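{- Let $k \geq 3$ and let $H$ be one of the following graphs: a spider with $k$ legs; the graph $\widetilde{C}_{2k+1}$; or the union of a path $P$ and a cycle $C$ such that $P$ has length at least $1$ and shares its endpoint and no other vertex with $C$. Then there is a graph $G$ such that $G$ is $H$-induced-saturated.
   Context: All graphs are finite and simple. For graphs $H,G$, write $H \subseteq_I G$ if $G$ contains an induced subgraph isomorphic to $H$. A graph $G$ on at least two vertices is $H$-induced-saturated if $H \not\subseteq_I G$, but $H \subseteq_I G - e$ for every edge $e \in E(G)$ and $H \subseteq_I G + e$ for every edge $e \in E(\overline{G})$ of the complement. A spider with $k$ legs is a union of $k$ paths, each of length at least $1$ (not necessarily equal lengths), that pairwise share exactly one common vertex $r$, which is an endpoint of each path. $\widetilde{C}_n$ is the union of the cycle $C_n$ on $n$ vertices and an edge $e$ whose endpoints are at distance $2$ in $C_n$. The length of a path is its number of edges. -}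

module Defs where

open import Level using (0ℓ)
open import Data.Bool using (Bool; T)
open import Data.Fin using (Fin; zero; toℕ)
open import Data.Nat using (ℕ; suc; _≤_)
open import Data.Nat.Properties using (1+n≢n)
open import Data.Product using (∃-syntax; Σ-syntax; _×_; _,_; proj₁)
open import Data.Sum using (_⊎_; inj₁; inj₂; [_,_]; swap)
open import Function.Base using (_∘_)
open import Function.Bundles using (_↔_; _⇔_; Inverse)
open import Function.Definitions using (Injective)
open import Relation.Binary.Core using (Rel)
open import Relation.Binary.Definitions using (Symmetric; Irreflexive; Decidable)
open import Relation.Binary.PropositionalEquality using (_≡_; _≢_; refl; sym; trans)
open import Relation.Nullary using (¬_)

record Graph : Set₁ where
  infix 4 _~_
  field
    V        : Set
    _~_      : Rel V 0ℓ
    ~-sym    : Symmetric _~_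
    ~-irrefl : Irreflexive _≡_ _~_

open Graph public using (V)

Adj : (G : Graph) → Rel (V G) 0ℓ
Adj = Graph._~_

-- Adjacency in a finite graph is required to be decidable, as it is classically.
record Finite (G : Graph) : Set where
  field
    order       : ℕ
    enumeration : V G ↔ Fin order
    adj?        : Decidable (Adj G)

record _≅_ (G H : Graph) : Set where
  field
    bijection : V G ↔ V H
    adj⇔      : ∀ x y → Adj G x y ⇔ Adj H (Inverse.to bijection x) (Inverse.to bijection y)

complement : Graph → Graph
complement G = record
  { V        = V G
  ; _~_      = λ x y → x ≢ y × ¬ Adj G x y
  ; ~-sym    = λ (x≢y , x≁y) → x≢y ∘ sym , x≁y ∘ Graph.~-sym G
  ; ~-irrefl = λ x≡y (x≢y , _) → x≢y x≡y
  }

-- {x , y} and {u , v} are the same unordered pair.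
SamePair : {A : Set} → A → A → A → A → Set
SamePair u v x y = (x ≡ u × y ≡ v) ⊎ (x ≡ v × y ≡ u)

SamePair-sym : {A : Set} (u v x y : A) → SamePair u v x y → SamePair u v y x
SamePair-sym _ _ _ _ (inj₁ (p , q)) = inj₂ (q , p)
SamePair-sym _ _ _ _ (inj₂ (p , q)) = inj₁ (q , p)

SamePair-irrefl : {A : Set} {u v x y : A} → u ≢ v → x ≡ y → ¬ SamePair u v x y
SamePair-irrefl u≢v x≡y (inj₁ (p , q)) = u≢v (trans (sym p) (trans x≡y q))
SamePair-irrefl u≢v x≡y (inj₂ (p , q)) = u≢v (trans (sym q) (trans (sym x≡y) p))

deleteEdge : (G : Graph) (u v : V G) → Graph
deleteEdge G u v = record
  { V        = V G
  ; _~_      = λ x y → Adj G x y × ¬ SamePair u v x y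
  ; ~-sym    = λ {x} {y} (x~y , ne) → Graph.~-sym G x~y , ne ∘ SamePair-sym u v y x
  ; ~-irrefl = λ x≡y (x~y , _) → Graph.~-irrefl G x≡y x~y
  }

addEdge : (G : Graph) (u v : V G) → u ≢ v → Graph
addEdge G u v u≢v = record
  { V        = V G
  ; _~_      = λ x y → Adj G x y ⊎ SamePair u v x y
  ; ~-sym    = λ {x} {y} → [ inj₁ ∘ Graph.~-sym G , inj₂ ∘ SamePair-sym u v x y ]
  ; ~-irrefl = λ x≡y → [ Graph.~-irrefl G x≡y , SamePair-irrefl u≢v x≡y ]
  }

inducedSubgraph : (G : Graph) → (V G → Bool) → Graph
inducedSubgraph G S = record
  { V        = Σ[ v ∈ V G ] T (S v)
  ; _~_      = λ x y → Adj G (proj₁ x) (proj₁ y)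
  ; ~-sym    = Graph.~-sym G
  ; ~-irrefl = λ { refl → Graph.~-irrefl G refl }
  }

infix 4 _⊆I_

_⊆I_ : Graph → Graph → Set
H ⊆I G = ∃[ S ] H ≅ inducedSubgraph G S

record InducedSaturated (H G : Graph) : Set where
  field
    twoVertices : ∃[ u ] ∃[ v ] (_≢_ {A = V G} u v)
    free        : ¬ (H ⊆I G)
    deletion    : ∀ u v → Adj G u v → H ⊆I deleteEdge G u v
    addition    : ∀ u v → (e : Adj (complement G) u v) → H ⊆I addEdge G u v (proj₁ e)

-- The path of length ℓ, with ℓ + 1 vertices; vertex zero is one of its endpoints.
path : ℕ → Graph
path ℓ = record
  { V        = Fin (suc ℓ)
  ; _~_      = λ i j → toℕ j ≡ suc (toℕ i) ⊎ toℕ i ≡ suc (toℕ j)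
  ; ~-sym    = swap
  ; ~-irrefl = λ { refl → [ 1+n≢n ∘ sym , 1+n≢n ∘ sym ] }
  }

-- j is the cyclic successor of i.
Next : {n : ℕ} → Rel (Fin n) 0ℓ
Next {n} i j = toℕ j ≡ suc (toℕ i) ⊎ (suc (toℕ i) ≡ n × toℕ j ≡ 0)

-- The cycle C_n when 3 ≤ n.  The conjunct i ≢ j is redundant there; it only
-- excludes the loop that Next has for n = 1.
cycle : ℕ → Graph
cycle n = record
  { V        = Fin n
  ; _~_      = λ i j → i ≢ j × (Next i j ⊎ Next j i)
  ; ~-sym    = λ (i≢j , adj) → i≢j ∘ sym , swap adj
  ; ~-irrefl = λ i≡j (i≢j , _) → i≢j i≡j
  }

data Walk (G : Graph) : V G → V G → ℕ → Set where
  []  : ∀ {u} → Walk G u u 0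
  _∷_ : ∀ {u v w n} → Adj G u v → Walk G v w n → Walk G u w (suc n)

Distance : (G : Graph) → V G → V G → ℕ → Set
Distance G u v d = Walk G u v d × (∀ m → Walk G u v m → d ≤ m)

distance2⇒≢ : (G : Graph) (u v : V G) → Distance G u v 2 → u ≢ v
distance2⇒≢ G u .u (_ , minimal) refl with minimal 0 []
... | ()

-- H is a copy of C̃_n.
IsC̃ : ℕ → Graph → Set
IsC̃ n H = ∃[ u ] ∃[ v ] Σ[ d ∈ Distance (cycle n) u v 2 ]
          (H ≅ addEdge (cycle n) u v (distance2⇒≢ (cycle n) u v d))

-- A not necessarily induced subgraph of H isomorphic to F.
record Copy (F H : Graph) : Set where
  field
    vertex    : V F → V H
    injective : Injective _≡_ _≡_ vertex
    edge      : ∀ {x y} → Adj F x y → Adj H (vertex x) (vertex y)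

open Copy public using (vertex)

OnVertex : {F H : Graph} → Copy F H → V H → Set
OnVertex c v = ∃[ x ] vertex c x ≡ v

OnEdge : {F H : Graph} → Copy F H → V H → V H → Set
OnEdge {F} c u v = ∃[ x ] ∃[ y ] (Adj F x y × vertex c x ≡ u × vertex c y ≡ v)

-- Each leg is oriented so that it starts at the common vertex r.
record IsSpider (k : ℕ) (H : Graph) : Set where
  field
    r          : V H
    legLength  : Fin k → ℕ
    nontrivial : ∀ i → 1 ≤ legLength i
    leg        : ∀ i → Copy (path (legLength i)) H
    start      : ∀ i → vertex (leg i) zero ≡ r
    meet       : ∀ i j → i ≢ j → ∀ v → OnVertex (leg i) v → OnVertex (leg j) v → v ≡ r
    vertices   : ∀ v → ∃[ i ] OnVertex (leg i) v
    edges      : ∀ u v → Adj H u v → ∃[ i ] OnEdge (leg i) u v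

-- The path is oriented so that it starts at the vertex shared with the cycle.
record IsCycleWithPath (H : Graph) : Set where
  field
    cycleLength : ℕ
    3≤length    : 3 ≤ cycleLength
    C           : Copy (cycle cycleLength) H
    pathLength  : ℕ
    nontrivial  : 1 ≤ pathLength
    P           : Copy (path pathLength) H
    shared      : OnVertex C (vertex P zero)
    meet        : ∀ v → OnVertex P v → OnVertex C v → v ≡ vertex P zero
    vertices    : ∀ v → OnVertex P v ⊎ OnVertex C v
    edges       : ∀ u v → Adj H u v → OnEdge P u v ⊎ OnEdge C u v

-- Every graph H of the theorem is a pattern on 0, …, n − 1, and a host is saturated as soon as it has no induced copy of
-- the pattern while every change of the adjacency of a single pair creates one.  Automorphisms leave few pairs to treat;
-- for those a small copy is given explicitly and lengthened by steps that use a fresh row and column (or symbol).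
--   * A spider with k legs: tuples of length k − 1, adjacent when they agree in some coordinate.  They contain no induced
--     star with k leaves by the pigeonhole principle, and fresh symbols prolong legs at will.
--   * C̃ with 2k + 1 vertices: a k × k board with two signs in each cell.  The edges of the long cycle are charged injectively
--     to the 2k lines.
--   * A cycle of length at least 4 with a path: a rook's graph, which has no induced claws.
--   * A triangle with a path of length l: an M × M rook's graph if l = 2M − 4; if l = 2M − 3 one row is replaced by two
--     copies of it with opposite signs, joined when signs and columns differ.  The vertices 0, 1, 2 of the triangle and
--     every second vertex of the path need M + 1 distinct columns (or rows).  The lengths 1 and 3 are sporadic.

module Submission where

open import Defs
open import Data.Bool using (Bool; true; false; T; _∧_; _∨_; _xor_; not; if_then_else_)
open import Data.Bool.Properties as B using (T-irrelevant; T-∨; T?; ∨-comm; ∧-comm)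
open import Data.Empty using (⊥; ⊥-elim)
open import Data.Fin as F using (Fin; zero; suc; toℕ; fromℕ<)
open import Data.Fin.Properties as FP using (any?; pigeonhole; injective⇒≤; toℕ-injective; toℕ-fromℕ<; toℕ<n)
open import Data.List as L using (List; []; _∷_; length; lookup; map; _++_; cartesianProduct; upTo)
open import Data.Bool.ListAction using (any; all)
open import Data.List.Properties using (length-map)
open import Data.List.Membership.Propositional using (_∈_)
open import Data.List.Membership.Propositional.Properties using (∈-lookup; ∈-map⁺; ∈-cartesianProduct⁺; ∈-cartesianProduct⁻; ∈-upTo⁺; ∈-upTo⁻)
open import Data.List.Relation.Unary.All as All using (All; []; _∷_)
open import Data.List.Relation.Unary.All.Properties using (map⁺; ++⁺; ++⁻ˡ; ++⁻ʳ)
open import Data.List.Relation.Unary.Any as Any using (here; there; index)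
open import Data.List.Relation.Unary.Any.Properties using (lookup-index)
open import Data.List.Relation.Unary.AllPairs using ([]; _∷_)
open import Data.List.Relation.Unary.Unique.Propositional using (Unique)
open import Data.Nat using (ℕ; zero; suc; _+_; _*_; _∸_; _≤_; _<_; z≤n; s≤s; _≡ᵇ_; _<ᵇ_)
open import Data.Nat.Properties as ℕP hiding (_≟_)
open import Data.Product using (Σ; Σ-syntax; ∃-syntax; _×_; _,_; proj₁; proj₂)
open import Data.Sum using (_⊎_; inj₁; inj₂; [_,_]′)
open import Data.Unit using (⊤; tt)
open import Function using (_∘_; id)
open import Function.Bundles using (_⇔_; mk↔ₛ′; mk⇔; Inverse; Equivalence)
open import Function.Construct.Composition using (_↔-∘_; _⇔-∘_)
open import Function.Construct.Symmetry using (↔-sym; ⇔-sym)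
open import Function.Definitions using (Injective)
open import Relation.Binary.PropositionalEquality using (_≡_; _≢_; refl; sym; trans; cong; cong₂; subst; subst₂)
open import Relation.Binary.Definitions using (tri<; tri≈; tri>)
open import Relation.Nullary using (¬_; Dec; yes; no)
open import Relation.Nullary.Decidable using (⌊_⌋; toWitness; fromWitness)
open import Data.List.Relation.Unary.Unique.Propositional.Properties using (cartesianProduct⁺; upTo⁺)
open import Data.Vec as Vec using (Vec; replicate; tabulate; _[_]≔_)
open import Data.Vec.Properties using (lookup∘update; lookup∘update′; lookup-replicate; lookup∘tabulate; tabulate∘lookup; tabulate-cong)
open import Data.List using (allFin)
open import Data.List.Properties using (length-tabulate)
open import Data.List.Relation.Unary.Unique.Propositional.Properties using () renaming (map⁺ to Unique-map⁺; allFin⁺ to Unique-allFin⁺)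
open import Data.List.Membership.Propositional.Properties using (∈-map⁻)
open import Relation.Nullary.Decidable using (¬?)
open import Data.List using (filter)
open import Data.List.Relation.Unary.Unique.Propositional.Properties using () renaming (filter⁺ to Unique-filter⁺)
open import Data.List.Membership.Propositional.Properties using (∈-filter⁺; ∈-filter⁻)

-- Deleting and adding an edge are one operation, the toggling of a pair; copies after a toggle are
-- built in an unbounded host, and a finite board is cut out afterwards. The triangle with a path is
-- the obstacle: unlike a longer cycle it has no claw at the attaching vertex, so rook's graphs do
-- contain it and only their size can exclude it. Each lengthening step costs a row and a column and
-- yields two vertices, so by such steps an M × M board serves one parity of the path length only.
-- The row with signs buys one more vertex, since equal signs in it are non-adjacent. The price is
-- that the count by rows may fail in that row and that a cell there can hold two vertices. Both
-- defects are repaired by one fact: the pattern has no cycle besides its triangle, whereas two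
-- vertices of one cell force short cycles. Cells with two vertices are the difficulty for C̃ as
-- well; there a long cycle of length at least 8 rules them out, and k = 3 is left to a search.

≡⇒T : ∀ {a} → a ≡ true → T a
≡⇒T refl = tt

T⇒≡ : ∀ {a} → T a → a ≡ true
T⇒≡ {true} _ = refl

¬T⇒≡ : ∀ {a} → ¬ T a → a ≡ false
¬T⇒≡ {true} f = ⊥-elim (f tt)
¬T⇒≡ {false} _ = refl

T-cong : ∀ {a b} → a ≡ b → T a ⇔ T b
T-cong refl = mk⇔ id id

T-ext : ∀ {a b} → (T a → T b) → (T b → T a) → a ≡ b
T-ext {true} {true} _ _ = refl
T-ext {true} {false} f _ = ⊥-elim (f tt)
T-ext {false} {true} _ g = ⊥-elim (g tt)
T-ext {false} {false} _ _ = refl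

∧-intro : ∀ {a b} → T a → T b → T (a ∧ b)
∧-intro {true} _ q = q

∧-elim₁ : ∀ {a b} → T (a ∧ b) → T a
∧-elim₁ {true} _ = tt

∧-elim₂ : ∀ {a b} → T (a ∧ b) → T b
∧-elim₂ {true} q = q

-- Induced subgraphs as embeddings

≅-sym : ∀ {G H} → G ≅ H → H ≅ G
≅-sym {G} {H} e = record
  { bijection = ↔-sym bijection
  ; adj⇔ = λ x y → mk⇔
      (λ a → Equivalence.from (adj⇔ (from x) (from y)) (subst₂ (Adj H) (sym (inverseˡ′ x)) (sym (inverseˡ′ y)) a))
      (λ a → subst₂ (Adj H) (inverseˡ′ x) (inverseˡ′ y) (Equivalence.to (adj⇔ (from x) (from y)) a))
  }
  where
  open _≅_ e
  open Inverse bijection using (to; from; inverseˡ)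
  inverseˡ′ : ∀ x → to (from x) ≡ x
  inverseˡ′ x = inverseˡ refl

≅-trans : ∀ {G H K} → G ≅ H → H ≅ K → G ≅ K
≅-trans e f = record
  { bijection = _≅_.bijection f ↔-∘ _≅_.bijection e
  ; adj⇔ = λ x y → _≅_.adj⇔ f _ _ ⇔-∘ _≅_.adj⇔ e x y
  }

⊆I-resp-≅ : ∀ {H K G} → H ≅ K → K ⊆I G → H ⊆I G
⊆I-resp-≅ e (S , i) = S , ≅-trans e i

record Embedding (P G : Graph) : Set where
  field
    vert : V P → V G
    inj  : ∀ {x y} → vert x ≡ vert y → x ≡ y
    adj⇔ : ∀ x y → Adj P x y ⇔ Adj G (vert x) (vert y)

Σ-T-≡ : ∀ {A : Set} {S : A → Bool} {x y : Σ A (T ∘ S)} → proj₁ x ≡ proj₁ y → x ≡ y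
Σ-T-≡ {x = a , p} {.a , q} refl = cong (a ,_) (T-irrelevant p q)

⊆I⇒embedding : ∀ {P G} → P ⊆I G → Embedding P G
⊆I⇒embedding {P} {G} (S , i) = record
  { vert = proj₁ ∘ to
  ; inj  = λ {x} {y} e → trans (sym (inverseʳ refl)) (trans (cong from (Σ-T-≡ {S = S} e)) (inverseʳ refl))
  ; adj⇔ = _≅_.adj⇔ i
  }
  where
  open Inverse (_≅_.bijection i) using (to; from; inverseʳ)

-- Patterns: the vertices are numbered, and B i j for i < j tells whether j is joined to the earlier i.

patAdj : (ℕ → ℕ → Bool) → ℕ → ℕ → Bool
patAdj B i j = ((i <ᵇ j) ∧ B i j) ∨ ((j <ᵇ i) ∧ B j i)

n≮ᵇn : ∀ n → (n <ᵇ n) ≡ false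
n≮ᵇn zero = refl
n≮ᵇn (suc n) = n≮ᵇn n

patAdj-< : ∀ B {i j} → i < j → patAdj B i j ≡ B i j
patAdj-< B {i} {j} i<j rewrite T⇒≡ (<⇒<ᵇ i<j) | ¬T⇒≡ (λ t → <-asym i<j (<ᵇ⇒< j i t)) with B i j
... | true = refl
... | false = refl

Pat : (ℕ → ℕ → Bool) → ℕ → Graph
Pat B n = record
  { V = Fin n
  ; _~_ = λ i j → T (patAdj B (toℕ i) (toℕ j))
  ; ~-sym = λ {i} {j} → subst T (∨-comm ((toℕ i <ᵇ toℕ j) ∧ B (toℕ i) (toℕ j)) _)
  ; ~-irrefl = λ { {i} refl a → irr (toℕ i) a }
  }
  where
  irr : ∀ k → ¬ T (patAdj B k k)
  irr k a rewrite n≮ᵇn k = a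

-- The image of the pattern becomes a Boolean subset by a search over the finite pattern; the
-- equation `V G ≡ Fin N` supplies the decidable equality of vertices.
embedding⇒⊆I : ∀ {B n G N} → (iso : V G ≡ Fin N) → Embedding (Pat B n) G → Pat B n ⊆I G
embedding⇒⊆I {B} {n} {G} refl e = S , record
  { bijection = mk↔ₛ′ to from to∘from from∘to
  ; adj⇔ = adj⇔
  }
  where
  open Embedding e
  S : V G → Bool
  S v = ⌊ any? (λ i → vert i FP.≟ v) ⌋
  to : Fin n → Σ (V G) (T ∘ S)
  to i = vert i , fromWitness (i , refl)
  from : Σ (V G) (T ∘ S) → Fin n
  from (v , p) = proj₁ (toWitness p)
  to∘from : ∀ y → to (from y) ≡ y
  to∘from (v , p) = Σ-T-≡ {S = S} (proj₂ (toWitness p))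
  from∘to : ∀ i → from (to i) ≡ i
  from∘to i = inj (proj₂ (toWitness (fromWitness {a? = any? (λ j → vert j FP.≟ vert i)} (i , refl))))

-- A host before a finite vertex set is cut out of it. There may be infinitely many vertices, so
-- fresh symbols are always at hand, and adjacency is Boolean, so explicit copies are checked by
-- evaluation.
record Raw : Set₁ where
  field
    R        : Set
    eq       : R → R → Bool
    eq-sound : ∀ x y → T (eq x y) → x ≡ y
    eq-refl  : ∀ x → T (eq x x)
    adj      : R → R → Bool
    adj-sym  : ∀ x y → T (adj x y) → T (adj y x)
    adj-irr  : ∀ x → ¬ T (adj x x)

bool-eq : Bool → Bool → Bool
bool-eq true b = b
bool-eq false b = not b

bool-eq-sound : ∀ {a b} → T (bool-eq a b) → a ≡ b
bool-eq-sound {true} {true} _ = refl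
bool-eq-sound {false} {false} _ = refl

bool-eq-refl : ∀ {a b} → a ≡ b → T (bool-eq a b)
bool-eq-refl {true} refl = tt
bool-eq-refl {false} refl = tt

lookup-injective : ∀ {A : Set} {xs : List A} → Unique xs → ∀ {i j} → lookup xs i ≡ lookup xs j → i ≡ j
lookup-injective (_ ∷ _) {zero} {zero} _ = refl
lookup-injective {xs = _ ∷ xs} (p ∷ _) {zero} {suc j} e = ⊥-elim (All.lookup p (∈-lookup {xs = xs} j) e)
lookup-injective {xs = _ ∷ xs} (p ∷ _) {suc i} {zero} e = ⊥-elim (All.lookup p (∈-lookup {xs = xs} i) (sym e))
lookup-injective (_ ∷ u) {suc i} {suc j} e = cong suc (lookup-injective u e)

-- Copies of a pattern in a host with one toggled pair

module Realisation (raw : Raw) (B : ℕ → ℕ → Bool) where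
  open Raw raw

  -- Sequences are stored with the newest vertex first, so a vertex has as index the length of the rest.
  fits : (R → R → Bool) → ℕ → R → List R → Bool
  fits a n y [] = true
  fits a n y (z ∷ zs) = (not (eq z y) ∧ bool-eq (a z y) (B (length zs) n)) ∧ fits a n y zs

  ind : (R → R → Bool) → List R → Bool
  ind a [] = true
  ind a (y ∷ ys) = fits a (length ys) y ys ∧ ind a ys

  -- Exclusive or with the pair of u and v removes the edge if it is there and adds it if not, so
  -- deletion and addition share every later argument.
  flip : R → R → R → R → Bool
  flip u v x y = adj x y xor ((eq x u ∧ eq y v) ∨ (eq x v ∧ eq y u))

  eq-≢ : ∀ {x y} → x ≢ y → eq x y ≡ false
  eq-≢ {x} {y} ne = ¬T⇒≡ (ne ∘ eq-sound x y)

  flip-comm : ∀ u v x y → flip u v x y ≡ flip v u x y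
  flip-comm u v x y = cong (adj x y xor_) (∨-comm (eq x u ∧ eq y v) _)

  at : (xs : List R) → ∀ i → i < length xs → R
  at (x ∷ xs) i p with i ℕP.≟ length xs
  ... | yes _ = x
  ... | no ne = at xs i (≤∧≢⇒< (≤-pred p) ne)

  at-top : ∀ z zs p → at (z ∷ zs) (length zs) p ≡ z
  at-top z zs p with length zs ℕP.≟ length zs
  ... | yes _ = refl
  ... | no ne = ⊥-elim (ne refl)

  at-lower : ∀ z zs i p q → at (z ∷ zs) i p ≡ at zs i q
  at-lower z zs i p q with i ℕP.≟ length zs
  ... | yes refl = ⊥-elim (<-irrefl refl q)
  ... | no _ = cong (at zs i) (<-irrelevant _ _)

  at-fits : ∀ a n y xs → T (fits a n y xs) → ∀ i p → at xs i p ≢ y × a (at xs i p) y ≡ B i n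
  at-fits a n y (x ∷ xs) f i p with i ℕP.≟ length xs
  ... | yes refl = (λ { refl → ne (eq-refl x) }) , bool-eq-sound (∧-elim₂ {not (eq x y)} (∧-elim₁ {not (eq x y) ∧ _} f))
    where
    ne : ¬ T (eq x y)
    ne t with eq x y | ∧-elim₁ {not (eq x y)} (∧-elim₁ {not (eq x y) ∧ _} f)
    ... | true | ()
    ... | false | _ = t
  ... | no ne = at-fits a n y xs (∧-elim₂ {not (eq x y) ∧ bool-eq (a x y) (B (length xs) n)} f) i _

  at-ind : ∀ a xs → T (ind a xs) → ∀ i j p q → i < j → at xs i p ≢ at xs j q × a (at xs i p) (at xs j q) ≡ B i j
  at-ind a (x ∷ xs) t i j p q i<j with i ℕP.≟ length xs | j ℕP.≟ length xs
  ... | yes refl | _ = ⊥-elim (<⇒≱ i<j (≤-pred q))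
  ... | no ne | yes refl = at-fits a (length xs) x xs (∧-elim₁ {fits a (length xs) x xs} t) i _
  ... | no ne | no ne′ = at-ind a xs (∧-elim₂ {fits a (length xs) x xs} t) i j _ _ i<j

  at-All : ∀ {P : R → Set} xs → All P xs → ∀ i p → P (at xs i p)
  at-All (x ∷ xs) (px ∷ pxs) i p with i ℕP.≟ length xs
  ... | yes _ = px
  ... | no _ = at-All xs pxs i _

  module _ (a : R → R → Bool) where
    fits-map : ∀ {a′ : R → R → Bool} (f : R → R) → (∀ {x y} → f x ≡ f y → x ≡ y) → (∀ x y → a′ (f x) (f y) ≡ a x y) →
               ∀ n y xs → fits a′ n (f y) (map f xs) ≡ fits a n y xs
    fits-map f inj h n y [] = refl
    fits-map {a′} f inj h n y (x ∷ xs) = cong₂ _∧_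
      (cong₂ (λ b c → not b ∧ c)
        (T-ext {eq (f x) (f y)} {eq x y}
          (λ t → subst (λ z → T (eq x z)) (inj (eq-sound _ _ t)) (eq-refl x))
          (λ t → subst (λ z → T (eq (f x) (f z))) (eq-sound _ _ t) (eq-refl (f x))))
        (cong₂ (λ b k → bool-eq b (B k n)) (h x y) (length-map f xs)))
      (fits-map f inj h n y xs)

    ind-map : ∀ {a′ : R → R → Bool} (f : R → R) → (∀ {x y} → f x ≡ f y → x ≡ y) → (∀ x y → a′ (f x) (f y) ≡ a x y) →
              ∀ xs → ind a′ (map f xs) ≡ ind a xs
    ind-map f inj h [] = refl
    ind-map {a′} f inj h (x ∷ xs) = cong₂ _∧_
      (trans (cong (λ k → fits a′ k (f x) (map f xs)) (length-map f xs)) (fits-map f inj h (length xs) x xs))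
      (ind-map f inj h xs)

  fits-cong : ∀ {a b : R → R → Bool} → (∀ x y → a x y ≡ b x y) → ∀ n y xs → fits a n y xs ≡ fits b n y xs
  fits-cong h n y [] = refl
  fits-cong h n y (x ∷ xs) = cong₂ _∧_
    (cong (λ b → not (eq x y) ∧ bool-eq b (B (length xs) n)) (h x y)) (fits-cong h n y xs)

  ind-cong : ∀ {a b : R → R → Bool} → (∀ x y → a x y ≡ b x y) → ∀ xs → ind a xs ≡ ind b xs
  ind-cong h [] = refl
  ind-cong h (x ∷ xs) = cong₂ _∧_ (fits-cong h (length xs) x xs) (ind-cong h xs)

  -- The predicate `D` records the region that holds the copy; it can be enlarged afterwards, so the
  -- final size of the host need not be fixed while the copy grows.
  record Realises (D : R → Set) (n : ℕ) (a : R → R → Bool) : Set where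
    constructor realises
    field
      verts   : List R
      induced : T (ind a verts)
      inside  : All D verts
      size    : length verts ≡ n

  realises-cong : ∀ {D n a b} → (∀ x y → a x y ≡ b x y) → Realises D n a → Realises D n b
  realises-cong h (realises xs i d s) = realises xs (subst T (ind-cong h xs) i) d s

  -- Symmetries of the host carry a copy for one toggled pair to a copy for the image of that pair;
  -- one pair per orbit remains to be treated.
  realises-map : ∀ {D n u v} (f : R → R) → (∀ {x y} → f x ≡ f y → x ≡ y) → (∀ x y → adj (f x) (f y) ≡ adj x y) →
                 (∀ {x} → D x → D (f x)) → Realises D n (flip u v) → Realises D n (flip (f u) (f v))
  realises-map {u = u} {v} f inj h fd (realises xs i d s) =
    realises (map f xs) (subst T (sym (ind-map (flip u v) f inj h′ xs)) i) (map⁺ (All.map fd d))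
             (trans (length-map f xs) s)
    where
    e : ∀ x y → eq (f x) (f y) ≡ eq x y
    e x y = T-ext (λ t → subst (λ z → T (eq x z)) (inj (eq-sound _ _ t)) (eq-refl x))
                  (λ t → subst (λ z → T (eq (f x) (f z))) (eq-sound _ _ t) (eq-refl (f x)))
    h′ : ∀ x y → flip (f u) (f v) (f x) (f y) ≡ flip u v x y
    h′ x y rewrite h x y | e x u | e y v | e x v | e y u = refl

  module Host (dom : List R) (uniq : Unique dom) where
    N : ℕ
    N = length dom

    graph : Graph
    graph = record
      { V = Fin N
      ; _~_ = λ i j → T (adj (lookup dom i) (lookup dom j))
      ; ~-sym = λ {i} {j} → adj-sym (lookup dom i) (lookup dom j)
      ; ~-irrefl = λ { {i} refl → adj-irr (lookup dom i) }
      }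

    finite : Finite graph
    finite = record
      { order = N
      ; enumeration = mk↔ₛ′ id id (λ _ → refl) (λ _ → refl)
      ; adj? = λ i j → T? _
      }

    SamePair-flip : ∀ u v x y → SamePair u v x y ⇔
      T ((eq (lookup dom x) (lookup dom u) ∧ eq (lookup dom y) (lookup dom v)) ∨
         (eq (lookup dom x) (lookup dom v) ∧ eq (lookup dom y) (lookup dom u)))
    SamePair-flip u v x y = mk⇔
      (λ { (inj₁ (refl , refl)) → Equivalence.from T-∨ (inj₁ (∧-intro (eq-refl _) (eq-refl _)))
         ; (inj₂ (refl , refl)) → Equivalence.from T-∨ (inj₂ (∧-intro (eq-refl _) (eq-refl _))) })
      (λ t → [ (λ s → inj₁ (l (∧-elim₁ s) , l (∧-elim₂ {eq (lookup dom x) (lookup dom u)} s)))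
             , (λ s → inj₂ (l (∧-elim₁ s) , l (∧-elim₂ {eq (lookup dom x) (lookup dom v)} s))) ]′
             (Equivalence.to T-∨ t))
      where
      l : ∀ {i j} → T (eq (lookup dom i) (lookup dom j)) → i ≡ j
      l t = lookup-injective uniq (eq-sound _ _ t)

    private
      pick : ∀ {x} → x ∈ dom → Fin N
      pick = index

      pick-lookup : ∀ {x} (p : x ∈ dom) → lookup dom (pick p) ≡ x
      pick-lookup p = sym (lookup-index p)

    embed : ∀ {n a} (G : Graph) (e : V G ≡ Fin N) →
            (∀ x y → Adj G (subst id (sym e) x) (subst id (sym e) y) ⇔ T (a (lookup dom x) (lookup dom y))) →
            (∀ x y → T (a x y) → T (a y x)) → (∀ x → ¬ T (a x x)) →
            Realises (_∈ dom) n a → Pat B n ⊆I G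
    embed {n} {a} G refl adj⇔ a-sym a-irr (realises xs i d refl) = embedding⇒⊆I {B} {length xs} {G} {N} refl record
      { vert = vert
      ; inj = λ {x} {y} → inj x y
      ; adj⇔ = λ x y → ⇔-sym (adj⇔ (vert x) (vert y)) ⇔-∘ T-cong {patAdj B (toℕ x) (toℕ y)} (agree x y)
      }
      where
      r : Fin (length xs) → R
      r k = at xs (toℕ k) (toℕ<n k)
      vert : Fin (length xs) → Fin N
      vert k = pick (at-All xs d (toℕ k) (toℕ<n k))
      vert-r : ∀ k → lookup dom (vert k) ≡ r k
      vert-r k = pick-lookup (at-All xs d (toℕ k) (toℕ<n k))
      inj : ∀ x y → vert x ≡ vert y → x ≡ y
      inj x y e with <-cmp (toℕ x) (toℕ y)
      ... | tri< l _ _ = ⊥-elim (proj₁ (at-ind a xs i (toℕ x) (toℕ y) (toℕ<n x) (toℕ<n y) l)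
                           (trans (sym (vert-r x)) (trans (cong (lookup dom) e) (vert-r y))))
      ... | tri≈ _ q _ = toℕ-injective q
      ... | tri> _ _ l = ⊥-elim (proj₁ (at-ind a xs i (toℕ y) (toℕ x) (toℕ<n y) (toℕ<n x) l)
                           (trans (sym (vert-r y)) (trans (cong (lookup dom) (sym e)) (vert-r x))))
      a-comm : ∀ x y → a x y ≡ a y x
      a-comm x y = T-ext (a-sym x y) (a-sym y x)
      agree : ∀ x y → patAdj B (toℕ x) (toℕ y) ≡ a (lookup dom (vert x)) (lookup dom (vert y))
      agree x y rewrite vert-r x | vert-r y with <-cmp (toℕ x) (toℕ y)
      ... | tri< l _ _ = trans (patAdj-< B l) (sym (proj₂ (at-ind a xs i (toℕ x) (toℕ y) (toℕ<n x) (toℕ<n y) l)))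
      ... | tri> _ _ l = trans (∨-comm ((toℕ x <ᵇ toℕ y) ∧ B (toℕ x) (toℕ y)) _)
            (trans (patAdj-< B l) (trans (sym (proj₂ (at-ind a xs i (toℕ y) (toℕ x) (toℕ<n y) (toℕ<n x) l))) (a-comm _ _)))
      ... | tri≈ _ q _ rewrite toℕ-injective q =
            trans (cong₂ (λ b c → (b ∧ B (toℕ y) (toℕ y)) ∨ (c ∧ B (toℕ y) (toℕ y))) (n≮ᵇn (toℕ y)) (n≮ᵇn (toℕ y)))
                  (sym (¬T⇒≡ (a-irr (r y))))

    record Hosts (n : ℕ) : Set where
      field
        free  : ¬ Embedding (Pat B n) graph
        flips : ∀ u v → u ∈ dom → v ∈ dom → u ≢ v → Realises (_∈ dom) n (flip u v)
        two   : ∃[ u ] ∃[ v ] (u ∈ dom × v ∈ dom × u ≢ v)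

    saturated : ∀ {n H} → H ≅ Pat B n → Hosts n → InducedSaturated H graph
    saturated {n} {H} iso h = record
      { twoVertices = let (u , v , p , q , ne) = two in
          index p , index q , λ e → ne (trans (lookup-index p) (trans (cong (lookup dom) e) (sym (lookup-index q))))
      ; free = λ H⊆G → free (⊆I⇒embedding {Pat B n} {graph} (⊆I-resp-≅ {Pat B n} {H} {graph} (≅-sym {H} {Pat B n} iso) H⊆G))
      ; deletion = λ u v uv → ⊆I-resp-≅ {H} {Pat B n} {deleteEdge graph u v} iso
          (embed {n} (deleteEdge graph u v) refl (del u v uv) (flip-sym u v) (flip-irr u v (λ e → adj-irr _ (subst (λ z → T (adj (lookup dom u) (lookup dom z))) (sym e) uv)))
            (flips _ _ (∈-lookup u) (∈-lookup v)
              (λ e → adj-irr _ (subst (λ z → T (adj (lookup dom u) z)) (sym e) uv))))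
      ; addition = λ u v e → ⊆I-resp-≅ {H} {Pat B n} {addEdge graph u v (proj₁ e)} iso
          (embed {n} (addEdge graph u v (proj₁ e)) refl (add u v (proj₂ e)) (flip-sym u v) (flip-irr u v (proj₁ e))
            (flips _ _ (∈-lookup u) (∈-lookup v) (proj₁ e ∘ lookup-injective uniq)))
      }
      where
      open Hosts h
      F : Fin N → Fin N → Fin N → Fin N → Bool
      F u v x y = (eq (lookup dom x) (lookup dom u) ∧ eq (lookup dom y) (lookup dom v)) ∨
                  (eq (lookup dom x) (lookup dom v) ∧ eq (lookup dom y) (lookup dom u))
      pair-adj : ∀ u v x y → SamePair u v x y → T (adj (lookup dom u) (lookup dom v)) → T (adj (lookup dom x) (lookup dom y))
      pair-adj u v x y (inj₁ (refl , refl)) a = a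
      pair-adj u v x y (inj₂ (refl , refl)) a = adj-sym _ _ a
      del : ∀ u v → T (adj (lookup dom u) (lookup dom v)) → ∀ x y →
            (T (adj (lookup dom x) (lookup dom y)) × ¬ SamePair u v x y) ⇔ T (adj (lookup dom x) (lookup dom y) xor F u v x y)
      del u v uv x y with adj (lookup dom x) (lookup dom y) | F u v x y | SamePair-flip u v x y | pair-adj u v x y
      ... | true | true | s | _ = mk⇔ (λ (_ , ns) → ns (Equivalence.from s tt)) (λ ())
      ... | true | false | s | _ = mk⇔ (λ _ → tt) (λ _ → tt , Equivalence.to s)
      ... | false | true | s | p = ⊥-elim (p (Equivalence.from s tt) uv)
      ... | false | false | s | _ = mk⇔ proj₁ (λ ())
      add : ∀ u v → ¬ T (adj (lookup dom u) (lookup dom v)) → ∀ x y →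
            (T (adj (lookup dom x) (lookup dom y)) ⊎ SamePair u v x y) ⇔ T (adj (lookup dom x) (lookup dom y) xor F u v x y)
      add u v nuv x y with adj (lookup dom x) (lookup dom y) in eqn | F u v x y | SamePair-flip u v x y
      ... | true | true | s = ⊥-elim (nuv (nonadj (Equivalence.from s tt)))
        where
        nonadj : SamePair u v x y → T (adj (lookup dom u) (lookup dom v))
        nonadj (inj₁ (refl , refl)) = ≡⇒T eqn
        nonadj (inj₂ (refl , refl)) = adj-sym _ _ (≡⇒T eqn)
      ... | true | false | s = mk⇔ (λ _ → tt) (λ _ → inj₁ tt)
      ... | false | true | s = mk⇔ (λ _ → tt) (λ _ → inj₂ (Equivalence.from s tt))
      ... | false | false | s = mk⇔ [ (λ ()) , Equivalence.to s ]′ (λ ())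
      flip-sym : ∀ u v x y → T (flip (lookup dom u) (lookup dom v) x y) → T (flip (lookup dom u) (lookup dom v) y x)
      flip-sym u v x y = subst T (cong₂ _xor_ (T-ext (adj-sym x y) (adj-sym y x))
        (trans (∨-comm (eq x (lookup dom u) ∧ eq y (lookup dom v)) _)
          (cong₂ _∨_ (∧-comm (eq x (lookup dom v)) _) (∧-comm (eq x (lookup dom u)) _))))
      flip-irr : ∀ u v → u ≢ v → ∀ x → ¬ T (flip (lookup dom u) (lookup dom v) x x)
      flip-irr u v ne x t with adj x x | adj-irr x | eq x (lookup dom u) in e₁ | eq x (lookup dom v) in e₂
      ... | true | ¬t | _ | _ = ¬t tt
      ... | false | _ | true | true = ne (lookup-injective uniq (trans (sym (eq-sound _ _ (≡⇒T e₁))) (eq-sound _ _ (≡⇒T e₂))))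
      flip-irr u v ne x () | false | _ | true | false
      flip-irr u v ne x () | false | _ | false | true
      flip-irr u v ne x () | false | _ | false | false

    exists : ∀ {n H} → H ≅ Pat B n → Hosts n → ∃[ G ] (Finite G × InducedSaturated H G)
    exists iso h = graph , finite , saturated iso h

    -- Backtracking over partial copies: a new vertex is compared with the earlier ones as soon as
    -- it is chosen, which prunes enough for evaluation on small hosts.
    search : (R → R → Bool) → ℕ → List R → Bool
    search a zero xs = true
    search a (suc k) xs = any (λ y → fits a (length xs) y xs ∧ search a k (y ∷ xs)) dom

    private
      any-find : ∀ (p : R → Bool) ys → T (any p ys) → ∃[ y ] (y ∈ ys × T (p y))
      any-find p (y ∷ ys) t with p y in e
      ... | true = y , here refl , ≡⇒T e
      ... | false = let (z , m , q) = any-find p ys t in z , there m , q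

      any-intro : ∀ (p : R → Bool) {y ys} → y ∈ ys → T (p y) → T (any p ys)
      any-intro p {y} (here refl) t rewrite T⇒≡ t = tt
      any-intro p {ys = z ∷ ys} (there m) t with p z
      ... | true = tt
      ... | false = any-intro p m t

    search-sound : ∀ a k xs → T (ind a xs) → All (_∈ dom) xs → T (search a k xs) → Realises (_∈ dom) (k + length xs) a
    search-sound a zero xs i d _ = realises xs i d refl
    search-sound a (suc k) xs i d t =
      let (y , m , s) = any-find _ dom t
          r = search-sound a k (y ∷ xs) (∧-intro (∧-elim₁ s) i) (m ∷ d) (∧-elim₂ {fits a (length xs) y xs} s)
      in subst (λ n → Realises (_∈ dom) n a) (+-suc k (length xs)) r

    search-free : ∀ n → search adj n [] ≡ false → ¬ Embedding (Pat B n) graph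
    search-free n none e = subst T none (go n zero (+-identityʳ n) [] refl (λ { _ () }))
      where
      open Embedding e
      -- the copy itself, read off in order, is a successful branch
      go : ∀ k j → (kj : k + j ≡ n) → (xs : List R) → (len : length xs ≡ j) →
           (∀ i (p : i < length xs) → ∃[ q ] at xs i p ≡ lookup dom (vert (fromℕ< {i} {n} q))) → T (search adj k xs)
      go zero j kj xs len h = tt
      go (suc k) j kj xs refl h = any-intro (λ y′ → fits adj (length xs) y′ xs ∧ search adj k (y′ ∷ xs)) {ys = dom} (∈-lookup (vert y)) (∧-intro (fit xs h {≤-refl}) (go k (suc j) (trans (+-suc k j) kj) (Y ∷ xs) refl h′))
        where
        j<n : j < n
        j<n = subst (suc j ≤_) (trans (+-suc k j) kj) (m≤n+m (suc j) k)
        y = fromℕ< j<n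
        Y = lookup dom (vert y)
        fit : ∀ zs → (∀ i (p : i < length zs) → ∃[ q ] at zs i p ≡ lookup dom (vert (fromℕ< {i} {n} q))) →
              {l : length zs ≤ j} → T (fits adj j Y zs)
        fit [] h = tt
        fit (z ∷ zs) h {l} = ∧-intro (∧-intro
            (subst (T ∘ not) (sym (eq-≢ (λ e′ → <⇒≢ l (trans (sym (toℕ-fromℕ< q)) (trans (cong toℕ (inj (lookup-injective uniq (trans (sym z≡) e′)))) (toℕ-fromℕ< j<n)))))) tt)
            (bool-eq-refl (trans (cong (λ r → adj r Y) z≡)
              (trans (sym (T-ext (Equivalence.to (adj⇔ (fromℕ< q) y)) (Equivalence.from (adj⇔ (fromℕ< q) y))))
                (trans (cong₂ (patAdj B) (toℕ-fromℕ< q) (toℕ-fromℕ< j<n)) (patAdj-< B {_} {_} l))))))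
            (fit zs (λ i p → proj₁ (h i (m≤n⇒m≤1+n p)) , trans (sym (at-lower z zs i _ p)) (proj₂ (h i (m≤n⇒m≤1+n p)))) {<⇒≤ l})
          where
          q = proj₁ (h (length zs) ≤-refl)
          z≡ : z ≡ lookup dom (vert (fromℕ< q))
          z≡ = trans (sym (at-top z zs ≤-refl)) (proj₂ (h (length zs) ≤-refl))
        h′ : ∀ i (p : i < suc j) → ∃[ q ] at (Y ∷ xs) i p ≡ lookup dom (vert (fromℕ< {i} {n} q))
        h′ i p with i ℕP.≟ j
        ... | yes refl = j<n , refl
        ... | no _ = h i _

    allPairs : (R → R → Bool) → Bool
    allPairs p = all (λ u → all (p u) dom) dom

    private
      all-∈ : ∀ (p : R → Bool) {y ys} → T (all p ys) → y ∈ ys → T (p y)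
      all-∈ p {ys = z ∷ ys} t (here refl) = ∧-elim₁ t
      all-∈ p {ys = z ∷ ys} t (there m) = all-∈ p (∧-elim₂ {p z} t) m

    -- Both Boolean hypotheses are closed equations for a concrete small host, so that `refl` proves
    -- them by running the search on the host and on each of its toggled versions.
    searched : ∀ n → search adj n [] ≡ false → allPairs (λ u v → eq u v ∨ search (flip u v) n []) ≡ true →
               (∃[ u ] ∃[ v ] (u ∈ dom × v ∈ dom × u ≢ v)) → Hosts n
    searched n none all two = record
      { free = search-free n none
      ; flips = λ u v mu mv ne → [ (λ e → ⊥-elim (ne (eq-sound u v e))) , (λ s → subst (λ k → Realises (_∈ dom) k (flip u v)) (+-identityʳ n) (search-sound (flip u v) n [] tt [] s)) ]′
            (Equivalence.to (T-∨ {eq u v}) (all-∈ _ (all-∈ _ (≡⇒T all) mu) mv))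
      ; two = two
      }

∨-elim : ∀ a {b} → T (a ∨ b) → T a ⊎ T b
∨-elim a = Equivalence.to (T-∨ {a})

-- Lollipops with the path attached to vertex q − 1 of the cycle 0, …, q − 1

lol : ℕ → ℕ → ℕ → Bool
lol q i j = (j ≡ᵇ suc i) ∨ ((i ≡ᵇ 0) ∧ (suc j ≡ᵇ q))

≡ᵇ-refl : ∀ n → T (n ≡ᵇ n)
≡ᵇ-refl n = ≡⇒≡ᵇ n n refl

-- Adjacency tests ordinary differences. On the vertices 0, ..., n - 1 this is a circulant graph
-- when `D` contains n - d along with every d.
circulant : ℕ → List ℕ → Raw
circulant n D = record
  { R = ℕ
  ; eq = _≡ᵇ_
  ; eq-sound = ≡ᵇ⇒≡
  ; eq-refl = ≡ᵇ-refl
  ; adj = λ x y → not (x ≡ᵇ y) ∧ (any (λ d → (x + d ≡ᵇ y) ∨ (y + d ≡ᵇ x)) D)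
  ; adj-sym = λ x y t → ∧-intro (subst (T ∘ not) (T-ext (λ e → ≡⇒≡ᵇ y x (sym (≡ᵇ⇒≡ x y e))) (λ e → ≡⇒≡ᵇ x y (sym (≡ᵇ⇒≡ y x e)))) (∧-elim₁ t))
                                (comm x y D (∧-elim₂ {not (x ≡ᵇ y)} t))
  ; adj-irr = λ x t → irr x (∧-elim₁ t)
  }
  where
  comm : ∀ x y D → T (any (λ d → (x + d ≡ᵇ y) ∨ (y + d ≡ᵇ x)) D) → T (any (λ d → (y + d ≡ᵇ x) ∨ (x + d ≡ᵇ y)) D)
  comm x y (d ∷ D) t = Equivalence.from T-∨ ([ inj₁ ∘ subst T (∨-comm (x + d ≡ᵇ y) _) , inj₂ ∘ comm x y D ]′
    (∨-elim ((x + d ≡ᵇ y) ∨ (y + d ≡ᵇ x)) t))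
  irr : ∀ x → ¬ T (not (x ≡ᵇ x))
  irr x t with x ≡ᵇ x | ≡ᵇ-refl x
  ... | true | _ = t

-- Prolonging an induced copy by one vertex

module Growth (raw : Raw) (B : ℕ → ℕ → Bool) where
  open Raw raw
  open Realisation raw B public

  Apart : (R → R → Bool) → R → R → Set
  Apart a y z = z ≢ y × a z y ≡ false

  fits-apart : ∀ {a n y xs} → All (Apart a y) xs → (∀ i → i < length xs → B i n ≡ false) → T (fits a n y xs)
  fits-apart [] _ = tt
  fits-apart {a} {n} {y} {x ∷ xs} ((ne , na) ∷ r) b = ∧-intro
    (∧-intro (subst (T ∘ not) (sym (eq-≢ ne)) tt) (bool-eq-refl (trans na (sym (b (length xs) ≤-refl)))))
    (fits-apart {a} {n} {y} {xs} r (λ i p → b i (m≤n⇒m≤1+n p)))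

  fits-next : ∀ {a n y x xs} → x ≢ y → a x y ≡ true → B (length xs) n ≡ true → T (fits a n y xs) → T (fits a n y (x ∷ xs))
  fits-next ne ad b f = ∧-intro (∧-intro (subst (T ∘ not) (sym (eq-≢ ne)) tt) (bool-eq-refl (trans ad (sym b)))) f

  extend : ∀ {a y x xs} → T (ind a (x ∷ xs)) → x ≢ y → a x y ≡ true → All (Apart a y) xs →
           B (length xs) (suc (length xs)) ≡ true → (∀ i → i < length xs → B i (suc (length xs)) ≡ false) →
           T (ind a (y ∷ x ∷ xs))
  extend {a} {y} {x} {xs} i ne ad ap b b′ = ∧-intro {fits a (suc (length xs)) y (x ∷ xs)}
    (fits-next {a} {suc (length xs)} {y} {x} {xs} ne ad b (fits-apart {a} {suc (length xs)} {y} {xs} ap b′)) i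

  -- The toggle only concerns u and v. Once both are placed, a fresh vertex sees the unchanged host,
  -- so lengthening need not look at the toggled pair again.
  flip-new : ∀ {u v} z y → y ≢ u → y ≢ v → flip u v z y ≡ adj z y
  flip-new {u} {v} z y yu yv rewrite eq-≢ yu | eq-≢ yv with adj z y | eq z u | eq z v
  ... | true | true | true = refl
  ... | true | true | false = refl
  ... | true | false | true = refl
  ... | true | false | false = refl
  ... | false | true | true = refl
  ... | false | true | false = refl
  ... | false | false | true = refl
  ... | false | false | false = refl

  realises-swap : ∀ {D n u v} → Realises D n (flip u v) → Realises D n (flip v u)
  realises-swap {u = u} {v} = realises-cong (flip-comm u v)

≢⇒≡ᵇ : ∀ {m n} → m ≢ n → (m ≡ᵇ n) ≡ false
≢⇒≡ᵇ {m} {n} ne = ¬T⇒≡ (ne ∘ ≡ᵇ⇒≡ m n)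

≡ᵇ-comm : ∀ m n → (m ≡ᵇ n) ≡ (n ≡ᵇ m)
≡ᵇ-comm m n = T-ext (λ e → ≡⇒≡ᵇ n m (sym (≡ᵇ⇒≡ m n e))) (λ e → ≡⇒≡ᵇ m n (sym (≡ᵇ⇒≡ n m e)))

-- Transpositions of ℕ

sw : ℕ → ℕ → ℕ → ℕ
sw a b x = if x ≡ᵇ a then b else (if x ≡ᵇ b then a else x)

sw-left : ∀ a b → sw a b a ≡ b
sw-left a b rewrite T⇒≡ (≡ᵇ-refl a) = refl

sw-right : ∀ a b → sw a b b ≡ a
sw-right a b with b ≡ᵇ a in e
... | true = ≡ᵇ⇒≡ b a (≡⇒T e)
... | false rewrite T⇒≡ (≡ᵇ-refl b) = refl

sw-other : ∀ {a b x} → x ≢ a → x ≢ b → sw a b x ≡ x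
sw-other p q rewrite ≢⇒≡ᵇ p | ≢⇒≡ᵇ q = refl

sw-sw : ∀ a b x → sw a b (sw a b x) ≡ x
sw-sw a b x with x ℕP.≟ a | x ℕP.≟ b
... | yes refl | _ = trans (cong (sw a b) (sw-left a b)) (sw-right a b)
... | no _ | yes refl = trans (cong (sw a b) (sw-right a b)) (sw-left a b)
... | no p | no q = trans (cong (sw a b) (sw-other p q)) (sw-other p q)

sw-< : ∀ {a b n x} → a < n → b < n → x < n → sw a b x < n
sw-< {a} {b} {x = x} p q r with x ≡ᵇ a | x ≡ᵇ b
... | true | _ = q
... | false | true = p
... | false | false = r

record Perm (n : ℕ) : Set where
  field
    fun : ℕ → ℕ
    inj : ∀ {x y} → fun x ≡ fun y → x ≡ y
    bnd : ∀ {x} → x < n → fun x < n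

  eqᵇ : ∀ x y → (fun x ≡ᵇ fun y) ≡ (x ≡ᵇ y)
  eqᵇ x y = T-ext (λ e → ≡⇒≡ᵇ x y (inj (≡ᵇ⇒≡ _ _ e))) (λ e → ≡⇒≡ᵇ _ _ (cong fun (≡ᵇ⇒≡ x y e)))

open Perm

swap : ∀ {n a b} → a < n → b < n → Perm n
swap {a = a} {b} p q = record
  { fun = sw a b
  ; inj = λ {x} {y} e → trans (sym (sw-sw a b x)) (trans (cong (sw a b) e) (sw-sw a b y))
  ; bnd = sw-< p q
  }

_⊙_ : ∀ {n} → Perm n → Perm n → Perm n
p ⊙ q = record { fun = fun p ∘ fun q ; inj = inj q ∘ inj p ; bnd = bnd p ∘ bnd q }

place : ∀ {n a i} → a < n → i < n → Σ[ p ∈ Perm n ] fun p a ≡ i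
place {a = a} {i} p q = swap p q , sw-left a i

place₂ : ∀ {n a b i j} → a < n → b < n → i < n → j < n → a ≢ b → i ≢ j →
         Σ[ p ∈ Perm n ] fun p a ≡ i × fun p b ≡ j
place₂ {n} {a} {b} {i} {j} an bn iN jN ab ij =
  -- The inner transposition sends b to the preimage of j under the outer one. It leaves a alone,
  -- because that preimage is a only if i = j.
  (swap an iN ⊙ swap bn (sw-< an iN jN)) ,
  trans (cong (sw a i) (sw-other ab (λ e → ij (sym (trans (sym (sw-sw a i j)) (trans (cong (sw a i) (sym e)) (sw-left a i))))))) (sw-left a i) ,
  trans (cong (sw a i) (sw-left b (sw a i j))) (sw-sw a i j)

-- The host for C̃ : cells (i , j) of a k × k board, two vertices in each cell; a row joins different signs
-- in different cells, a column is complete multipartite with the cells as parts.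

Cell : Set
Cell = ℕ × Bool × ℕ

row col : Cell → ℕ
row = proj₁
col = proj₂ ∘ proj₂

sign : Cell → Bool
sign = proj₁ ∘ proj₂

xor-comm : ∀ a b → (a xor b) ≡ (b xor a)
xor-comm true true = refl
xor-comm true false = refl
xor-comm false true = refl
xor-comm false false = refl

board : Raw
board = record
  { R = Cell
  ; eq = λ (i , s , j) (i′ , s′ , j′) → (i ≡ᵇ i′) ∧ ((j ≡ᵇ j′) ∧ bool-eq s s′)
  ; eq-sound = λ { (i , s , j) (i′ , s′ , j′) t →
      cong₂ _,_ (≡ᵇ⇒≡ i i′ (∧-elim₁ t))
        (cong₂ _,_ (bool-eq-sound (∧-elim₂ {j ≡ᵇ j′} (∧-elim₂ {i ≡ᵇ i′} t))) (≡ᵇ⇒≡ j j′ (∧-elim₁ (∧-elim₂ {i ≡ᵇ i′} t)))) }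
  ; eq-refl = λ (i , s , j) → ∧-intro (≡ᵇ-refl i) (∧-intro (≡ᵇ-refl j) (bool-eq-refl {s} refl))
  ; adj = adj
  ; adj-sym = λ x y → subst T (comm x y)
  ; adj-irr = irr
  }
  where
  adj : Cell → Cell → Bool
  adj (i , s , j) (i′ , s′ , j′) = if i ≡ᵇ i′ then not (j ≡ᵇ j′) ∧ (s xor s′) else (j ≡ᵇ j′)
  comm : ∀ x y → adj x y ≡ adj y x
  comm (i , s , j) (i′ , s′ , j′) rewrite ≡ᵇ-comm i i′ | ≡ᵇ-comm j j′ | xor-comm s s′ = refl
  irr : ∀ x → ¬ T (adj x x)
  irr (i , s , j) t rewrite T⇒≡ (≡ᵇ-refl i) | T⇒≡ (≡ᵇ-refl j) = t

-- Vertex 1 is the one of the triangle 0, 1, 2 that lies off the long cycle 0, 2, 3, …, m.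
tri : ℕ → ℕ → ℕ → Bool
tri m i j = (j ≡ᵇ suc i) ∨ ((i ≡ᵇ 0) ∧ ((j ≡ᵇ 2) ∨ (j ≡ᵇ m)))

-- Copies of C̃ in the board after one toggle

module Board (m : ℕ) where
  open Growth board (tri m) public
  open Raw board using (adj)

  InBoard : ℕ → Cell → Set
  InBoard k x = row x < k × col x < k

  adj-row : ∀ {i s s′ j j′} → j ≢ j′ → adj (i , s , j) (i , s′ , j′) ≡ s xor s′
  adj-row {i} ne rewrite T⇒≡ (≡ᵇ-refl i) | ≢⇒≡ᵇ ne = refl

  adj-col : ∀ {i i′ s s′ j} → i ≢ i′ → adj (i , s , j) (i′ , s′ , j) ≡ true
  adj-col {j = j} ne rewrite ≢⇒≡ᵇ ne = T⇒≡ (≡ᵇ-refl j)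

  adj-off : ∀ {x y} → row x ≢ row y → col x ≢ col y → adj x y ≡ false
  adj-off p q rewrite ≢⇒≡ᵇ p | ≢⇒≡ᵇ q = refl

  -- Columns ignore signs and rows only compare them, so the signs may be reversed in each row
  -- independently.
  automorphism : ∀ {k} → Perm k → (ℕ → Bool) → Perm k → Cell → Cell
  automorphism f σ g (i , s , j) = fun f i , (s xor σ i) , fun g j

  xor-cancel : ∀ s s′ t → ((s xor t) xor (s′ xor t)) ≡ (s xor s′)
  xor-cancel true true true = refl
  xor-cancel true true false = refl
  xor-cancel true false true = refl
  xor-cancel true false false = refl
  xor-cancel false true true = refl
  xor-cancel false true false = refl
  xor-cancel false false true = refl
  xor-cancel false false false = refl

  xor-inj : ∀ s s′ t → (s xor t) ≡ (s′ xor t) → s ≡ s′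
  xor-inj true true t e = refl
  xor-inj true false true ()
  xor-inj true false false ()
  xor-inj false true true ()
  xor-inj false true false ()
  xor-inj false false t e = refl

  move : ∀ {k n u v} (f : Perm k) (σ : ℕ → Bool) (g : Perm k) → Realises (InBoard k) n (flip u v) →
         Realises (InBoard k) n (flip (automorphism f σ g u) (automorphism f σ g v))
  move f σ g = realises-map (automorphism f σ g) injective preserves (λ (p , q) → bnd f p , bnd g q)
    where
    injective : ∀ {x y} → automorphism f σ g x ≡ automorphism f σ g y → x ≡ y
    injective {i , s , j} {i′ , s′ , j′} e with inj f (cong row e) | inj g (cong col e)
    ... | refl | refl rewrite xor-inj s s′ (σ i) (cong sign e) = refl
    preserves : ∀ x y → adj (automorphism f σ g x) (automorphism f σ g y) ≡ adj x y
    preserves (i , s , j) (i′ , s′ , j′) rewrite eqᵇ f i i′ | eqᵇ g j j′ with i ≡ᵇ i′ in e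
    ... | false = refl
    ... | true rewrite ≡ᵇ⇒≡ i i′ (≡⇒T e) | xor-cancel s s′ (σ i′) = refl

  -- When the ends of the canonical pair lie in rows 0 and 1, reversing these two rows separately
  -- produces any two signs.
  signs : Bool → Bool → ℕ → Bool
  signs s s′ zero = s
  signs s s′ (suc _) = s′

  -- Up to the automorphisms there are five pairs of vertices.
  record Canonical (k n : ℕ) : Set where
    field
      sameCell    : Realises (InBoard k) n (flip (0 , false , 0) (0 , true , 0))
      sameRow     : Realises (InBoard k) n (flip (0 , false , 0) (0 , false , 1))
      rowEdge     : Realises (InBoard k) n (flip (0 , false , 0) (0 , true , 1))
      columnEdge  : Realises (InBoard k) n (flip (0 , false , 0) (1 , false , 0))
      general     : Realises (InBoard k) n (flip (0 , false , 0) (1 , false , 1))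

  all-flips : ∀ {k n} → 1 < k → Canonical k n → ∀ u v → InBoard k u → InBoard k v → u ≢ v →
              Realises (InBoard k) n (flip u v)
  all-flips {k} 1<k c (i , s , j) (i′ , s′ , j′) (ik , jk) (ik′ , jk′) ne with i ℕP.≟ i′ | j ℕP.≟ j′
  ... | yes refl | yes refl = cell s s′ (ne ∘ λ { refl → refl })
    where
    0<k = <-trans (s≤s z≤n) 1<k
    cell : ∀ s s′ → s ≢ s′ → Realises _ _ (flip (i , s , j) (i , s′ , j))
    cell true true ne = ⊥-elim (ne refl)
    cell false false ne = ⊥-elim (ne refl)
    cell false true _ with place 0<k ik | place 0<k jk
    ... | f , refl | g , refl = move f (λ _ → false) g (Canonical.sameCell c)
    cell true false _ with place 0<k ik | place 0<k jk
    ... | f , refl | g , refl = move f (λ _ → true) g (Canonical.sameCell c)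
  ... | yes refl | no jj with place (<-trans (s≤s z≤n) 1<k) ik | place₂ (<-trans (s≤s z≤n) 1<k) 1<k jk jk′ (λ ()) jj
  ...   | f , refl | g , refl , refl = line s s′
    where
    line : ∀ s s′ → Realises _ _ (flip (fun f 0 , s , fun g 0) (fun f 0 , s′ , fun g 1))
    line false false = move f (λ _ → false) g (Canonical.sameRow c)
    line false true = move f (λ _ → false) g (Canonical.rowEdge c)
    line true false = move f (λ _ → true) g (Canonical.rowEdge c)
    line true true = move f (λ _ → true) g (Canonical.sameRow c)
  all-flips 1<k c (i , s , j) (i′ , s′ , j′) (ik , jk) (ik′ , jk′) ne | no ii | yes refl
    with place₂ (<-trans (s≤s z≤n) 1<k) 1<k ik ik′ (λ ()) ii | place (<-trans (s≤s z≤n) 1<k) jk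
  ... | f , refl , refl | g , refl = move f (signs s s′) g (Canonical.columnEdge c)
  all-flips 1<k c (i , s , j) (i′ , s′ , j′) (ik , jk) (ik′ , jk′) ne | no ii | no jj
    with place₂ (<-trans (s≤s z≤n) 1<k) 1<k ik ik′ (λ ()) ii | place₂ (<-trans (s≤s z≤n) 1<k) 1<k jk jk′ (λ ()) jj
  ... | f , refl , refl | g , refl , refl = move f (signs s s′) g (Canonical.general c)

  -- A path that starts at z, the only vertex of its row, and ends alone in the last column.
  record Path (a : Cell → Cell → Bool) (r : ℕ) (z : Cell) : Set where
    field
      end      : Cell
      mid      : List Cell
      induced  : T (ind a (end ∷ mid ++ z ∷ []))
      end-row  : row end < suc r
      end-col  : col end ≡ r
      rest     : All (λ x → row x < suc r × col x < r) (mid ++ z ∷ [])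
      alone    : All (λ x → row x ≢ row z) (end ∷ mid)
      size     : length (mid ++ z ∷ []) ≡ suc (r + r)

  snoc≢0 : ∀ {A : Set} (ws : List A) {z} → length (ws ++ z ∷ []) ≢ 0
  snoc≢0 [] ()
  snoc≢0 (_ ∷ _) ()

  tri-next : ∀ i → tri m i (suc i) ≡ true
  tri-next i rewrite T⇒≡ (≡ᵇ-refl i) = refl

  tri-far : ∀ {i n} → suc i < n → 2 < n → n ≢ m → tri m i n ≡ false
  tri-far {i} {n} p q ne rewrite ≢⇒≡ᵇ (λ e → <⇒≢ p (sym e)) | ≢⇒≡ᵇ {n} {2} (λ e → <⇒≢ q (sym e)) | ≢⇒≡ᵇ ne with i ≡ᵇ 0
  ... | true = refl
  ... | false = refl

  tri-chord : ∀ {i n} → suc i < n → i ≢ 0 → tri m i n ≡ false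
  tri-chord {i} {n} p q rewrite ≢⇒≡ᵇ (λ e → <⇒≢ p (sym e)) | ≢⇒≡ᵇ q = refl

  module _ {u v : Cell} where
    a = flip u v

    off-row : ∀ {r} → row u < r → ∀ {s j} → (r , s , j) ≢ u
    off-row p refl = <-irrefl refl p

    off-row′ : ∀ {r} → row v < r → ∀ {s j} → (r , s , j) ≢ v
    off-row′ p refl = <-irrefl refl p

    -- `end` is alone in column r, so y₁ can enter the new row there; y₂ follows in the same row
    -- with the opposite sign and is alone in the new column. The bound on m keeps both indices
    -- below m, the only later index that is joined to 0.
    grow : ∀ {r z} → row u < suc r → row v < suc r → suc (suc (suc (r + r))) < m → 1 ≤ r → row z < suc r →
           Path a r z → Path a (suc r) z
    grow {r} {z} ur vr lm 1≤r zr p = record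
      { end = y₂
      ; mid = y₁ ∷ end ∷ mid
      ; induced = extend {a} {y₂} {y₁} {end ∷ mid ++ z ∷ []} i₁ (λ e → <⇒≢ ≤-refl (cong col e))
          (trans (flip-new y₁ y₂ (off-row ur) (off-row′ vr)) (adj-row {suc r} {false} {true} {r} {suc r} (<⇒≢ ≤-refl)))
          (apart₂ end (subst (_< suc r) (sym end-col) ≤-refl , end-row)
             ∷ All.map (λ {x} (p , q) → apart₂ x (m≤n⇒m≤1+n q , p)) rest)
          (tri-next (length (end ∷ mid ++ z ∷ []))) (λ j q → tri-far {j} (s≤s q) (s≤s (s≤s (subst (1 ≤_) (sym size) (s≤s z≤n)))) (λ e → <⇒≢ lm (trans (cong (2 +_) (sym size)) e)))
      ; end-row = ≤-refl
      ; end-col = refl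
      ; rest = (≤-refl , ≤-refl) ∷ (m≤n⇒m≤1+n end-row , subst (_< suc r) (sym end-col) ≤-refl)
                 ∷ All.map (λ (p , q) → m≤n⇒m≤1+n p , m≤n⇒m≤1+n q) rest
      ; alone = (λ e → <⇒≢ zr (sym e)) ∷ (λ e → <⇒≢ zr (sym e)) ∷ alone
      ; size = trans (cong (2 +_) size) (cong (2 +_) (sym (+-suc r r)))
      }
      where
      open Path p
      y₁ = suc r , false , r
      y₂ = suc r , true , suc r
      apart₂ : ∀ x → col x < suc r × row x < suc r → Apart a y₂ x
      apart₂ x (q , p) = (λ e → <⇒≢ p (cong row e)) ,
                         trans (flip-new x y₂ (off-row ur) (off-row′ vr)) (adj-off {x} {y₂} (<⇒≢ p) (<⇒≢ q))
      i₁ : T (ind a (y₁ ∷ end ∷ mid ++ z ∷ []))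
      i₁ = extend {a} {y₁} {end} {mid ++ z ∷ []} induced (λ e → <⇒≢ end-row (cong row e))
          (trans (flip-new end y₁ (off-row ur) (off-row′ vr))
                 (trans (cong (λ j → adj (row end , sign end , j) y₁) end-col) (adj-col {row end} {suc r} {sign end} {false} {r} (<⇒≢ end-row))))
          (All.map (λ {x} (p , q) → (λ e → <⇒≢ p (cong row e)) , trans (flip-new x y₁ (off-row ur) (off-row′ vr)) (adj-off {x} {y₁} (<⇒≢ p) (<⇒≢ q))) rest)
          (tri-next (length (mid ++ z ∷ []))) (λ j q → tri-far {j} (s≤s q) (s≤s (subst (1 <_) (sym size) (s≤s (≤-trans 1≤r (m≤m+n r r))))) (λ e → <⇒≢ (<⇒≤ lm) (trans (cong suc (sym size)) e)))

    -- The last vertex closes the long cycle in the row of z and the column of `end`. Each of the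
    -- two is alone in that line, so they are its only neighbours; the sign opposite to that of z
    -- provides the edge to z.
    close : ∀ {r z} → col u < r → col v < r → m ≡ suc (suc (r + r)) → col z < r → row z < suc r →
            Path a r z → Realises (InBoard (suc r)) (suc m) a
    close {r} {z} uc vc me zc zr p = realises (y ∷ end ∷ mid ++ z ∷ [])
      (∧-intro {fits a _ y (end ∷ mid ++ z ∷ [])}
        (fits-next {a} {_} {y} {end} {mid ++ z ∷ []} (λ e → All.head alone (cong row e))
          (trans (flip-new end y off-u off-v)
                 (trans (cong (λ j → adj (row end , sign end , j) y) end-col) (adj-col {row end} {row z} {sign end} {not (sign z)} {r} (All.head alone))))
          (tri-next (length (mid ++ z ∷ []))) (around mid (All.tail alone) rest (≤-reflexive (cong suc size)))) induced)
      ((zr , ≤-refl) ∷ (end-row , subst (_< suc r) (sym end-col) ≤-refl) ∷ All.map (λ (p , q) → p , m≤n⇒m≤1+n q) rest)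
      (trans (cong (2 +_) size) (cong suc (sym me)))
      where
      open Path p
      y = row z , not (sign z) , r
      off-u : y ≢ u
      off-u e = <⇒≢ uc (sym (cong col e))
      off-v : y ≢ v
      off-v e = <⇒≢ vc (sym (cong col e))
      xor-not : ∀ s → (s xor not s) ≡ true
      xor-not true = refl
      xor-not false = refl
      n = suc (length (mid ++ z ∷ []))
      n≡m : n ≡ m
      n≡m = trans (cong suc size) (sym me)
      tri-last : tri m 0 n ≡ true
      tri-last = T⇒≡ (Equivalence.from (T-∨ {n ≡ᵇ 1}) (inj₂ (Equivalence.from (T-∨ {n ≡ᵇ 2}) (inj₂ (≡⇒≡ᵇ n m n≡m)))))
      around : ∀ ws → All (λ x → row x ≢ row z) ws → All (λ x → row x < suc r × col x < r) (ws ++ z ∷ []) →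
               suc (length (ws ++ z ∷ [])) ≤ suc (suc (r + r)) → T (fits a n y (ws ++ z ∷ []))
      around [] _ _ _ = fits-next {a} {n} {y} {z} {[]} (λ e → <⇒≢ zc (cong col e))
        (trans (flip-new z y off-u off-v) (trans (adj-row {row z} {sign z} {not (sign z)} {col z} {r} (<⇒≢ zc)) (xor-not (sign z)))) tri-last tt
      around (w ∷ ws) (al ∷ als) ((_ , wc) ∷ rs) (s≤s le) = ∧-intro {not (Raw.eq board w y) ∧ bool-eq (a w y) (tri m (length (ws ++ z ∷ [])) n)}
        (∧-intro (subst (T ∘ not) (sym (eq-≢ {w} {y} (λ e → al (cong row e)))) tt)
                 (bool-eq-refl (trans (trans (flip-new w y off-u off-v) (adj-off {w} {y} al (<⇒≢ wc)))
                   (sym (tri-chord {length (ws ++ z ∷ [])} (subst (suc (length (ws ++ z ∷ [])) <_) (sym (cong suc size)) (s≤s le)) (snoc≢0 ws))))))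
        (around ws als rs (m≤n⇒m≤1+n le))

    grow* : ∀ e {r z} → row u < suc r → row v < suc r → col u < r → col v < r → 1 ≤ r → row z < suc r → col z < r →
            m ≡ suc (suc ((e + r) + (e + r))) → Path a r z → Realises (InBoard (suc (e + r))) (suc m) a
    grow* zero ur vr uc vc 1≤r zr zc me p = close uc vc me zc zr p
    grow* (suc e) {r} ur vr uc vc 1≤r zr zc me p =
      subst (λ n → Realises (InBoard (suc n)) (suc m) a) (+-suc e r)
        (grow* e (m≤n⇒m≤1+n ur) (m≤n⇒m≤1+n vr) (m≤n⇒m≤1+n uc) (m≤n⇒m≤1+n vc) (s≤s z≤n) (m≤n⇒m≤1+n zr) (m≤n⇒m≤1+n zc)
          (trans me (cong (λ n → suc (suc (n + n))) (sym (+-suc e r))))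
          (grow ur vr (subst (suc (suc (suc (r + r))) <_) (sym me) (s≤s (s≤s (bound e r)))) 1≤r zr p))
      where
      bound : ∀ e r → suc (suc (r + r)) ≤ suc (e + r) + suc (e + r)
      bound e r = subst (suc (suc (r + r)) ≤_) (cong suc (sym (+-suc (e + r) (e + r)))) (s≤s (s≤s (+-mono-≤ (m≤n+m r e) (m≤n+m r e))))

-- Here m is twice the side 4 + d. The explicit copies have eight vertices on four rows and four
-- columns, the case r = 3 of `Path`; d growing steps follow.
module BoardFlips (d : ℕ) where
  m = 8 + (d + d)
  open Board m public

  private
    k≡ : m ≡ suc (suc ((d + 3) + (d + 3)))
    k≡ = cong (λ n → suc (suc n)) (trans (cong (6 +_) refl) (sym (arith d)))
      where
      arith : ∀ d → (d + 3) + (d + 3) ≡ 6 + (d + d)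
      arith d = trans (cong₂ _+_ (+-comm d 3) (+-comm d 3)) (cong (3 +_) (trans (+-comm d (3 + d)) refl))

    start : ∀ {u v} z end mid → T (ind (flip u v) (end ∷ mid ++ z ∷ [])) → row u < 4 → row v < 4 → col u < 3 → col v < 3 →
            row end < 4 → col end ≡ 3 → All (λ x → row x < 4 × col x < 3) (mid ++ z ∷ []) →
            All (λ x → row x ≢ row z) (end ∷ mid) → length (mid ++ z ∷ []) ≡ 7 → row z < 4 → col z < 3 →
            Realises (InBoard (4 + d)) (suc m) (flip u v)
    start {u} {v} z end mid i ur vr uc vc er ec re al sz zr zc =
      subst (λ n → Realises (InBoard (suc n)) (suc m) (flip u v)) (+-comm d 3)
        (grow* d ur vr uc vc (s≤s z≤n) zr zc k≡ (record
          { end = end ; mid = mid ; induced = i ; end-row = er ; end-col = ec ; rest = re ; alone = al ; size = sz }))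

    all-T : ∀ {A : Set} {p : A → Bool} xs → T (all p xs) → All (T ∘ p) xs
    all-T [] _ = []
    all-T {p = p} (x ∷ xs) t = ∧-elim₁ t ∷ all-T xs (∧-elim₂ {p x} t)

    inner : Cell → Bool
    inner x = (row x <ᵇ 4) ∧ (col x <ᵇ 3)

    inner-sound : ∀ {x} → T (inner x) → row x < 4 × col x < 3
    inner-sound {x} t = <ᵇ⇒< _ _ (∧-elim₁ t) , <ᵇ⇒< _ _ (∧-elim₂ {row x <ᵇ 4} t)

    head : ∀ u v z end mid → T (inner u ∧ inner v ∧ inner z ∧ all inner mid ∧ ((row end <ᵇ 4) ∧ (col end ≡ᵇ 3)) ∧
             all (λ x → not (row x ≡ᵇ row z)) (end ∷ mid) ∧ (length (mid ++ z ∷ []) ≡ᵇ 7)) →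
           T (ind (flip u v) (end ∷ mid ++ z ∷ [])) → Realises (InBoard (4 + d)) (suc m) (flip u v)
    head u v z end mid c i =
      let c₁ = ∧-elim₂ {inner u} c ; c₂ = ∧-elim₂ {inner v} c₁ ; c₃ = ∧-elim₂ {inner z} c₂
          c₄ = ∧-elim₂ {all inner mid} c₃ ; c₅ = ∧-elim₂ {(row end <ᵇ 4) ∧ (col end ≡ᵇ 3)} c₄
          (ur , uc) = inner-sound {u} (∧-elim₁ c) ; (vr , vc) = inner-sound {v} (∧-elim₁ c₁) ; (zr , zc) = inner-sound {z} (∧-elim₁ c₂)
          e = ∧-elim₁ c₄
      in start z end mid i ur vr uc vc (<ᵇ⇒< _ _ (∧-elim₁ e)) (≡ᵇ⇒≡ _ _ (∧-elim₂ {row end <ᵇ 4} e))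
           (++⁺ (All.map (λ {x} → inner-sound {x}) (all-T {p = inner} mid (∧-elim₁ c₃))) ((zr , zc) ∷ []))
           (All.map (λ {x} t e → not-T (row x ≡ᵇ row z) t (≡⇒≡ᵇ _ _ e)) (all-T {p = λ x → not (row x ≡ᵇ row z)} (end ∷ mid) (∧-elim₁ c₅)))
           (≡ᵇ⇒≡ _ _ (∧-elim₂ {all (λ x → not (row x ≡ᵇ row z)) (end ∷ mid)} c₅)) zr zc
      where
      not-T : ∀ b → T (not b) → ¬ T b
      not-T false _ ()

  -- Lists run from the newest vertex to the oldest: `z` and the last two entries of the list are
  -- the triangle 0, 1, 2. Every side condition is evaluated.
  canonical : Canonical (4 + d) (suc m)
  canonical = record
    { sameCell = head (0 , false , 0) (0 , true , 0) (1 , false , 0) (3 , true , 3)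
        ((3 , false , 2) ∷ (2 , true , 2) ∷ (2 , false , 1) ∷ (0 , false , 1) ∷ (0 , true , 0) ∷ (0 , false , 0) ∷ []) tt tt
    ; sameRow = head (0 , false , 0) (0 , false , 1) (1 , false , 2) (3 , true , 3)
        ((3 , false , 1) ∷ (0 , false , 1) ∷ (0 , false , 0) ∷ (2 , true , 0) ∷ (2 , false , 2) ∷ (0 , false , 2) ∷ []) tt tt
    ; rowEdge = head (0 , false , 0) (0 , true , 1) (1 , false , 0) (3 , true , 3)
        ((3 , false , 2) ∷ (0 , false , 2) ∷ (0 , true , 1) ∷ (2 , true , 1) ∷ (2 , false , 0) ∷ (0 , false , 0) ∷ []) tt tt
    ; columnEdge = head (0 , false , 0) (1 , false , 0) (0 , false , 0) (3 , false , 3)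
        ((3 , true , 2) ∷ (3 , false , 1) ∷ (1 , true , 1) ∷ (1 , false , 0) ∷ (2 , false , 0) ∷ (1 , true , 0) ∷ []) tt tt
    ; general = head (0 , false , 0) (1 , false , 1) (2 , false , 2) (1 , true , 3)
        ((1 , false , 1) ∷ (0 , false , 0) ∷ (3 , false , 0) ∷ (0 , true , 0) ∷ (0 , false , 2) ∷ (3 , false , 2) ∷ []) tt tt
    }

-- No induced C̃ in the board

module Cycle (m : ℕ) (0<m : 0 < m) where
  nxt : ℕ → ℕ
  nxt s with suc s ℕP.≟ m
  ... | yes _ = 0
  ... | no _ = suc s

  nxt-< : ∀ {s} → s < m → nxt s < m
  nxt-< {s} p with suc s ℕP.≟ m
  ... | yes _ = 0<m
  ... | no ne = ≤∧≢⇒< p ne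

  prv : ∀ t → t < m → ∃[ s ] (s < m × nxt s ≡ t)
  prv zero p = m ∸ 1 , subst (_≤ m) (sym e) ≤-refl , hit
    where
    e : suc (m ∸ 1) ≡ m
    e = m+[n∸m]≡n 0<m
    hit : nxt (m ∸ 1) ≡ 0
    hit with suc (m ∸ 1) ℕP.≟ m
    ... | yes _ = refl
    ... | no ne = ⊥-elim (ne e)
  prv (suc t) p = t , <⇒≤ p , hit
    where
    hit : nxt t ≡ suc t
    hit with suc t ℕP.≟ m
    ... | yes e = ⊥-elim (<⇒≢ p e)
    ... | no _ = refl

  iter : ℕ → ℕ → ℕ
  iter zero s = s
  iter (suc j) s = nxt (iter j s)

  -- At most m steps wrap around at most once.
  iter-val : ∀ j {s} → s < m → j ≤ m → iter j s ≡ s + j ⊎ iter j s + m ≡ s + j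
  iter-val zero {s} p q = inj₁ (sym (+-identityʳ s))
  iter-val (suc j) {s} p q with iter-val j p (<⇒≤ q)
  ... | inj₁ e with suc (iter j s) ℕP.≟ m
  ...   | yes e′ = inj₂ (trans (sym e′) (trans (cong suc e) (sym (+-suc s j))))
  ...   | no _ = inj₁ (trans (cong suc e) (sym (+-suc s j)))
  iter-val (suc j) {s} p q | inj₂ e with suc (iter j s) ℕP.≟ m
  ...   | yes e′ = ⊥-elim (<⇒≢ (≤-<-trans small q) e′)
    where
    small : suc (iter j s) ≤ j
    small = +-cancelʳ-< m (iter j s) j (subst (_< j + m) (sym e) (subst (_< j + m) (+-comm j s) (+-monoʳ-< j p)))
  ...   | no _ = inj₂ (trans (cong suc e) (sym (+-suc s j)))

  iter-≢ : ∀ j {s} → s < m → 0 < j → j < m → iter j s ≢ s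
  iter-≢ j {s} p 0<j q e with iter-val j p (<⇒≤ q)
  ... | inj₁ e′ = <⇒≢ (m<m+n s 0<j) (trans (sym e) e′)
  ... | inj₂ e′ = <⇒≢ q (sym (+-cancelˡ-≡ s m j (trans (cong (_+ m) (sym e)) e′)))

  iter-< : ∀ j {s} → s < m → iter j s < m
  iter-< zero p = p
  iter-< (suc j) p = nxt-< (iter-< j p)

  nxt-inj : ∀ {s t} → s < m → t < m → nxt s ≡ nxt t → s ≡ t
  nxt-inj {s} {t} p q e with suc s ℕP.≟ m | suc t ℕP.≟ m
  ... | yes a | yes b = suc-injective (trans a (sym b))
  nxt-inj p q () | yes _ | no _
  nxt-inj p q () | no _ | yes _
  ... | no _ | no _ = suc-injective e

module CellFacts where
  open Raw board using (adj)

  Twin : Cell → Cell → Set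
  Twin x y = row x ≡ row y × col x ≡ col y

  adj-by-row : ∀ {x y} → row x ≡ row y → col x ≢ col y → sign x ≢ sign y → T (adj x y)
  adj-by-row {i , s , j} {_ , s′ , j′} refl q r rewrite T⇒≡ (≡ᵇ-refl i) | ≢⇒≡ᵇ q with s | s′
  ... | true | true = ⊥-elim (r refl)
  ... | true | false = tt
  ... | false | true = tt
  ... | false | false = ⊥-elim (r refl)

  adj-by-col : ∀ {x y} → row x ≢ row y → col x ≡ col y → T (adj x y)
  adj-by-col {_ , _ , j} p refl rewrite ≢⇒≡ᵇ p = ≡ᵇ-refl j

  adj-inv : ∀ {x y} → T (adj x y) → (row x ≡ row y × col x ≢ col y × sign x ≢ sign y) ⊎ (row x ≢ row y × col x ≡ col y)
  adj-inv {i , s , j} {i′ , s′ , j′} t with i ≡ᵇ i′ in e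
  ... | false = inj₂ ((λ { refl → false≢true (trans (sym e) (T⇒≡ (≡ᵇ-refl i))) }) , ≡ᵇ⇒≡ j j′ t)
    where
    false≢true : false ≢ true
    false≢true ()
  ... | true = inj₁ (≡ᵇ⇒≡ i i′ (≡⇒T e) , (λ { refl → irr j (∧-elim₁ t) }) , λ { refl → xor-irr s (∧-elim₂ {not (j ≡ᵇ j′)} t) })
    where
    irr : ∀ j → ¬ T (not (j ≡ᵇ j))
    irr j t rewrite T⇒≡ (≡ᵇ-refl j) = t
    xor-irr : ∀ s → ¬ T (s xor s)
    xor-irr true ()
    xor-irr false ()

  third : ∀ {a b c : Bool} → a ≢ b → a ≢ c → b ≡ c
  third {true} {true} p q = ⊥-elim (p refl)
  third {true} {false} {true} p q = ⊥-elim (q refl)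
  third {true} {false} {false} p q = refl
  third {false} {false} p q = ⊥-elim (p refl)
  third {false} {true} {false} p q = ⊥-elim (q refl)
  third {false} {true} {true} p q = refl

-- `h` runs along the long cycle and `w` is the vertex off it. The charging to lines would break if
-- both vertices of a cell lay on the cycle, so the first half of the argument excludes twins; this
-- is where the length 8 enters.
module BoardFree (k m : ℕ) (m≡ : m ≡ k + k) (8≤m : 8 ≤ m) (h : ℕ → Cell) (w : Cell) where
  open Cycle m (≤-trans (s≤s z≤n) 8≤m)
  open CellFacts
  open Raw board using (adj; adj-sym)

  module _ (inside : ∀ {s} → s < m → row (h s) < k × col (h s) < k) (w-row : row w < k)
           (inj : ∀ {s t} → s < m → t < m → h s ≡ h t → s ≡ t)
           (edge : ∀ {s} → s < m → T (adj (h s) (h (nxt s))))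
           (edges : ∀ {s t} → s < m → t < m → T (adj (h s) (h t)) → t ≡ nxt s ⊎ s ≡ nxt t)
           (w₀ : T (adj w (h 0))) (w₁ : T (adj w (h 1)))
           (w-only : ∀ {s} → s < m → T (adj w (h s)) → s ≡ 0 ⊎ s ≡ 1) where

    private
      lt : ∀ {j} → j ≤ 7 → j < m
      lt p = ≤-trans (s≤s p) 8≤m

    -- Adjacency through a column depends on the cell alone, so a vertex that distinguishes two
    -- twins must be a row neighbour.
    exclusive : ∀ {x y z} → Twin x y → T (adj x z) → ¬ T (adj y z) → row x ≡ row z × col x ≢ col z × sign x ≢ sign z
    exclusive {x} {y} {z} (re , ce) xz yz with adj-inv {x} {z} xz
    ... | inj₁ r = r
    ... | inj₂ (r , c) = ⊥-elim (yz (adj-by-col {y} {z} (r ∘ trans re) (trans (sym ce) c)))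

    twin-≁ : ∀ {x y} → Twin x y → ¬ T (adj x y)
    twin-≁ {x} {y} (re , ce) t with adj-inv {x} {y} t
    ... | inj₁ (_ , c , _) = c ce
    ... | inj₂ (r , _) = r re

    cell-≡ : ∀ {x y} → Twin x y → sign x ≡ sign y → x ≡ y
    cell-≡ (refl , refl) refl = refl

    twin-sign : ∀ {x y} → Twin x y → x ≢ y → sign x ≢ sign y
    twin-sign tw ne e = ne (cell-≡ tw e)

    same-col : ∀ {x y} → row x ≡ row y → sign x ≢ sign y → ¬ T (adj x y) → col x ≡ col y
    same-col {x} {y} r s n with col x ℕP.≟ col y
    ... | yes e = e
    ... | no ne = ⊥-elim (n (adj-by-row {x} {y} r ne s))

    -- The distance is between 2 and 6; since 8 ≤ m, such positions are not consecutive the other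
    -- way round either.
    far : ∀ i j {b} → b < m → i < j → suc j ≤ i + 7 → suc i ≢ j → ¬ T (adj (h (iter i b)) (h (iter j b)))
    far i j {b} p i<j le ne t with edges (iter-< i p) (iter-< j p) t
    ... | inj₁ e = shift (suc i) j (≤∧≢⇒< i<j ne) (m≤n⇒m≤1+n (<⇒≤ le)) (sym e)
      where
      shift : ∀ i j → i < j → j ≤ i + 7 → iter i b ≢ iter j b
      shift zero j p′ q e = iter-≢ j p p′ (lt q) (sym e)
      shift (suc i) (suc j) (s≤s p′) (s≤s q) e = shift i j p′ q (nxt-inj (iter-< i p) (iter-< j p) e)
    ... | inj₂ e = shift i (suc j) (m≤n⇒m≤1+n i<j) le e
      where
      shift : ∀ i j → i < j → j ≤ i + 7 → iter i b ≢ iter j b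
      shift zero j p′ q e = iter-≢ j p p′ (lt q) (sym e)
      shift (suc i) (suc j) (s≤s p′) (s≤s q) e = shift i j p′ q (nxt-inj (iter-< i p) (iter-< j p) e)

    apart : ∀ i j {b} → b < m → i < j → j ≤ i + 7 → h (iter i b) ≢ h (iter j b)
    apart i j {b} p p′ q e = shift i j p′ q (inj (iter-< i p) (iter-< j p) e)
      where
      shift : ∀ i j → i < j → j ≤ i + 7 → iter i b ≢ iter j b
      shift zero j p′ q e = iter-≢ j p p′ (lt q) (sym e)
      shift (suc i) (suc j) (s≤s p′) (s≤s q) e = shift i j p′ q (nxt-inj (iter-< i p) (iter-< j p) e)

    -- The outer neighbours v 1 and v 5 each see only one of the twins, so they lie in the same row
    -- with opposite signs; being non-adjacent they are twins too. The same reasoning one step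
    -- further puts v 0 into this row with the sign of v 2, and its non-adjacency to v 4 forces it
    -- into the cell of v 2. So v 0 = v 2.
    no-twin-2 : ∀ {b} → b < m → ¬ Twin (h (iter 2 b)) (h (iter 4 b))
    no-twin-2 {b} p tw@(r24 , c24) = apart 0 2 p (s≤s z≤n) (s≤s (s≤s z≤n)) (cell-≡ (r02 , trans c04 (sym c24)) s02)
      where
      v : ℕ → Cell
      v i = h (iter i b)
      n24 : sign (v 2) ≢ sign (v 4)
      n24 = twin-sign tw (apart 2 4 p (s≤s (s≤s (s≤s z≤n))) (s≤s (s≤s (s≤s (s≤s z≤n)))))
      x21 = exclusive {v 2} {v 4} {v 1} tw (adj-sym (v 1) (v 2) (edge (iter-< 1 p)))
              (far 1 4 p (s≤s (s≤s z≤n)) (s≤s (s≤s (s≤s (s≤s (s≤s z≤n))))) (λ ()) ∘ adj-sym (v 4) (v 1))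
      x45 = exclusive {v 4} {v 2} {v 5} (sym r24 , sym c24) (edge (iter-< 4 p))
              (far 2 5 p (s≤s (s≤s (s≤s z≤n))) (s≤s (s≤s (s≤s (s≤s (s≤s (s≤s z≤n)))))) (λ ()))
      s14 : sign (v 1) ≡ sign (v 4)
      s14 = third (proj₂ (proj₂ x21)) n24
      n15 : sign (v 1) ≢ sign (v 5)
      n15 e = proj₂ (proj₂ x45) (trans (sym s14) e)
      r15 : row (v 1) ≡ row (v 5)
      r15 = trans (sym (proj₁ x21)) (trans r24 (proj₁ x45))
      c15 : col (v 1) ≡ col (v 5)
      c15 = same-col r15 n15 (far 1 5 p (s≤s (s≤s z≤n)) (s≤s (s≤s (s≤s (s≤s (s≤s (s≤s z≤n)))))) (λ ()))
      x10 = exclusive {v 1} {v 5} {v 0} (r15 , c15) (adj-sym (v 0) (v 1) (edge p))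
              (far 0 5 p (s≤s z≤n) (s≤s (s≤s (s≤s (s≤s (s≤s (s≤s z≤n)))))) (λ ()) ∘ adj-sym (v 5) (v 0))
      r02 : row (v 0) ≡ row (v 2)
      r02 = sym (trans (proj₁ x21) (proj₁ x10))
      s02 : sign (v 0) ≡ sign (v 2)
      s02 = third (proj₂ (proj₂ x10)) (proj₂ (proj₂ x21) ∘ sym)
      c04 : col (v 0) ≡ col (v 4)
      c04 = same-col (trans r02 r24) (n24 ∘ trans (sym s02)) (far 0 4 p (s≤s z≤n) (s≤s (s≤s (s≤s (s≤s (s≤s z≤n))))) (λ ()))

    two-on : ∀ {s t} → s < m → t ≡ iter 2 s → ¬ Twin (h s) (h t)
    two-on {s} p refl tw with prv s p
    ... | s₁ , p₁ , refl with prv s₁ p₁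
    ...   | s₂ , p₂ , refl = no-twin-2 p₂ tw

    -- The successors P and P₂ of the twins lie in their row with opposite signs and are
    -- non-adjacent, hence share a cell. The predecessor Q₂ of t has the sign of P₂, so it lies in
    -- another column and is adjacent to P; adjacency on the cycle leaves only t = s + 3.
    three-on : ∀ {s t} → s < m → t < m → s ≢ t → Twin (h s) (h t) → t ≡ iter 3 s
    three-on {s} {t} p q ne tw with prv s p | prv t q
    ... | s′ , p′ , es | t′ , q′ , et = result
      where
      tw′ : Twin (h t) (h s)
      tw′ = sym (proj₁ tw) , sym (proj₂ tw)
      not-next : ∀ {i j} → i < m → j < m → Twin (h i) (h j) → j ≢ nxt i
      not-next {i} ip jp tw e = twin-≁ {h i} {h (nxt i)} (subst (λ z → Twin (h i) (h z)) e tw) (edge ip)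
      nst : sign (h s) ≢ sign (h t)
      nst = twin-sign tw (ne ∘ inj p q)
      P = h (nxt s) ; P₂ = h (nxt t) ; Q₂ = h t′
      xp : row (h s) ≡ row P × col (h s) ≢ col P × sign (h s) ≢ sign P
      xp = exclusive {h s} {h t} tw (edge p) λ a → [ (λ e → ne (nxt-inj p q e)) , (λ e → two-on p e tw) ]′ (edges q (nxt-< p) a)
      xp₂ : row (h t) ≡ row P₂ × col (h t) ≢ col P₂ × sign (h t) ≢ sign P₂
      xp₂ = exclusive {h t} {h s} tw′ (edge q) λ a → [ (λ e → ne (sym (nxt-inj q p e))) , (λ e → two-on q e tw′) ]′ (edges p (nxt-< q) a)
      xq₂ : row (h t) ≡ row Q₂ × col (h t) ≢ col Q₂ × sign (h t) ≢ sign Q₂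
      xq₂ = exclusive {h t} {h s} tw′ (adj-sym Q₂ (h t) (subst (λ z → T (adj Q₂ (h z))) et (edge q′)))
              λ a → [ (λ e → two-on p (trans (sym et) (cong nxt e)) tw) , (λ e → ne (trans e et)) ]′ (edges p q′ a)
      sP : sign P ≡ sign (h t)
      sP = third (proj₂ (proj₂ xp)) nst
      rP : row P ≡ row (h t)
      rP = trans (sym (proj₁ xp)) (proj₁ tw)
      cP₂ : col P ≡ col P₂
      cP₂ = same-col (trans rP (proj₁ xp₂)) (proj₂ (proj₂ xp₂) ∘ trans (sym sP)) λ a →
        [ (λ e → not-next p q tw (nxt-inj q (nxt-< p) e))
        , (λ e → not-next q p tw′ (nxt-inj p (nxt-< q) e)) ]′ (edges (nxt-< p) (nxt-< q) a)
      cQ₂ : col P ≢ col Q₂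
      cQ₂ e = iter-≢ 2 q (s≤s z≤n) (lt (s≤s (s≤s z≤n))) (trans (cong nxt t″) et)
        where
        t″ : nxt t ≡ t′
        t″ = inj (nxt-< q) q′ (cell-≡ (trans (sym (proj₁ xp₂)) (proj₁ xq₂) , trans (sym cP₂) e)
                                      (third (proj₂ (proj₂ xp₂)) (proj₂ (proj₂ xq₂))))
      result : t ≡ iter 3 s
      result with edges (nxt-< p) q′ (adj-by-row {P} {Q₂} (trans rP (proj₁ xq₂)) cQ₂ (proj₂ (proj₂ xq₂) ∘ trans (sym sP)))
      ... | inj₁ e = trans (sym et) (cong nxt e)
      ... | inj₂ e = ⊥-elim (not-next p q tw (sym (trans e et)))

    -- Each twin comes three steps after the other, so six steps would close the cycle.
    no-twins : ∀ {s t} → s < m → t < m → s ≢ t → ¬ Twin (h s) (h t)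
    no-twins {s} {t} p q ne tw = iter-≢ 6 p (s≤s z≤n) (lt (s≤s (s≤s (s≤s (s≤s (s≤s (s≤s z≤n)))))))
      (sym (trans (three-on q p (ne ∘ sym) (sym (proj₁ tw) , sym (proj₂ tw))) (cong (iter 3) (three-on p q ne tw))))

    -- If both edges at s ran along its column, the two neighbours would share that column: in one
    -- cell they would be twins, in different rows they would be adjacent at distance 2.
    row-neighbour : ∀ {s} → s < m → ∃[ u ] (u < m × T (adj (h s) (h u)) × row (h s) ≡ row (h u) × sign (h s) ≢ sign (h u) ×
                                             (nxt u ≡ s ⊎ u ≡ nxt s))
    row-neighbour {s} p with prv s p
    ... | s′ , p′ , refl with adj-inv {h (nxt s′)} {h s′} (adj-sym (h s′) _ (edge p′)) | adj-inv {h (nxt s′)} {h (nxt (nxt s′))} (edge p)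
    ...   | inj₁ (r , _ , s) | _ = s′ , p′ , adj-sym (h s′) _ (edge p′) , r , s , inj₁ refl
    ...   | inj₂ _ | inj₁ (r , _ , s) = nxt (nxt s′) , nxt-< p , edge p , r , s , inj₂ refl
    ...   | inj₂ (r , c) | inj₂ (r′ , c′) with row (h s′) ℕP.≟ row (h (nxt (nxt s′)))
    ...     | yes e = ⊥-elim (no-twins p′ (nxt-< p) (iter-≢ 2 p′ (s≤s z≤n) (lt (s≤s (s≤s z≤n))) ∘ sym) (e , trans (sym c) c′))
    ...     | no ne = ⊥-elim (far 0 2 p′ (s≤s z≤n) (s≤s (s≤s (s≤s z≤n))) (λ ())
                        (adj-by-col {h s′} {h (nxt (nxt s′))} ne (trans (sym c) c′)))

    RowEdge : ℕ → Set
    RowEdge s = row (h s) ≡ row (h (nxt s))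

    -- Starts in a common column are not twins, so they are adjacent and consecutive; but then the
    -- edge between them is one of the two row edges.
    row-edges : ∀ {s t} → s < m → t < m → s ≢ t → RowEdge s → RowEdge t → col (h s) ≢ col (h t)
    row-edges {s} {t} p q ne es et e with row (h s) ℕP.≟ row (h t)
    ... | yes r = no-twins p q ne (r , e)
    ... | no r with edges p q (adj-by-col {h s} {h t} r e)
    ...   | inj₁ ts = r (trans es (cong (row ∘ h) (sym ts)))
    ...   | inj₂ st = r (trans (cong (row ∘ h) st) (sym et))

    -- The row neighbour of s must be its predecessor u. If t were in the same row, it would be
    -- adjacent to whichever of s and u has the opposite sign, and every way of being consecutive
    -- with it contradicts one of the hypotheses.
    column-edges : ∀ {s t} → s < m → t < m → s ≢ t → ¬ RowEdge s → ¬ RowEdge t → row (h s) ≢ row (h t)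
    column-edges {s} {t} p q ne es et e with row-neighbour p
    ... | u , up , a , r , sg , inj₂ us = es (trans r (cong (row ∘ h) us))
    ... | u , up , a , r , sg , inj₁ us with sign (h s) B.≟ sign (h t)
    ...   | no sne = [ (λ ts → es (trans e (cong (row ∘ h) ts))) , (λ st → et (trans (sym e) (cong (row ∘ h) st))) ]′
                (edges p q (adj-by-row {h s} {h t} e (λ c → no-twins p q ne (e , c)) sne))
    ...   | yes se with t ℕP.≟ u
    ...     | yes tu = sg (trans se (cong (sign ∘ h) tu))
    ...     | no tu = [ (λ tu′ → ne (trans (sym us) (sym tu′))) , (λ ut → et (trans (sym e) (trans r (cong (row ∘ h) ut)))) ]′
                (edges up q (adj-by-row {h u} {h t} (trans (sym r) e) (λ c → no-twins up q (tu ∘ sym) (trans (sym r) e , c)) (λ s′ → sg (trans se (sym s′)))))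

    private
      0<m : 0 < m
      0<m = lt z≤n
      nxt0 : nxt 0 ≡ 1
      nxt0 with 1 ℕP.≟ m
      ... | yes e = ⊥-elim (<⇒≢ (lt {1} (s≤s z≤n)) e)
      ... | no _ = refl
      1<m : 1 < m
      1<m = lt (s≤s z≤n)

    -- Three vertices of a row cannot have pairwise different signs, and a row and a column do not
    -- meet in two cells; so the triangle lies in a column.
    triangle : row (h 0) ≢ row (h 1) × col w ≡ col (h 0) × col w ≡ col (h 1) × row w ≢ row (h 0) × row w ≢ row (h 1)
    triangle with adj-inv {h 0} {h 1} (subst (λ z → T (adj (h 0) (h z))) nxt0 (edge 0<m)) | adj-inv {w} {h 0} w₀ | adj-inv {w} {h 1} w₁
    ... | inj₁ (_ , _ , s) | inj₁ (_ , _ , a) | inj₁ (_ , _ , b) = ⊥-elim (s (third a b))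
    ... | inj₁ (r , _ , _) | inj₁ (a , _ , _) | inj₂ (b , _) = ⊥-elim (b (trans a r))
    ... | inj₁ (r , _ , _) | inj₂ (a , _) | inj₁ (b , _ , _) = ⊥-elim (a (trans b (sym r)))
    ... | inj₁ (_ , c , _) | inj₂ (_ , a) | inj₂ (_ , b) = ⊥-elim (c (trans (sym a) b))
    ... | inj₂ (r , c) | inj₁ (a , a′ , _) | inj₁ (b , _ , _) = ⊥-elim (r (trans (sym a) b))
    ... | inj₂ (r , c) | inj₁ (a , a′ , _) | inj₂ (_ , b) = ⊥-elim (a′ (trans b (sym c)))
    ... | inj₂ (r , c) | inj₂ (_ , a) | inj₁ (_ , b , _) = ⊥-elim (b (trans a c))
    ... | inj₂ (r , c) | inj₂ (a , a′) | inj₂ (b , b′) = r , a′ , b′ , a , b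

    -- In the cell of w the vertex h t would be adjacent to h 0 and to h 1, which is impossible on
    -- so long a cycle.
    row-w-col : ∀ {t} → t < m → row w ≡ row (h t) → col w ≢ col (h t)
    row-w-col {t} p e c with triangle
    ... | r , c₀ , c₁ , r₀ , r₁ = close (edges p 0<m (adj-by-col {h t} {h 0} (r₀ ∘ trans e) (trans (sym c) c₀)))
                                        (edges p 1<m (adj-by-col {h t} {h 1} (r₁ ∘ trans e) (trans (sym c) c₁)))
      where
      close : 0 ≡ nxt t ⊎ t ≡ nxt 0 → 1 ≡ nxt t ⊎ t ≡ nxt 1 → ⊥
      close (inj₂ a) _ = r₁ (trans e (cong (row ∘ h) (trans a nxt0)))
      close (inj₁ a) (inj₁ b) with trans a (sym b)
      ... | ()
      close (inj₁ a) (inj₂ b) = iter-≢ 3 0<m (s≤s z≤n) (lt (s≤s (s≤s (s≤s z≤n))))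
        (trans (cong (nxt ∘ nxt) nxt0) (trans (cong nxt (sym b)) (sym a)))

    -- As h t is no neighbour of w, it has the sign of w. Its row neighbour then has the opposite
    -- sign and, in another column, would be adjacent to w although neither h 0 nor h 1 lies in the
    -- row of w.
    row-w : ∀ {t} → t < m → row w ≢ row (h t)
    row-w {t} p e with row-neighbour p
    ... | u , up , a , r , sg , _ = row-w-col up (trans e r) (same-col (trans e r) (λ s → sg (trans (sym same) s)) (not-adj up (trans e r)))
      where
      not-adj : ∀ {t} → t < m → row w ≡ row (h t) → ¬ T (adj w (h t))
      not-adj q e′ a with w-only q a
      ... | inj₁ refl = proj₁ (proj₂ (proj₂ (proj₂ triangle))) e′
      ... | inj₂ refl = proj₂ (proj₂ (proj₂ (proj₂ triangle))) e′
      same : sign w ≡ sign (h t)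
      same with sign w B.≟ sign (h t)
      ... | yes q = q
      ... | no ne = ⊥-elim (not-adj p e (adj-by-row {w} {h t} e (row-w-col p e) ne))

    -- Leaving a row or a column for good: row edges are charged to columns, column edges to rows, w to its row.
    charge : ℕ → ℕ
    charge s with s ℕP.≟ m
    ... | yes _ = k + row w
    ... | no _ with row (h s) ℕP.≟ row (h (nxt s))
    ...   | yes _ = col (h s)
    ...   | no _ = k + row (h s)

    charge-< : ∀ {s} → s < suc m → charge s < k + k
    charge-< {s} p with s ℕP.≟ m
    ... | yes _ = +-monoʳ-< k w-row
    ... | no ne with row (h s) ℕP.≟ row (h (nxt s))
    ...   | yes _ = <-≤-trans (proj₂ (inside (≤∧≢⇒< (≤-pred p) ne))) (m≤m+n k k)
    ...   | no _ = +-monoʳ-< k (proj₁ (inside (≤∧≢⇒< (≤-pred p) ne)))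

    charge-≢ : ∀ {s t} → s < t → t < suc m → charge s ≢ charge t
    charge-≢ {s} {t} s<t p with s ℕP.≟ m | t ℕP.≟ m
    ... | yes refl | _ = ⊥-elim (<⇒≱ s<t (≤-pred p))
    charge-≢ {s} {t} s<t p | no sm | yes refl with row (h s) ℕP.≟ row (h (nxt s))
    ... | yes _ = λ e → <⇒≢ (<-≤-trans (proj₂ (inside s<t)) (m≤m+n k (row w))) e
    ... | no _ = λ e → row-w s<t (sym (+-cancelˡ-≡ k _ _ e))
    charge-≢ {s} {t} s<t p | no sm | no tm with row (h s) ℕP.≟ row (h (nxt s)) | row (h t) ℕP.≟ row (h (nxt t))
    ... | yes a | yes b = row-edges (<-trans s<t t<m) t<m (<⇒≢ s<t) a b
      where t<m = ≤∧≢⇒< (≤-pred p) tm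
    ... | yes a | no b = <⇒≢ (<-≤-trans (proj₂ (inside (<-trans s<t (≤∧≢⇒< (≤-pred p) tm)))) (m≤m+n k _))
    ... | no a | yes b = λ e → <⇒≢ (<-≤-trans (proj₂ (inside (≤∧≢⇒< (≤-pred p) tm))) (m≤m+n k _)) (sym e)
    ... | no a | no b = column-edges (<-trans s<t t<m) t<m (<⇒≢ s<t) a b ∘ +-cancelˡ-≡ k _ _
      where t<m = ≤∧≢⇒< (≤-pred p) tm

    impossible : ⊥
    impossible with pigeonhole (s≤s (≤-reflexive (sym m≡))) (λ (i : Fin (suc m)) → fromℕ< (charge-< (toℕ<n i)))
    ... | i , j , i<j , e = charge-≢ i<j (toℕ<n j) (trans (sym (toℕ-fromℕ< _)) (trans (cong toℕ e) (toℕ-fromℕ< _)))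

cells : ℕ → List Cell
cells k = cartesianProduct (upTo k) (cartesianProduct (false ∷ true ∷ []) (upTo k))

cells-unique : ∀ k → Unique (cells k)
cells-unique k = cartesianProduct⁺ (upTo⁺ k) (cartesianProduct⁺ (((λ ()) ∷ []) ∷ [] ∷ []) (upTo⁺ k))

∈-cells⁺ : ∀ {k x} → row x < k × col x < k → x ∈ cells k
∈-cells⁺ {x = i , s , j} (p , q) = ∈-cartesianProduct⁺ (∈-upTo⁺ p) (∈-cartesianProduct⁺ (bool s) (∈-upTo⁺ q))
  where
  bool : ∀ s → s ∈ false ∷ true ∷ []
  bool false = here refl
  bool true = there (here refl)

∈-cells⁻ : ∀ {k x} → x ∈ cells k → row x < k × col x < k
∈-cells⁻ {k} {i , s , j} m = let (p , q) = ∈-cartesianProduct⁻ (upTo k) _ m in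
  ∈-upTo⁻ p , ∈-upTo⁻ (proj₂ (∈-cartesianProduct⁻ (false ∷ true ∷ []) (upTo k) q))

realises-dom : ∀ {raw B D D′ n a} → (∀ {x} → D x → D′ x) → Realisation.Realises raw B D n a → Realisation.Realises raw B D′ n a
realises-dom {raw} {B} f r = Realisation.realises verts induced (All.map f inside) size
  where
  open Realisation.Realises r

-- A total sequence of host vertices spares the bounds in the counting arguments; `default` only
-- makes it total.
module Copied {raw : Raw} {B : ℕ → ℕ → Bool} {dom : List (Raw.R raw)} {uniq : Unique dom} {n : ℕ}
              (e : Embedding (Pat B n) (Realisation.Host.graph raw B dom uniq)) (default : Raw.R raw) where
  open Raw raw
  open Embedding e

  r : ℕ → R
  r i with i <? n
  ... | yes p = lookup dom (vert (fromℕ< p))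
  ... | no _ = default

  r-yes : ∀ {i} (p : i < n) → r i ≡ lookup dom (vert (fromℕ< p))
  r-yes {i} p with i <? n
  ... | yes q = cong (λ z → lookup dom (vert (fromℕ< z))) (<-irrelevant q p)
  ... | no np = ⊥-elim (np p)

  r-∈ : ∀ {i} → i < n → r i ∈ dom
  r-∈ p = subst (_∈ dom) (sym (r-yes p)) (∈-lookup _)

  r-inj : ∀ {i j} → i < n → j < n → r i ≡ r j → i ≡ j
  r-inj p q eq′ = trans (sym (toℕ-fromℕ< p)) (trans (cong toℕ (Embedding.inj e (lookup-injective uniq (trans (sym (r-yes p)) (trans eq′ (r-yes q)))))) (toℕ-fromℕ< q))

  r-adj : ∀ {i j} → i < n → j < n → adj (r i) (r j) ≡ patAdj B i j
  r-adj p q = trans (cong₂ adj (r-yes p) (r-yes q))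
    (trans (sym (T-ext (Equivalence.to (adj⇔ (fromℕ< p) (fromℕ< q))) (Equivalence.from (adj⇔ (fromℕ< p) (fromℕ< q)))))
      (cong₂ (patAdj B) (toℕ-fromℕ< p) (toℕ-fromℕ< q)))

  r-< : ∀ {i j} → i < j → j < n → adj (r i) (r j) ≡ B i j
  r-< p q = trans (r-adj (<-trans p q) q) (patAdj-< B p)

module BoardHost (k m : ℕ) (m≡ : m ≡ k + k) (8≤m : 8 ≤ m) where
  open Board m
  open Host (cells k) (cells-unique k)
  open Cycle m (≤-trans (s≤s z≤n) 8≤m)

  private
    module Contra (e : Embedding (Pat (tri m) (suc m)) graph) where
      open Copied {board} {tri m} {cells k} {cells-unique k} e (0 , false , 0)
      open Raw board using (adj; adj-sym)

      -- Skips vertex 1 of the pattern, so that the long cycle is numbered 0, ..., m - 1.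
      pos : ℕ → ℕ
      pos zero = zero
      pos (suc s) = suc (suc s)

      pos-< : ∀ {s} → s < m → pos s < suc m
      pos-< {zero} p = s≤s z≤n
      pos-< {suc s} p = s≤s p

      pos-inj : ∀ {s t} → pos s ≡ pos t → s ≡ t
      pos-inj {zero} {zero} e = refl
      pos-inj {suc s} {suc .s} refl = refl

      pos-mono : ∀ {s t} → s < t → pos s < pos t
      pos-mono {zero} {suc t} p = s≤s z≤n
      pos-mono {suc s} {suc t} (s≤s p) = s≤s (s≤s p)

      h : ℕ → Cell
      h s = r (pos s)

      lt1 : 1 < suc m
      lt1 = ≤-trans (s≤s (s≤s z≤n)) (m≤n⇒m≤1+n 8≤m)

      nxt-suc : ∀ {s} → suc s < m → nxt s ≡ suc s
      nxt-suc {s} p with suc s ℕP.≟ m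
      ... | yes e = ⊥-elim (<⇒≢ p e)
      ... | no _ = refl

      up : ∀ {s t} → s < t → t < m → T (adj (h s) (h t)) → t ≡ nxt s ⊎ s ≡ nxt t
      up {zero} {suc t} p q a = fin (∨-elim (suc (suc t) ≡ᵇ 1) (subst T (r-< (pos-mono {zero} {suc t} p) (pos-< q)) a))
        where
        fin : T (suc (suc t) ≡ᵇ 1) ⊎ T ((suc (suc t) ≡ᵇ 2) ∨ (suc (suc t) ≡ᵇ m)) → suc t ≡ nxt 0 ⊎ 0 ≡ nxt (suc t)
        fin (inj₂ b) with ∨-elim (suc (suc t) ≡ᵇ 2) b
        ... | inj₁ c rewrite ≡ᵇ⇒≡ t 0 c = inj₁ (sym (nxt-suc q))
        ... | inj₂ c = inj₂ last
          where
          last : 0 ≡ nxt (suc t)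
          last with suc (suc t) ℕP.≟ m
          ... | yes _ = refl
          ... | no ne = ⊥-elim (ne (≡ᵇ⇒≡ (suc (suc t)) m c))
      up {suc s} {suc t} p q a = inj₁ (trans eq (sym (nxt-suc (subst (_< m) eq q))))
        where
        eq : suc t ≡ suc (suc s)
        eq with ∨-elim (suc (suc t) ≡ᵇ suc (suc (suc s))) (subst T (r-< (pos-mono {suc s} {suc t} p) (pos-< q)) a)
        ... | inj₁ c = suc-injective (≡ᵇ⇒≡ (suc (suc t)) (suc (suc (suc s))) c)

      edges : ∀ {s t} → s < m → t < m → T (adj (h s) (h t)) → t ≡ nxt s ⊎ s ≡ nxt t
      edges {s} {t} p q a with <-cmp s t
      ... | tri< l _ _ = up l q a
      ... | tri≈ _ refl _ = ⊥-elim (Raw.adj-irr board (h s) a)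
      ... | tri> _ _ l = [ inj₂ , inj₁ ]′ (up l p (adj-sym (h s) (h t) a))

      edge : ∀ {s} → s < m → T (adj (h s) (h (nxt s)))
      edge {s} p with suc s ℕP.≟ m
      edge {zero} p | yes e = ⊥-elim (<⇒≢ (≤-trans (s≤s (s≤s z≤n)) 8≤m) e)
      edge {suc s} p | yes e = adj-sym (h 0) (h (suc s)) (subst T (sym (r-< (s≤s z≤n) (s≤s p)))
        (Equivalence.from (T-∨ {suc (suc s) ≡ᵇ 1}) (inj₂ (Equivalence.from (T-∨ {suc (suc s) ≡ᵇ 2}) (inj₂ (≡⇒≡ᵇ _ _ e))))))
      edge {zero} p | no ne = subst T (sym (r-< {0} {2} (s≤s z≤n) (s≤s (≤∧≢⇒< p ne)))) tt
      edge {suc s} p | no ne = subst T (sym (r-< {suc (suc s)} {suc (suc (suc s))} ≤-refl (s≤s (≤∧≢⇒< p ne)))) (Equivalence.from (T-∨ {suc (suc (suc s)) ≡ᵇ suc (suc (suc s))}) (inj₁ (≡ᵇ-refl s)))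

      w-only : ∀ {s} → s < m → T (adj (r 1) (h s)) → s ≡ 0 ⊎ s ≡ 1
      w-only {zero} p a = inj₁ refl
      w-only {suc s} p a with ∨-elim (suc (suc s) ≡ᵇ 2) (subst T (r-< {1} {suc (suc s)} (s≤s (s≤s z≤n)) (s≤s p)) a)
      ... | inj₁ c = inj₂ (cong suc (≡ᵇ⇒≡ s 0 c))

      absurd : ⊥
      absurd = BoardFree.impossible k m m≡ 8≤m h (r 1)
        (λ p → ∈-cells⁻ (r-∈ (pos-< p))) (proj₁ (∈-cells⁻ {k} (r-∈ lt1)))
        (λ {s} {t} p q e → pos-inj {s} {t} (r-inj (pos-< p) (pos-< q) e))
        edge edges
        (adj-sym (h 0) (r 1) (subst T (sym (r-< {0} {1} (s≤s z≤n) lt1)) tt))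
        (subst T (sym (r-< {1} {2} (s≤s (s≤s z≤n)) (≤-trans (s≤s (s≤s (s≤s z≤n))) (m≤n⇒m≤1+n 8≤m)))) tt)
        w-only

  hosts : Canonical k (suc m) → 1 < k → Hosts (suc m)
  hosts c 1<k = record
    { free = Contra.absurd
    ; flips = λ u v mu mv ne → realises-dom (∈-cells⁺ {k}) (all-flips 1<k c u v (∈-cells⁻ mu) (∈-cells⁻ mv) ne)
    ; two = (0 , false , 0) , (0 , true , 0) , ∈-cells⁺ (<-trans (s≤s z≤n) 1<k , <-trans (s≤s z≤n) 1<k) ,
            ∈-cells⁺ (<-trans (s≤s z≤n) 1<k , <-trans (s≤s z≤n) 1<k) , λ ()
    }

C̃-host : ∀ d {H} → H ≅ Pat (tri (8 + (d + d))) (9 + (d + d)) → ∃[ G ] (Finite G × InducedSaturated H G)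
C̃-host d iso = Board.Host.exists (8 + (d + d)) (cells (4 + d)) (cells-unique (4 + d)) iso
  (BoardHost.hosts (4 + d) (8 + (d + d)) (cong (4 +_) (sym (+-comm d (4 + d)))) (s≤s (s≤s (s≤s (s≤s (s≤s (s≤s (s≤s (s≤s z≤n))))))))
    (BoardFlips.canonical d) (s≤s (s≤s z≤n)))

-- With k = 3 the long cycle has length 6, and six steps do close it, so twins are not excluded by
-- `no-twins`. The board with 18 vertices is searched instead.
module Board₃ where
  open Board 6
  open Host (cells 3) (cells-unique 3)

  private
    by-search : ∀ u v → T (search (flip u v) 7 []) → Realises (InBoard 3) 7 (flip u v)
    by-search u v s = realises-dom (∈-cells⁻ {3}) (search-sound (flip u v) 7 [] tt [] s)

  hosts : Hosts 7
  hosts = record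
    { free = search-free 7 refl
    ; flips = λ u v mu mv ne → realises-dom (∈-cells⁺ {3}) (all-flips (s≤s (s≤s z≤n)) (record
        { sameCell = by-search _ _ tt ; sameRow = by-search _ _ tt ; rowEdge = by-search _ _ tt
        ; columnEdge = by-search _ _ tt ; general = by-search _ _ tt }) u v (∈-cells⁻ mu) (∈-cells⁻ mv) ne)
    ; two = (0 , false , 0) , (0 , true , 0) , ∈-cells⁺ {3} (s≤s z≤n , s≤s z≤n) , ∈-cells⁺ {3} (s≤s z≤n , s≤s z≤n) , λ ()
    }

C̃₇-host : ∀ {H} → H ≅ Pat (tri 6) 7 → ∃[ G ] (Finite G × InducedSaturated H G)
C̃₇-host iso = Board.Host.exists 6 (cells 3) (cells-unique 3) iso Board₃.hosts

-- The graphs C̃ and the cycles with a path as patterns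

≅-from : ∀ {B n G} (f : Fin n → V G) → (∀ {i j} → f i ≡ f j → i ≡ j) → (∀ y → ∃[ i ] f i ≡ y) →
         (∀ i j → toℕ i < toℕ j → T (B (toℕ i) (toℕ j)) ⇔ Adj G (f i) (f j)) → G ≅ Pat B n
≅-from {B} {n} {G} f inj sur adj = ≅-sym {Pat B n} {G} record
  { bijection = mk↔ₛ′ f (proj₁ ∘ sur) (proj₂ ∘ sur) (λ i → inj (proj₂ (sur (f i))))
  ; adj⇔ = both
  }
  where
  both : ∀ i j → T (patAdj B (toℕ i) (toℕ j)) ⇔ Adj G (f i) (f j)
  both i j with <-cmp (toℕ i) (toℕ j)
  ... | tri< l _ _ = adj i j l ⇔-∘ T-cong {patAdj B (toℕ i) (toℕ j)} (patAdj-< B l)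
  ... | tri> _ _ l = mk⇔ (Graph.~-sym G) (Graph.~-sym G) ⇔-∘ (adj j i l ⇔-∘
        T-cong {patAdj B (toℕ i) (toℕ j)} (trans (∨-comm ((toℕ i <ᵇ toℕ j) ∧ B (toℕ i) (toℕ j)) _) (patAdj-< B l)))
  ... | tri≈ _ e _ rewrite toℕ-injective e = mk⇔ (⊥-elim ∘ Graph.~-irrefl (Pat B n) {j} refl) (⊥-elim ∘ Graph.~-irrefl G refl)

injective⇒surjective : ∀ {n} (f : Fin n → Fin n) → (∀ {i j} → f i ≡ f j → i ≡ j) → ∀ y → ∃[ i ] f i ≡ y
injective⇒surjective {n} f inj y with any? (λ i → f i FP.≟ y)
... | yes p = p
... | no np = ⊥-elim (1+n≰n (injective⇒≤ {f = g} g-inj))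
  where
  g : Fin (suc n) → Fin n
  g zero = y
  g (suc i) = f i
  g-inj : Injective _≡_ _≡_ g
  g-inj {zero} {zero} e = refl
  g-inj {zero} {suc j} e = ⊥-elim (np (j , sym e))
  g-inj {suc i} {zero} e = ⊥-elim (np (i , e))
  g-inj {suc i} {suc j} e = cong suc (inj e)

-- The cyclic renumbering in which `a` becomes vertex 0.
module Rotation (n : ℕ) (3≤n : 3 ≤ n) (a : Fin n) where
  private
    0<n : 0 < n
    0<n = ≤-trans (s≤s z≤n) 3≤n
  open Cycle n 0<n public

  rot : ℕ → Fin n
  rot i = fromℕ< (iter-< i (toℕ<n a))

  toℕ-rot : ∀ i → toℕ (rot i) ≡ iter i (toℕ a)
  toℕ-rot i = toℕ-fromℕ< (iter-< i (toℕ<n a))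

  iter-n : iter n (toℕ a) ≡ toℕ a
  iter-n with iter-val n {toℕ a} (toℕ<n a) ≤-refl
  ... | inj₁ e = ⊥-elim (<⇒≱ (iter-< n (toℕ<n a)) (subst (n ≤_) (sym e) (m≤n+m n (toℕ a))))
  ... | inj₂ e = +-cancelʳ-≡ n _ _ e

  iter-inj : ∀ {i j} → i < n → j < n → iter i (toℕ a) ≡ iter j (toℕ a) → i ≡ j
  iter-inj {i} {j} p q e with <-cmp i j
  ... | tri≈ _ e _ = e
  ... | tri< l _ _ = ⊥-elim (shift i j l q e)
    where
    shift : ∀ i j → i < j → j < n → iter i (toℕ a) ≢ iter j (toℕ a)
    shift zero j l q e = iter-≢ j (toℕ<n a) l q (sym e)
    shift (suc i) (suc j) (s≤s l) q e = shift i j l (<⇒≤ q) (nxt-inj (iter-< i (toℕ<n a)) (iter-< j (toℕ<n a)) e)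
  ... | tri> _ _ l = ⊥-elim (shift j i l p (sym e))
    where
    shift : ∀ i j → i < j → j < n → iter i (toℕ a) ≢ iter j (toℕ a)
    shift zero j l q e = iter-≢ j (toℕ<n a) l q (sym e)
    shift (suc i) (suc j) (s≤s l) q e = shift i j l (<⇒≤ q) (nxt-inj (iter-< i (toℕ<n a)) (iter-< j (toℕ<n a)) e)

  rot-inj : ∀ {i j} → i < n → j < n → rot i ≡ rot j → i ≡ j
  rot-inj {i} {j} p q e = iter-inj p q (trans (sym (toℕ-rot i)) (trans (cong toℕ e) (toℕ-rot j)))

  rot-sur : ∀ y → ∃[ i ] (i < n × rot i ≡ y)
  rot-sur y = let (i , e) = injective⇒surjective (rot ∘ toℕ) (λ {i} {j} → toℕ-injective ∘ rot-inj (toℕ<n i) (toℕ<n j)) y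
              in toℕ i , toℕ<n i , e

  next⇒nxt : ∀ {i j : Fin n} → Next i j → toℕ j ≡ nxt (toℕ i)
  next⇒nxt {i} {j} d with suc (toℕ i) ℕP.≟ n | d
  ... | yes e | inj₁ p = ⊥-elim (<⇒≢ (toℕ<n j) (trans p e))
  ... | yes e | inj₂ (_ , p) = p
  ... | no ne | inj₁ p = p
  ... | no ne | inj₂ (e , _) = ⊥-elim (ne e)

  nxt⇒next : ∀ {i j : Fin n} → toℕ j ≡ nxt (toℕ i) → Next i j
  nxt⇒next {i} e with suc (toℕ i) ℕP.≟ n
  ... | yes p = inj₂ (p , e)
  ... | no _ = inj₁ e

  rot-cycle⁺ : ∀ {i j} → i < j → j < n → j ≡ suc i ⊎ (i ≡ 0 × suc j ≡ n) → Adj (cycle n) (rot i) (rot j)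
  rot-cycle⁺ {i} {j} l q (inj₁ refl) = (λ e → <⇒≢ l (rot-inj (<-trans l q) q e)) ,
    inj₁ (nxt⇒next (trans (toℕ-rot j) (cong nxt (sym (toℕ-rot i)))))
  rot-cycle⁺ {i} {j} l q (inj₂ (refl , e)) = (λ e → <⇒≢ l (rot-inj (<-trans l q) q e)) ,
    inj₂ (nxt⇒next (trans (toℕ-rot 0) (trans (sym iter-n) (trans (cong (λ k → iter k (toℕ a)) (sym e)) (cong nxt (sym (toℕ-rot j)))))))

  rot-cycle⁻ : ∀ {i j} → i < j → j < n → Adj (cycle n) (rot i) (rot j) → j ≡ suc i ⊎ (i ≡ 0 × suc j ≡ n)
  rot-cycle⁻ {i} {j} l q (_ , inj₁ d) = inj₁ (iter-inj q (≤-<-trans l q) (trans (sym (toℕ-rot j)) (trans (next⇒nxt d) (cong nxt (toℕ-rot i)))))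
  rot-cycle⁻ {i} {j} l q (_ , inj₂ d) with suc j ℕP.≟ n
  ... | yes e = inj₂ (iter-inj (<-trans l q) (≤-trans (s≤s z≤n) 3≤n) (trans e′ (trans (cong (λ k → iter k (toℕ a)) e) iter-n)) , e)
    where
    e′ : iter i (toℕ a) ≡ iter (suc j) (toℕ a)
    e′ = trans (sym (toℕ-rot i)) (trans (next⇒nxt d) (cong nxt (toℕ-rot j)))
  ... | no ne = ⊥-elim (<⇒≢ (m≤n⇒m≤1+n l) (iter-inj (<-trans l q) (≤∧≢⇒< q ne) (trans (sym (toℕ-rot i)) (trans (next⇒nxt d) (cong nxt (toℕ-rot j))))))

module C̃-iso (n : ℕ) (4≤n : 4 ≤ n) (u v : Fin n) (u≢v : u ≢ v) where
  3≤n : 3 ≤ n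
  3≤n = <⇒≤ 4≤n

  chord : ∀ a → SamePair u v (Rotation.rot n 3≤n a 0) (Rotation.rot n 3≤n a 2) → addEdge (cycle n) u v u≢v ≅ Pat (tri (n ∸ 1)) n
  chord a sp = ≅-from {tri (n ∸ 1)} {n} {addEdge (cycle n) u v u≢v} (rot ∘ toℕ) (λ {i} {j} → toℕ-injective ∘ rot-inj (toℕ<n i) (toℕ<n j))
      (λ y → let (i , p , e) = rot-sur y in fromℕ< p , trans (cong rot (toℕ-fromℕ< p)) e)
      (λ i j l → mk⇔ (fwd l (toℕ<n j)) (bwd l (toℕ<n j)))
    where
    open Rotation n 3≤n a
    n-1 : suc (n ∸ 1) ≡ n
    n-1 = m+[n∸m]≡n (≤-trans (s≤s z≤n) 3≤n)
    fwd : ∀ {i j} → i < j → j < n → T (tri (n ∸ 1) i j) → Adj (addEdge (cycle n) u v u≢v) (rot i) (rot j)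
    fwd {i} {j} l q t with ∨-elim (j ≡ᵇ suc i) t
    ... | inj₁ c = inj₁ (rot-cycle⁺ l q (inj₁ (≡ᵇ⇒≡ j (suc i) c)))
    ... | inj₂ c with ≡ᵇ⇒≡ i 0 (∧-elim₁ c) | ∨-elim (j ≡ᵇ 2) (∧-elim₂ {i ≡ᵇ 0} c)
    ...   | refl | inj₁ e rewrite ≡ᵇ⇒≡ j 2 e = inj₂ sp
    ...   | refl | inj₂ e = inj₁ (rot-cycle⁺ l q (inj₂ (refl , trans (cong suc (≡ᵇ⇒≡ j (n ∸ 1) e)) n-1)))
    bwd : ∀ {i j} → i < j → j < n → Adj (addEdge (cycle n) u v u≢v) (rot i) (rot j) → T (tri (n ∸ 1) i j)
    bwd {i} {j} l q (inj₁ c) with rot-cycle⁻ l q c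
    ... | inj₁ e = Equivalence.from (T-∨ {j ≡ᵇ suc i}) (inj₁ (≡⇒≡ᵇ j (suc i) e))
    ... | inj₂ (refl , e) = Equivalence.from (T-∨ {j ≡ᵇ 1}) (inj₂ (Equivalence.from (T-∨ {j ≡ᵇ 2}) (inj₂ (≡⇒≡ᵇ j (n ∸ 1) (suc-injective (trans e (sym n-1)))))))
    bwd {i} {j} l q (inj₂ s) with pairs sp s
      where
      2<n : 2 < n
      2<n = 3≤n
      pairs : SamePair u v (rot 0) (rot 2) → SamePair u v (rot i) (rot j) → i ≡ 0 × j ≡ 2
      pairs (inj₁ (a , b)) (inj₁ (c , d)) = rot-inj (<-trans l q) (≤-trans (s≤s z≤n) 3≤n) (trans c (sym a)) , rot-inj q 2<n (trans d (sym b))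
      pairs (inj₂ (a , b)) (inj₂ (c , d)) = rot-inj (<-trans l q) (≤-trans (s≤s z≤n) 3≤n) (trans c (sym a)) , rot-inj q 2<n (trans d (sym b))
      pairs (inj₁ (a , b)) (inj₂ (c , d)) with rot-inj {i} {2} (<-trans l q) 2<n (trans c (sym b)) | rot-inj {j} {0} q (≤-trans (s≤s z≤n) 3≤n) (trans d (sym a))
      ... | refl | refl = ⊥-elim (<⇒≱ l z≤n)
      pairs (inj₂ (a , b)) (inj₁ (c , d)) with rot-inj {i} {2} (<-trans l q) 2<n (trans c (sym b)) | rot-inj {j} {0} q (≤-trans (s≤s z≤n) 3≤n) (trans d (sym a))
      ... | refl | refl = ⊥-elim (<⇒≱ l z≤n)
    ... | refl , refl = tt

  -- The two steps of the walk go the same way round, since otherwise u = v. The end from which both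
  -- lead forward becomes vertex 0 and the other one vertex 2.
  iso : Distance (cycle n) u v 2 → addEdge (cycle n) u v u≢v ≅ Pat (tri (n ∸ 1)) n
  iso ((_∷_ {v = x} (_ , ux) (_∷_ {v = y} (_ , xv) [])) , _) = go ux xv
    where
    around : ∀ {a b c : Fin n} → Next a b → Next b c → Rotation.rot n 3≤n a 0 ≡ a × Rotation.rot n 3≤n a 2 ≡ c
    around {a} {b} {c} p q = toℕ-injective (toℕ-rot 0) ,
      toℕ-injective (trans (toℕ-rot 2) (sym (trans (next⇒nxt q) (cong nxt (next⇒nxt p)))))
      where
      open Rotation n 3≤n a
    go : Next u x ⊎ Next x u → Next x v ⊎ Next v x → addEdge (cycle n) u v u≢v ≅ Pat (tri (n ∸ 1)) n
    go (inj₁ p) (inj₁ q) = chord u (inj₁ (around p q))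
    go (inj₂ p) (inj₂ q) = chord v (inj₂ (around q p))
    go (inj₁ p) (inj₂ q) = ⊥-elim (u≢v (toℕ-injective (nxt-inj (toℕ<n u) (toℕ<n v) (trans (sym (next⇒nxt p)) (next⇒nxt q)))))
      where
      open Rotation n 3≤n u
    go (inj₂ p) (inj₁ q) = ⊥-elim (u≢v (toℕ-injective (trans (next⇒nxt p) (sym (next⇒nxt q)))))
      where
      open Rotation n 3≤n u

IsC̃-host : ∀ k → 3 ≤ k → ∀ H → IsC̃ (2 * k + 1) H → ∃[ G ] (Finite G × InducedSaturated H G)
IsC̃-host (suc (suc (suc zero))) _ H (u , v , d , H≅) =
  C̃₇-host (≅-trans H≅ (C̃-iso.iso 7 (s≤s (s≤s (s≤s (s≤s z≤n)))) u v (distance2⇒≢ (cycle _) u v d) d))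
IsC̃-host (suc (suc (suc (suc e)))) _ H (u , v , d , H≅) =
  C̃-host e (subst (λ n → H ≅ Pat (tri (n ∸ 1)) n) size (≅-trans H≅ (C̃-iso.iso (2 * (4 + e) + 1) (subst (4 ≤_) (sym size) (s≤s (s≤s (s≤s (s≤s z≤n))))) u v (distance2⇒≢ (cycle _) u v d) d)))
  where
  size : 2 * (4 + e) + 1 ≡ 9 + (e + e)
  size = trans (+-comm (2 * (4 + e)) 1) (cong suc (cong (4 +_) (trans (cong (e +_) (+-identityʳ (4 + e))) (+-comm e (4 + e)))))
IsC̃-host (suc (suc zero)) (s≤s (s≤s ())) _ _
IsC̃-host (suc zero) (s≤s ()) _ _

module Lollipop {H : Graph} (L : IsCycleWithPath H) where
  open IsCycleWithPath L

  q l : ℕ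
  q = cycleLength
  l = pathLength

  private
    0<q : 0 < q
    0<q = ≤-trans (s≤s z≤n) 3≤length

    s : Fin q
    s = proj₁ shared

    module S = Rotation q 3≤length s
    -- Starting one step after the shared vertex gives that vertex the last number q - 1, so that
    -- the path continues the numbering.
    a : Fin q
    a = fromℕ< (S.nxt-< (toℕ<n s))

    open Rotation q 3≤length a

    shift : ∀ i → iter i (nxt (toℕ s)) ≡ nxt (iter i (toℕ s))
    shift zero = refl
    shift (suc i) = cong nxt (shift i)

    q-1 : suc (q ∸ 1) ≡ q
    q-1 = m+[n∸m]≡n 0<q

    rot-last : rot (q ∸ 1) ≡ s
    rot-last = toℕ-injective (trans (toℕ-rot (q ∸ 1)) (trans (cong (iter (q ∸ 1)) (toℕ-fromℕ< _))
      (trans (shift (q ∸ 1)) (trans (cong (λ k → iter k (toℕ s)) q-1) S.iter-n))))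

    p : ∀ j → j < suc l → V H
    p j lt = vertex P (fromℕ< lt)

    c : ℕ → V H
    c i = vertex C (rot i)

    height-< : ∀ {i} → ¬ i < q → i < q + l → suc (i ∸ q) < suc l
    height-< {i} ge lt = s≤s (subst (suc (i ∸ q) ≤_) (m+n∸m≡n q l) (∸-monoˡ-< lt (≮⇒≥ ge)))

    f : ∀ i → i < q + l → V H
    f i lt with i <? q
    ... | yes _ = c i
    ... | no ge = p (suc (i ∸ q)) (height-< ge lt)

    p-off : ∀ {j} (lt : suc j < suc l) i → p (suc j) lt ≢ c i
    p-off {j} lt i e with Copy.injective P (trans e (trans (sym e) (meet _ (fromℕ< lt , refl) (rot i , sym e))))
    ... | ()

    c-P : ∀ {x} i → i < q → vertex P x ≡ c i → x ≡ zero × i ≡ q ∸ 1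
    c-P {x} i i<q e = Copy.injective P z , rot-inj i<q (subst (q ∸ 1 <_) q-1 ≤-refl)
      (trans (Copy.injective C (trans (sym e) (trans z (sym (proj₂ shared))))) (sym rot-last))
      where
      z : vertex P x ≡ vertex P zero
      z = meet _ (x , refl) (rot i , sym e)

    c-inj : ∀ {i j} → i < q → j < q → c i ≡ c j → i ≡ j
    c-inj x y e = rot-inj x y (Copy.injective C e)

    c⁺ : ∀ {i j} → i < j → j < q → T (lol q i j) → Adj H (c i) (c j)
    c⁺ {i} {j} i<j j<q t = Copy.edge C (rot-cycle⁺ i<j j<q (case (∨-elim (j ≡ᵇ suc i) t)))
      where
      case : T (j ≡ᵇ suc i) ⊎ T ((i ≡ᵇ 0) ∧ (suc j ≡ᵇ q)) → j ≡ suc i ⊎ (i ≡ 0 × suc j ≡ q)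
      case (inj₁ x) = inj₁ (≡ᵇ⇒≡ j (suc i) x)
      case (inj₂ x) = inj₂ (≡ᵇ⇒≡ i 0 (∧-elim₁ x) , ≡ᵇ⇒≡ (suc j) q (∧-elim₂ {i ≡ᵇ 0} x))

    c⁻ : ∀ {i j} → i < j → j < q → Adj H (c i) (c j) → T (lol q i j)
    c⁻ {i} {j} i<j j<q ad with edges _ _ ad
    ... | inj₁ (x , y , _ , e₁ , e₂) = ⊥-elim (<⇒≢ i<j (trans (proj₂ (c-P i (<-trans i<j j<q) e₁)) (sym (proj₂ (c-P j j<q e₂)))))
    ... | inj₂ (x , y , xy , e₁ , e₂) with rot-cycle⁻ i<j j<q (subst₂ (Adj (cycle q)) (Copy.injective C e₁) (Copy.injective C e₂) xy)
    ...   | inj₁ e = Equivalence.from (T-∨ {j ≡ᵇ suc i}) (inj₁ (≡⇒≡ᵇ j (suc i) e))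
    ...   | inj₂ (e , e′) = Equivalence.from (T-∨ {j ≡ᵇ suc i}) (inj₂ (∧-intro (≡⇒≡ᵇ i 0 e) (≡⇒≡ᵇ (suc j) q e′)))

    path-adj⁺ : ∀ {i j} (x : i < suc l) (y : j < suc l) → j ≡ suc i → Adj H (p i x) (p j y)
    path-adj⁺ x y e = Copy.edge P (inj₁ (trans (toℕ-fromℕ< y) (trans e (cong suc (sym (toℕ-fromℕ< x))))))

    path-adj⁻ : ∀ {i j} (x : suc i < suc l) (y : suc j < suc l) → i < j → Adj H (p (suc i) x) (p (suc j) y) → j ≡ suc i
    path-adj⁻ {i} {j} x y i<j ad with edges _ _ ad
    ... | inj₂ (b , b′ , _ , e , _) = ⊥-elim (p-off-C b (sym e))
      where
      p-off-C : ∀ b → p (suc i) x ≢ vertex C b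
      p-off-C b e = let (k , _ , r) = rot-sur b in p-off x k (trans e (cong (vertex C) (sym r)))
    ... | inj₁ (b , b′ , bb′ , e , e′) with Copy.injective P e | Copy.injective P e′
    ...   | refl | refl with bb′
    ...     | inj₁ r = suc-injective (trans (sym (toℕ-fromℕ< y)) (trans r (cong suc (toℕ-fromℕ< x))))
    ...     | inj₂ r = ⊥-elim (<⇒≢ (m≤n⇒m≤1+n i<j) (suc-injective (trans (sym (toℕ-fromℕ< x)) (trans r (cong suc (toℕ-fromℕ< y))))))

    bridge⁻ : ∀ {i j} (y : suc j < suc l) → i < q → Adj H (c i) (p (suc j) y) → i ≡ q ∸ 1 × j ≡ 0
    bridge⁻ {i} {j} y i<q ad with edges _ _ ad
    ... | inj₂ (b , b′ , _ , _ , e) = ⊥-elim (let (k , _ , r) = rot-sur b′ in p-off y k (trans (sym e) (cong (vertex C) (sym r))))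
    ... | inj₁ (b , b′ , bb′ , e , e′) with c-P i i<q e | Copy.injective P e′
    ...   | refl , iq | refl with bb′
    ...     | inj₁ r = iq , suc-injective (trans (sym (toℕ-fromℕ< y)) r)
    ...     | inj₂ ()

    bridge⁺ : ∀ (y : 1 < suc l) → Adj H (c (q ∸ 1)) (p 1 y)
    bridge⁺ y = subst (λ v → Adj H v (p 1 y)) (trans (sym (proj₂ shared)) (cong (vertex C) (sym rot-last)))
      (Copy.edge P {zero} (inj₁ (toℕ-fromℕ< y)))

    no-chord : ∀ {i j} → q ≤ j → T (lol q i j) → j ≡ suc i
    no-chord {i} {j} q≤j t with ∨-elim (j ≡ᵇ suc i) t
    ... | inj₁ x = ≡ᵇ⇒≡ j (suc i) x
    ... | inj₂ x = ⊥-elim (<⇒≱ (subst (j <_) (≡ᵇ⇒≡ (suc j) q (∧-elim₂ {i ≡ᵇ 0} x)) ≤-refl) q≤j)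

    consecutive : ∀ {i j} → j ≡ suc i → T (lol q i j)
    consecutive {i} refl = Equivalence.from (T-∨ {suc i ≡ᵇ suc i}) (inj₁ (≡ᵇ-refl i))

    f-inj : ∀ {i j} (x : i < q + l) (y : j < q + l) → f i x ≡ f j y → i ≡ j
    f-inj {i} {j} x y e with i <? q | j <? q
    ... | yes a | yes b = c-inj a b e
    ... | yes _ | no b = ⊥-elim (p-off (height-< b y) i (sym e))
    ... | no a | yes _ = ⊥-elim (p-off (height-< a x) j e)
    ... | no a | no b = ∸-cancelʳ-≡ (≮⇒≥ a) (≮⇒≥ b) (suc-injective
          (trans (sym (toℕ-fromℕ< (height-< a x))) (trans (cong toℕ (Copy.injective P e)) (toℕ-fromℕ< (height-< b y)))))

    f-c : ∀ {i} (i<q : i < q) (x : i < q + l) → f i x ≡ c i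
    f-c {i} i<q x with i <? q
    ... | yes _ = refl
    ... | no n = ⊥-elim (n i<q)

    f-p : ∀ {j} (x : q + j < q + l) (y : suc j < suc l) → f (q + j) x ≡ p (suc j) y
    f-p {j} x y with q + j <? q
    ... | yes b = ⊥-elim (<⇒≱ b (m≤m+n q j))
    ... | no b = cong (vertex P) (toℕ-injective (trans (toℕ-fromℕ< (height-< b x)) (trans (cong suc (m+n∸m≡n q j)) (sym (toℕ-fromℕ< y)))))

    f-sur : ∀ v → ∃[ i ] Σ[ x ∈ i < q + l ] f i x ≡ v
    f-sur v with vertices v
    ... | inj₂ (b , refl) = let (k , k<q , r) = rot-sur b ; x = ≤-trans k<q (m≤m+n q l) in k , x , trans (f-c k<q x) (cong (vertex C) r)
    ... | inj₁ (zero , refl) = let (k , k<q , r) = rot-sur s ; x = ≤-trans k<q (m≤m+n q l) in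
          k , x , trans (f-c k<q x) (trans (cong (vertex C) r) (proj₂ shared))
    ... | inj₁ (suc b , refl) = q + toℕ b , x , trans (f-p x (s≤s (toℕ<n b))) (cong (vertex P) (toℕ-injective (toℕ-fromℕ< (s≤s (toℕ<n b)))))
      where
      x = +-monoʳ-< q (toℕ<n b)

    f-adj : ∀ {i j} (x : i < q + l) (y : j < q + l) → i < j → T (lol q i j) ⇔ Adj H (f i x) (f j y)
    f-adj {i} {j} x y i<j with i <? q | j <? q
    ... | yes a | yes b = mk⇔ (c⁺ i<j b) (c⁻ i<j b)
    ... | no a | yes b = ⊥-elim (a (<-trans i<j b))
    ... | no a | no b = mk⇔
          (λ t → path-adj⁺ (height-< a x) (height-< b y) (cong suc (trans (cong (_∸ q) (no-chord (≮⇒≥ b) t)) (+-∸-assoc 1 (≮⇒≥ a)))))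
          (λ ad → consecutive (∸-cancelʳ-≡ (≮⇒≥ b) (m≤n⇒m≤1+n (≮⇒≥ a))
             (trans (path-adj⁻ (height-< a x) (height-< b y) (∸-monoˡ-< i<j (≮⇒≥ a)) ad) (sym (+-∸-assoc 1 (≮⇒≥ a))))))
    ... | yes a | no b = mk⇔ to from
      where
      to : T (lol q i j) → Adj H (c i) (p (suc (j ∸ q)) (height-< b y))
      to t with no-chord (≮⇒≥ b) t
      ... | refl with ≤-antisym a (≮⇒≥ b)
      ...   | refl = subst (Adj H (c i)) (cong (vertex P) (toℕ-injective (trans (toℕ-fromℕ< (s≤s nontrivial)) (sym (trans (toℕ-fromℕ< (height-< b y)) (cong suc (n∸n≡0 (suc i))))))))
                       (bridge⁺ (s≤s nontrivial))
      from : Adj H (c i) (p (suc (j ∸ q)) (height-< b y)) → T (lol q i j)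
      from ad with bridge⁻ (height-< b y) a ad
      ... | refl , e = consecutive (trans (trans (sym (m∸n+n≡m (≮⇒≥ b))) (cong (_+ q) e)) (sym q-1))

  iso : H ≅ Pat (lol q) (q + l)
  iso = ≅-from {lol q} {q + l} {H} (λ i → f (toℕ i) (toℕ<n i)) (λ {i} {j} e → toℕ-injective (f-inj (toℕ<n i) (toℕ<n j) e))
    (λ v → let (i , x , e) = f-sur v in fromℕ< x , trans (irr (toℕ-fromℕ< x)) e)
    (λ i j → f-adj (toℕ<n i) (toℕ<n j))
    where
    irr : ∀ {i j} {x : i < q + l} {y : j < q + l} → i ≡ j → f i x ≡ f j y
    irr {x = x} {y} refl = cong (f _) (<-irrelevant x y)

-- Rook's graph

≡ᵇ-× : ∀ {i i′ j j′} → T ((i ≡ᵇ i′) ∧ (j ≡ᵇ j′)) → (i , j) ≡ (i′ , j′)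
≡ᵇ-× {i} {i′} {j} {j′} t = cong₂ _,_ (≡ᵇ⇒≡ i i′ (∧-elim₁ t)) (≡ᵇ⇒≡ j j′ (∧-elim₂ {i ≡ᵇ i′} t))

rook : Raw
rook = record
  { R = ℕ × ℕ
  ; eq = λ (i , j) (i′ , j′) → (i ≡ᵇ i′) ∧ (j ≡ᵇ j′)
  ; eq-sound = λ { (i , j) (i′ , j′) t → ≡ᵇ-× t }
  ; eq-refl = λ (i , j) → ∧-intro (≡ᵇ-refl i) (≡ᵇ-refl j)
  ; adj = λ (i , j) (i′ , j′) → (i ≡ᵇ i′) xor (j ≡ᵇ j′)
  ; adj-sym = λ { (i , j) (i′ , j′) → subst T (cong₂ _xor_ (≡ᵇ-comm i i′) (≡ᵇ-comm j j′)) }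
  ; adj-irr = λ { (i , j) t → irr i j t }
  }
  where
  irr : ∀ i j → ¬ T ((i ≡ᵇ i) xor (j ≡ᵇ j))
  irr i j t rewrite T⇒≡ (≡ᵇ-refl i) | T⇒≡ (≡ᵇ-refl j) = t

-- Cycles of length at least 4 with a path

module Rook (q : ℕ) where
  open Growth rook (lol q) public
  open Raw rook using (adj)

  Square : ℕ → ℕ × ℕ → Set
  Square n (i , j) = i < n × j < n

  adj-row : ∀ {i j j′} → j ≢ j′ → adj (i , j) (i , j′) ≡ true
  adj-row {i} ne rewrite T⇒≡ (≡ᵇ-refl i) | ≢⇒≡ᵇ ne = refl

  adj-col : ∀ {i i′ j} → i ≢ i′ → adj (i , j) (i′ , j) ≡ true
  adj-col {j = j} ne rewrite T⇒≡ (≡ᵇ-refl j) | ≢⇒≡ᵇ ne = refl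

  adj-off : ∀ {i j i′ j′} → i ≢ i′ → j ≢ j′ → adj (i , j) (i′ , j′) ≡ false
  adj-off p r rewrite ≢⇒≡ᵇ p | ≢⇒≡ᵇ r = refl

  lol-next : ∀ i → lol q i (suc i) ≡ true
  lol-next i rewrite T⇒≡ (≡ᵇ-refl i) = refl

  lol-far : ∀ {i n} → suc i < n → suc n ≢ q → lol q i n ≡ false
  lol-far {i} {n} p ne rewrite ≢⇒≡ᵇ (λ e → <⇒≢ p (sym e)) | ≢⇒≡ᵇ ne with i ≡ᵇ 0
  ... | true = refl
  ... | false = refl

  data Way : Set where
    rowwise colwise : Way

  Free : Way → ℕ × ℕ → ℕ × ℕ → Set
  Free rowwise (i , _) (i′ , _) = i′ ≢ i
  Free colwise (_ , j) (_ , j′) = j′ ≢ j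

  module _ {v : ℕ × ℕ} where
    a = flip (0 , 0) v

    -- The last vertex can still move along its row (or its column) without meeting an earlier vertex.
    record Trail (P : ℕ × ℕ → Set) (z : ℕ × ℕ) (w : Way) (N len : ℕ) : Set where
      field
        end     : ℕ × ℕ
        mid     : List (ℕ × ℕ)
        induced : T (ind a (end ∷ mid ++ z ∷ []))
        bound   : All (Square N) (end ∷ mid ++ z ∷ [])
        free    : All (Free w end) (mid ++ z ∷ [])
        good    : All P (end ∷ mid)
        size    : length (end ∷ mid ++ z ∷ []) ≡ len

    turn : Way → Way
    turn rowwise = colwise
    turn colwise = rowwise

    go : Way → ℕ → ℕ × ℕ → ℕ × ℕ
    go rowwise N (i , j) = i , N
    go colwise N (i , j) = N , j

    Square-mono : ∀ {M N x} → M ≤ N → Square M x → Square N x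
    Square-mono le (p , r) = <-≤-trans p le , <-≤-trans r le

    go-new : ∀ w {N x z} → Square N z → go w N x ≢ z
    go-new rowwise (_ , s) e = <⇒≢ s (sym (cong proj₂ e))
    go-new colwise (s , _) e = <⇒≢ s (sym (cong proj₁ e))

    go-adj : ∀ w {N x} → Square N x → adj x (go w N x) ≡ true
    go-adj rowwise {x = x} (_ , s) = adj-row {proj₁ x} (<⇒≢ s)
    go-adj colwise {x = x} (s , _) = adj-col {j = proj₂ x} (<⇒≢ s)

    go-off : ∀ w {N x z} → Square N z → Free w x z → adj z (go w N x) ≡ false
    go-off rowwise (_ , s) f = adj-off f (<⇒≢ s)
    go-off colwise (s , _) f = adj-off (<⇒≢ s) f

    go-free : ∀ w {N x z} → Square N z → Free (turn w) (go w N x) z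
    go-free rowwise (_ , s) = <⇒≢ s
    go-free colwise (s , _) = <⇒≢ s

    go-bound : ∀ w {N x} → Square N x → Square (suc N) (go w N x)
    go-bound rowwise (p , _) = m≤n⇒m≤1+n p , ≤-refl
    go-bound colwise (_ , r) = ≤-refl , m≤n⇒m≤1+n r

    new-flip : ∀ {x} z y → y ≢ (0 , 0) → y ≢ v → adj z y ≡ x → a z y ≡ x
    new-flip z y p r e = trans (flip-new z y p r) e

    -- The line crossed at N is fresh, and no earlier vertex but `end` lies on the line along which
    -- it moves, so `end` is the only neighbour. The new vertex is alone on the fresh line, which
    -- allows the next move in the other direction. `suc len ≢ q` excludes the index that closes the
    -- cycle.
    step : ∀ {P z w N len} → Square N v → Square N (0 , 0) → (∀ {x} → P x → P (go w N x)) → suc len ≢ q →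
           Trail P z w N len → Trail P z (turn w) (suc N) (suc len)
    step {P} {z} {w} {N} {len} sv s0 pres ne t = record
      { end = y
      ; mid = end ∷ mid
      ; induced = extend {a} {y} {end} {mid ++ z ∷ []} induced (go-new w (All.head bound) ∘ sym)
          (new-flip end y (go-new w s0) (go-new w sv) (go-adj w (All.head bound)))
          (All.zipWith (λ {x} (s , f) → (go-new w s ∘ sym) , new-flip x y (go-new w s0) (go-new w sv) (go-off w s f)) (All.tail bound , free))
          (lol-next (length (mid ++ z ∷ []))) (λ i p → lol-far (s≤s p) (λ e → ne (trans (cong suc (sym size)) e)))
      ; bound = go-bound w (All.head bound) ∷ All.map (Square-mono (m≤n⇒m≤1+n ≤-refl)) bound
      ; free = All.map (go-free w) bound
      ; good = pres (All.head good) ∷ good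
      ; size = cong suc size
      }
      where
      open Trail t
      y = go w N end

    tail : ∀ k {z w N len} → Square N v → Square N (0 , 0) → q ≤ len → Trail (λ _ → ⊤) z w N len →
           Realises (Square (k + N)) (k + len) a
    tail zero sv s0 le t = realises _ (Trail.induced t) (Trail.bound t) (Trail.size t)
    tail (suc k) {N = N} {len} sv s0 le t = subst₂ (λ M n → Realises (Square M) n a) (+-suc k N) (+-suc k len)
      (tail k (Square-mono (m≤n⇒m≤1+n ≤-refl) sv) (Square-mono (m≤n⇒m≤1+n ≤-refl) s0) (m≤n⇒m≤1+n le)
        (step sv s0 (λ _ → tt) (λ e → <⇒≢ (s≤s le) (sym e)) t))

    -- Two moves restore the direction. With 3 ≤ N the fresh indices avoid 0, 1 and 2, which are
    -- reserved for closing the cycle; `P` states which of them the trail avoids.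
    zigzag : ∀ k {P : ℕ × ℕ → Set} {z N len} → Square N v → Square N (0 , 0) → 3 ≤ N →
             (∀ {w M x} → 3 ≤ M → P x → P (go w M x)) → len + (k + k) < q →
             Trail P z rowwise N len → Trail P z rowwise ((k + k) + N) ((k + k) + len)
    zigzag zero sv s0 3≤N pres lt t = t
    zigzag (suc k) {P} {z} {N} {len} sv s0 3≤N pres lt t =
      subst₂ (Trail P z rowwise) (e N) (e len)
        (zigzag k (Square-mono two sv) (Square-mono two s0) (≤-trans 3≤N two) pres (subst (_< q) (e′ k len) lt)
          (step {w = colwise} (Square-mono (m≤n⇒m≤1+n ≤-refl) sv) (Square-mono (m≤n⇒m≤1+n ≤-refl) s0) (pres {colwise} (m≤n⇒m≤1+n 3≤N)) (<⇒≢ l₂)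
            (step {w = rowwise} sv s0 (pres {rowwise} 3≤N) (<⇒≢ (<⇒≤ l₂)) t)))
      where
      two : ∀ {M} → M ≤ suc (suc M)
      two = m≤n⇒m≤1+n (m≤n⇒m≤1+n ≤-refl)
      e : ∀ M → (k + k) + suc (suc M) ≡ (suc k + suc k) + M
      e M = trans (+-suc (k + k) (suc M)) (cong suc (trans (+-suc (k + k) M) (cong (_+ M) (sym (+-suc k k)))))
      e′ : ∀ k len → len + (suc k + suc k) ≡ suc (suc len) + (k + k)
      e′ k len = trans (cong (len +_) (cong suc (+-suc k k))) (trans (+-suc len (suc (k + k))) (cong suc (+-suc len (k + k))))
      l₂ : suc (suc len) < q
      l₂ = ≤-<-trans (m≤m+n (suc (suc len)) (k + k)) (subst (_< q) (e′ k len) lt)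

    flip-keep : ∀ {x y} → (x ≡ (0 , 0) → y ≢ v) → (x ≡ v → y ≢ (0 , 0)) → a x y ≡ adj x y
    flip-keep {x} {y} f g = trans (cong (adj x y xor_) (¬T⇒≡ none)) (xor-false (adj x y))
      where
      xor-false : ∀ b → (b xor false) ≡ b
      xor-false true = refl
      xor-false false = refl
      none : ¬ T ((Raw.eq rook x (0 , 0) ∧ Raw.eq rook y v) ∨ (Raw.eq rook x v ∧ Raw.eq rook y (0 , 0)))
      none t with ∨-elim (Raw.eq rook x (0 , 0) ∧ Raw.eq rook y v) t
      ... | inj₁ s = f (Raw.eq-sound rook x _ (∧-elim₁ s)) (Raw.eq-sound rook y v (∧-elim₂ {Raw.eq rook x (0 , 0)} s))
      ... | inj₂ s = g (Raw.eq-sound rook x v (∧-elim₁ s)) (Raw.eq-sound rook y _ (∧-elim₂ {Raw.eq rook x v} s))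

    ring : ∀ {x r z ms} → T (ind a (x ∷ ms ++ z ∷ [])) → x ≢ r → a x r ≡ true → All (Apart a r) ms → z ≢ r → a z r ≡ true →
           suc (length (x ∷ ms ++ z ∷ [])) ≡ q → T (ind a (r ∷ x ∷ ms ++ z ∷ []))
    ring {x} {r} {z} {ms} i ne ad ap nz az e = ∧-intro {fits a n r (x ∷ ms ++ z ∷ [])}
      (fits-next {a} {n} {r} {x} {ms ++ z ∷ []} ne ad (lol-next (length (ms ++ z ∷ []))) (around ms ap ≤-refl)) i
      where
      n = length (x ∷ ms ++ z ∷ [])
      last : lol q 0 n ≡ true
      last = T⇒≡ (Equivalence.from (T-∨ {n ≡ᵇ 1}) (inj₂ (≡⇒≡ᵇ (suc n) q e)))
      inner : ∀ i → suc i < n → i ≢ 0 → lol q i n ≡ false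
      inner i p nz rewrite ≢⇒≡ᵇ (λ e → <⇒≢ p (sym e)) | ≢⇒≡ᵇ nz = refl
      snoc≢0 : ∀ ws → length (ws ++ z ∷ []) ≢ 0
      snoc≢0 [] ()
      snoc≢0 (_ ∷ _) ()
      around : ∀ ws → All (Apart a r) ws → suc (length (ws ++ z ∷ [])) ≤ n → T (fits a n r (ws ++ z ∷ []))
      around [] [] _ = fits-next {a} {n} {r} {z} {[]} nz az last tt
      around (w ∷ ws) ((nw , aw) ∷ aps) le = ∧-intro {not (Raw.eq rook w r) ∧ bool-eq (a w r) (lol q (length (ws ++ z ∷ [])) n)}
        (∧-intro (subst (T ∘ not) (sym (eq-≢ {w} {r} nw)) tt)
          (bool-eq-refl (trans aw (sym (inner (length (ws ++ z ∷ [])) le (snoc≢0 ws))))))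
        (around ws aps (<⇒≤ le))

    off : ∀ {x y} → proj₁ x ≢ proj₁ y → proj₂ x ≢ proj₂ y → (x ≡ (0 , 0) → y ≢ v) → (x ≡ v → y ≢ (0 , 0)) → Apart a y x
    off p r f g = (λ e → p (cong proj₁ e)) , trans (flip-keep f g) (adj-off p r)

    next : ∀ {x y ys} → T (ind a (x ∷ ys)) → x ≢ y → a x y ≡ true → All (Apart a y) ys → suc (suc (length ys)) ≢ q →
           T (ind a (y ∷ x ∷ ys))
    next {x} {y} {ys} i ne ad ap nq = extend {a} {y} {x} {ys} i ne ad ap (lol-next (length ys)) (λ i p → lol-far (s≤s p) nq)

-- Deleting an edge: the two ends become non-adjacent neighbours of the vertex (0 , 2).
module RookDelete (q : ℕ) where
  open Rook q hiding (off; flip-keep)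

  private
    v : ℕ × ℕ
    v = 0 , 1

    off : ∀ x y → proj₁ x ≢ proj₁ y → proj₂ x ≢ proj₂ y → (x ≡ (0 , 0) → y ≢ v) → (x ≡ v → y ≢ (0 , 0)) → Apart (a {v}) y x
    off x y = Rook.off q {v} {x} {y}

    keep : ∀ x y {b} → (x ≡ (0 , 0) → y ≢ v) → (x ≡ v → y ≢ (0 , 0)) → Raw.adj rook x y ≡ b → a {v} x y ≡ b
    keep x y f g e = trans (Rook.flip-keep q {v} {x} {y} f g) e

    P : ℕ × ℕ → Set
    P (i , j) = i ≢ 0 × j ≢ 1 × j ≢ 2

    pres : ∀ {w M x} → 3 ≤ M → P x → P (go {v} w M x)
    pres {rowwise} le (i0 , _ , _) = i0 , (λ e → <⇒≢ (<⇒≤ le) (sym e)) , (λ e → <⇒≢ le (sym e))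
    pres {colwise} le (_ , j1 , j2) = (λ e → <⇒≢ (<⇒≤ (<⇒≤ le)) (sym e)) , j1 , j2

  start : Trail {v} P (0 , 0) rowwise 3 2
  start = record { end = 1 , 0 ; mid = [] ; induced = tt ; bound = (s≤s (s≤s z≤n) , s≤s z≤n) ∷ (s≤s z≤n , s≤s z≤n) ∷ []
                 ; free = (λ ()) ∷ [] ; good = ((λ ()) , (λ ()) , λ ()) ∷ [] ; size = refl }

  -- An induced cycle of length at least 4 in a rook's graph alternates between rows and columns, so
  -- it is even. Here it passes through (0 , 0) and r = (0 , 2); after the deletion (0 , 1) is
  -- adjacent to r only and starts the path.
  even : ∀ {N len} → q ≡ suc (suc len) → 3 ≤ N → Trail {v} P (0 , 0) rowwise N len → Trail {v} (λ _ → ⊤) (0 , 0) colwise N (suc q)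
  even {N} qe 3≤N t = record
    { end = v ; mid = r ∷ y ∷ end ∷ mid
    ; induced = next {x = r} {v} {y ∷ end ∷ mid ++ (0 , 0) ∷ []} i₂ (λ ()) refl
        (off y v e0 (λ ()) (λ ()) (λ ()) ∷ ++⁺ (All.map (λ {x} (p , j , _) → off x v p j (λ { refl → ⊥-elim (p refl) }) (λ _ ())) good)
          (((λ ()) , refl) ∷ [])) (λ e → <⇒≢ {q} ≤-refl (sym (trans (cong suc (sym sz)) e)))
    ; bound = (0<N , 1<N) ∷ (0<N , 3≤N) ∷ (proj₁ (All.head bound) , 3≤N) ∷ bound
    ; free = (λ ()) ∷ (λ ()) ∷ ++⁺ (All.map (λ (_ , j , _) → j) good) ((λ ()) ∷ [])
    ; good = tt ∷ tt ∷ tt ∷ tt ∷ All.map (λ _ → tt) (All.tail good)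
    ; size = cong suc sz }
    where
    open Trail t
    y = proj₁ end , 2
    r = 0 , 2
    e0 = proj₁ (All.head good)
    0<N = <⇒≤ (<⇒≤ 3≤N)
    1<N = <⇒≤ 3≤N
    sz : suc (suc (length (end ∷ mid ++ (0 , 0) ∷ []))) ≡ q
    sz = trans (cong (2 +_) size) (sym qe)
    i₁ : T (ind (flip (0 , 0) v) (y ∷ end ∷ mid ++ (0 , 0) ∷ []))
    i₁ = next {x = end} {y} {mid ++ (0 , 0) ∷ []} induced (λ e → proj₂ (proj₂ (All.head good)) (cong proj₂ e))
      (keep end y (λ _ ()) (λ _ ()) (adj-row {proj₁ end} (proj₂ (proj₂ (All.head good)))))
      (++⁺ (All.zipWith (λ {x} (f , _ , _ , j) → off x y f j (λ _ ()) (λ _ ())) (++⁻ˡ mid free , All.tail good))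
           (off (0 , 0) y (All.head (++⁻ʳ mid free)) (λ ()) (λ _ ()) (λ _ ()) ∷ []))
      (λ e → <⇒≢ {suc (length (end ∷ mid ++ (0 , 0) ∷ []))} ≤-refl (trans e (sym sz)))
    i₂ : T (ind (flip (0 , 0) v) (r ∷ y ∷ end ∷ mid ++ (0 , 0) ∷ []))
    i₂ = ring {x = y} {r} {0 , 0} {end ∷ mid} i₁ (λ e → e0 (cong proj₁ e)) (keep y r (λ _ ()) (λ _ ()) (adj-col {j = 2} e0))
      (All.map (λ {x} (p , _ , j) → off x r p j (λ _ ()) (λ _ ())) good) (λ ()) refl sz

  -- Without the deleted edge the three vertices (0 , 0), (0 , 2), (0 , 1) of one row can be
  -- consecutive on the cycle, which breaks the alternation and makes the length odd.
  odd : ∀ {N len} → q ≡ suc (suc (suc len)) → 3 ≤ N → Trail {v} P (0 , 0) rowwise N len → Trail {v} (λ _ → ⊤) (0 , 0) colwise N q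
  odd {N} qe 3≤N t = record
    { end = r ; mid = v ∷ y ∷ end ∷ mid
    ; induced = ring {x = v} {r} {0 , 0} {y ∷ end ∷ mid} i₂ (λ ()) refl
        (off y r e0 (λ ()) (λ _ ()) (λ _ ()) ∷ All.map (λ {x} (p , _ , j) → off x r p j (λ _ ()) (λ _ ())) good) (λ ()) refl sz
    ; bound = (0<N , 3≤N) ∷ (0<N , 1<N) ∷ (proj₁ (All.head bound) , 1<N) ∷ bound
    ; free = (λ ()) ∷ (λ ()) ∷ ++⁺ (All.map (λ (_ , _ , j) → j) good) ((λ ()) ∷ [])
    ; good = tt ∷ tt ∷ tt ∷ tt ∷ All.map (λ _ → tt) (All.tail good)
    ; size = sz }
    where
    open Trail t
    y = proj₁ end , 1
    r = 0 , 2
    e0 = proj₁ (All.head good)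
    0<N = <⇒≤ (<⇒≤ 3≤N)
    1<N = <⇒≤ 3≤N
    sz : suc (suc (suc (length (end ∷ mid ++ (0 , 0) ∷ [])))) ≡ q
    sz = trans (cong (3 +_) size) (sym qe)
    y≢v : y ≢ v
    y≢v e = e0 (cong proj₁ e)
    i₁ : T (ind (flip (0 , 0) v) (y ∷ end ∷ mid ++ (0 , 0) ∷ []))
    i₁ = next {x = end} {y} {mid ++ (0 , 0) ∷ []} induced (λ e → proj₁ (proj₂ (All.head good)) (cong proj₂ e))
      (keep end y (λ _ → y≢v) (λ _ ()) (adj-row {proj₁ end} (proj₁ (proj₂ (All.head good)))))
      (++⁺ (All.zipWith (λ {x} (f , _ , j , _) → off x y f j (λ _ → y≢v) (λ _ ())) (++⁻ˡ mid free , All.tail good))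
           (off (0 , 0) y (All.head (++⁻ʳ mid free)) (λ ()) (λ _ → y≢v) (λ _ ()) ∷ []))
      (λ e → <⇒≢ {suc (length (end ∷ mid ++ (0 , 0) ∷ []))} (m≤n⇒m≤1+n ≤-refl) (trans e (sym sz)))
    i₂ : T (ind (flip (0 , 0) v) (v ∷ y ∷ end ∷ mid ++ (0 , 0) ∷ []))
    i₂ = next {x = y} {v} {end ∷ mid ++ (0 , 0) ∷ []} i₁ y≢v (keep y v (λ e → ⊥-elim (e0 (cong proj₁ e))) (λ _ ()) (adj-col {j = 1} e0))
      (++⁺ (All.map (λ {x} (p , j , _) → off x v p j (λ { refl → ⊥-elim (p refl) }) (λ _ ())) good) (((λ ()) , refl) ∷ []))
      (λ e → <⇒≢ {suc (suc (length (end ∷ mid ++ (0 , 0) ∷ [])))} ≤-refl (trans e (sym sz)))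

  grown : ∀ k → 2 + (k + k) < q → Trail {v} P (0 , 0) rowwise ((k + k) + 3) ((k + k) + 2)
  grown k lt = zigzag k (s≤s z≤n , s≤s (s≤s z≤n)) (s≤s z≤n , s≤s z≤n) ≤-refl (λ {w} {M} {x} → pres {w} {M} {x}) lt start

-- Adding an edge: (0 , 0) gets the new neighbour (1 , 1).
module RookAdd (q : ℕ) where
  open Rook q hiding (off; flip-keep)

  private
    v : ℕ × ℕ
    v = 1 , 1

    off : ∀ x y → proj₁ x ≢ proj₁ y → proj₂ x ≢ proj₂ y → (x ≡ (0 , 0) → y ≢ v) → (x ≡ v → y ≢ (0 , 0)) → Apart (a {v}) y x
    off x y = Rook.off q {v} {x} {y}

    keep : ∀ x y {b} → (x ≡ (0 , 0) → y ≢ v) → (x ≡ v → y ≢ (0 , 0)) → Raw.adj rook x y ≡ b → a {v} x y ≡ b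
    keep x y f g e = trans (Rook.flip-keep q {v} {x} {y} f g) e

    P : ℕ × ℕ → Set
    P (i , j) = i ≢ 0 × i ≢ 1 × j ≢ 0 × j ≢ 1

    Q : ℕ × ℕ → Set
    Q x = proj₁ x ≢ 0 × proj₂ x ≢ 0 × x ≢ v

    presP : ∀ {w M x} → 3 ≤ M → P x → P (go {v} w M x)
    presP {rowwise} le (i0 , i1 , _ , _) = i0 , i1 , (λ e → <⇒≢ (<⇒≤ (<⇒≤ le)) (sym e)) , (λ e → <⇒≢ (<⇒≤ le) (sym e))
    presP {colwise} le (_ , _ , j0 , j1) = (λ e → <⇒≢ (<⇒≤ (<⇒≤ le)) (sym e)) , (λ e → <⇒≢ (<⇒≤ le) (sym e)) , j0 , j1

    presQ : ∀ {w M x} → 3 ≤ M → Q x → Q (go {v} w M x)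
    presQ {rowwise} le (i0 , _ , _) = i0 , (λ e → <⇒≢ (<⇒≤ (<⇒≤ le)) (sym e)) , (λ e → <⇒≢ (<⇒≤ le) (sym (cong proj₂ e)))
    presQ {colwise} le (_ , j0 , _) = (λ e → <⇒≢ (<⇒≤ (<⇒≤ le)) (sym e)) , j0 , (λ e → <⇒≢ (<⇒≤ le) (sym (cong proj₁ e)))

  startP : Trail {v} P (0 , 2) rowwise 3 2
  startP = record { end = 2 , 2 ; mid = [] ; induced = tt ; bound = (≤-refl , ≤-refl) ∷ (s≤s z≤n , ≤-refl) ∷ []
                  ; free = (λ ()) ∷ [] ; good = ((λ ()) , (λ ()) , (λ ()) , λ ()) ∷ [] ; size = refl }

  startQ : 3 ≢ q → Trail {v} Q v rowwise 3 3
  startQ 3≢q = record { end = 2 , 2 ; mid = (1 , 2) ∷ []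
                  ; induced = ∧-intro (∧-intro tt (∧-intro (subst (λ b → T (bool-eq false b)) (sym (≢⇒≡ᵇ 3≢q)) tt) tt)) tt
                  ; bound = (≤-refl , ≤-refl) ∷ (s≤s (s≤s z≤n) , ≤-refl) ∷ (s≤s (s≤s z≤n) , s≤s (s≤s z≤n)) ∷ []
                  ; free = (λ ()) ∷ (λ ()) ∷ [] ; good = ((λ ()) , (λ ()) , λ ()) ∷ ((λ ()) , (λ ()) , λ ()) ∷ [] ; size = refl }

  -- The new edge is the one that closes the cycle; it replaces a turn and thereby makes the length
  -- odd.
  odd : ∀ {N len} → q ≡ suc (suc len) → 3 ≤ N → Trail {v} Q v rowwise N len → Trail {v} (λ _ → ⊤) v rowwise N q
  odd {N} qe 3≤N t = record
    { end = 0 , 0 ; mid = y ∷ end ∷ mid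
    ; induced = ring {x = y} {0 , 0} {v} {end ∷ mid} i₁ (λ e → e0 (cong proj₁ e)) (keep y (0 , 0) (λ _ ()) (λ e → ⊥-elim (y≢v e)) (adj-col {j = 0} e0))
        (All.map (λ {x} (p , j , ne) → off x (0 , 0) p j (λ _ ()) (λ e → ⊥-elim (ne e))) good) (λ ()) refl sz
    ; bound = (0<N , 0<N) ∷ (proj₁ (All.head bound) , 0<N) ∷ bound
    ; free = e0 ∷ ++⁺ (All.map proj₁ good) ((λ ()) ∷ [])
    ; good = tt ∷ tt ∷ tt ∷ All.map (λ _ → tt) (All.tail good)
    ; size = sz }
    where
    open Trail t
    y = proj₁ end , 0
    e0 = proj₁ (All.head good)
    0<N = <⇒≤ (<⇒≤ 3≤N)
    sz : suc (suc (length (end ∷ mid ++ v ∷ []))) ≡ q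
    sz = trans (cong (2 +_) size) (sym qe)
    y≢v : y ≢ v
    y≢v e with cong proj₂ e
    ... | ()
    y≢u : y ≢ (0 , 0)
    y≢u e = e0 (cong proj₁ e)
    i₁ : T (ind (flip (0 , 0) v) (y ∷ end ∷ mid ++ v ∷ []))
    i₁ = next {x = end} {y} {mid ++ v ∷ []} induced (λ e → proj₁ (proj₂ (All.head good)) (cong proj₂ e))
      (keep end y (λ _ y≡v → y≢v y≡v) (λ _ → y≢u) (adj-row {proj₁ end} (proj₁ (proj₂ (All.head good)))))
      (++⁺ (All.zipWith (λ {x} (f , _ , j , _) → off x y f j (λ _ ()) (λ _ → y≢u)) (++⁻ˡ mid free , All.tail good))
           (off v y (All.head (++⁻ʳ mid free)) (λ ()) (λ _ ()) (λ _ → y≢u) ∷ []))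
      (λ e → <⇒≢ {suc (length (end ∷ mid ++ v ∷ []))} ≤-refl (trans e (sym sz)))

  -- The cycle closes at (0 , 0) through row 0 as in the unchanged graph, and the new edge is the
  -- first edge of the path.
  even : ∀ {N len} → q ≡ suc (suc len) → 3 ≤ N → Trail {v} P (0 , 2) rowwise N len → Trail {v} (λ _ → ⊤) (0 , 2) colwise N (suc q)
  even {N} qe 3≤N t = record
    { end = v ; mid = (0 , 0) ∷ y ∷ end ∷ mid
    ; induced = next {x = 0 , 0} {v} {y ∷ end ∷ mid ++ (0 , 2) ∷ []} i₂ (λ ()) refl
        (off y v e1 (λ ()) (λ e → ⊥-elim (y≢u e)) (λ ()) ∷ ++⁺ (All.map (λ {x} (p , p1 , _ , j) → off x v p1 j (λ { refl → ⊥-elim (p refl) }) (λ _ ())) good)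
          (((λ ()) , refl) ∷ [])) (λ e → <⇒≢ {q} ≤-refl (sym (trans (cong suc (sym sz)) e)))
    ; bound = (1<N , 1<N) ∷ (0<N , 0<N) ∷ (proj₁ (All.head bound) , 0<N) ∷ bound
    ; free = (λ ()) ∷ (λ ()) ∷ ++⁺ (All.map (λ (_ , _ , _ , j) → j) good) ((λ ()) ∷ [])
    ; good = tt ∷ tt ∷ tt ∷ tt ∷ All.map (λ _ → tt) (All.tail good)
    ; size = cong suc sz }
    where
    open Trail t
    y = proj₁ end , 0
    e0 = proj₁ (All.head good)
    e1 = proj₁ (proj₂ (All.head good))
    ej = proj₁ (proj₂ (proj₂ (All.head good)))
    0<N = <⇒≤ (<⇒≤ 3≤N)
    1<N = <⇒≤ 3≤N
    sz : suc (suc (length (end ∷ mid ++ (0 , 2) ∷ []))) ≡ q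
    sz = trans (cong (2 +_) size) (sym qe)
    y≢v : y ≢ v
    y≢v e with cong proj₂ e
    ... | ()
    y≢u : y ≢ (0 , 0)
    y≢u e = e0 (cong proj₁ e)
    i₁ : T (ind (flip (0 , 0) v) (y ∷ end ∷ mid ++ (0 , 2) ∷ []))
    i₁ = next {x = end} {y} {mid ++ (0 , 2) ∷ []} induced (λ e → ej (cong proj₂ e))
      (keep end y (λ _ y≡v → y≢v y≡v) (λ _ → y≢u) (adj-row {proj₁ end} ej))
      (++⁺ (All.zipWith (λ {x} (f , _ , _ , j , _) → off x y f j (λ _ ()) (λ _ → y≢u)) (++⁻ˡ mid free , All.tail good))
           (off (0 , 2) y (All.head (++⁻ʳ mid free)) (λ ()) (λ _ ()) (λ _ → y≢u) ∷ []))
      (λ e → <⇒≢ {suc (length (end ∷ mid ++ (0 , 2) ∷ []))} ≤-refl (trans e (sym sz)))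
    i₂ : T (ind (flip (0 , 0) v) ((0 , 0) ∷ y ∷ end ∷ mid ++ (0 , 2) ∷ []))
    i₂ = ring {x = y} {0 , 0} {0 , 2} {end ∷ mid} i₁ y≢u (keep y (0 , 0) (λ _ ()) (λ e → ⊥-elim (y≢v e)) (adj-col {j = 0} e0))
      (All.map (λ {x} (p , _ , j , j1) → off x (0 , 0) p j (λ _ ()) (λ { refl → ⊥-elim (j1 refl) })) good) (λ ()) refl sz

  grownP : ∀ k → 2 + (k + k) < q → Trail {v} P (0 , 2) rowwise ((k + k) + 3) ((k + k) + 2)
  grownP k lt = zigzag k (s≤s (s≤s z≤n) , s≤s (s≤s z≤n)) (s≤s z≤n , s≤s z≤n) ≤-refl (λ {w} {M} {x} → presP {w} {M} {x}) lt startP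

  grownQ : ∀ k → 3 + (k + k) < q → Trail {v} Q v rowwise ((k + k) + 3) ((k + k) + 3)
  grownQ k lt = zigzag k (s≤s (s≤s z≤n) , s≤s (s≤s z≤n)) (s≤s z≤n , s≤s z≤n) ≤-refl (λ {w} {M} {x} → presQ {w} {M} {x}) lt (startQ (<⇒≢ (≤-<-trans (m≤m+n 3 (k + k)) lt)))

half : ∀ n → ∃[ k ] (n ≡ k + k ⊎ n ≡ suc (k + k))
half zero = 0 , inj₁ refl
half (suc n) with half n
... | k , inj₁ refl = k , inj₂ refl
... | k , inj₂ refl = suc k , inj₁ (cong suc (sym (+-suc k k)))

module RookHost (q′ l′ : ℕ) where
  private
    q = 4 + q′
    l = suc l′
    -- Freeness will come from claws and holds on every board, so the side only has to leave room
    -- for the copies.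
    n = (q + l) + 3
  open Rook q
  open Raw rook using (adj; adj-sym)

  squares : List (ℕ × ℕ)
  squares = cartesianProduct (upTo n) (upTo n)

  squares-unique : Unique squares
  squares-unique = cartesianProduct⁺ (upTo⁺ n) (upTo⁺ n)

  open Host squares squares-unique

  ∈⁺ : ∀ {x} → Square n x → x ∈ squares
  ∈⁺ (p , r) = ∈-cartesianProduct⁺ (∈-upTo⁺ p) (∈-upTo⁺ r)

  ∈⁻ : ∀ {x} → x ∈ squares → Square n x
  ∈⁻ m = let (p , r) = ∈-cartesianProduct⁻ (upTo n) (upTo n) m in ∈-upTo⁻ p , ∈-upTo⁻ r

  private
    finish : ∀ {v z w N} → N ≤ q → Square N v → Square N (0 , 0) → ∀ j len → q ≤ len → j + len ≡ q + l → j ≤ l →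
             Trail {v} (λ _ → ⊤) z w N len → Realises (Square n) (q + l) (flip (0 , 0) v)
    finish {v} {N = N} le sv s0 j len q≤ e jl t = subst (λ k → Realises (Square n) k (flip (0 , 0) v)) e
      (realises-dom (λ (p , s) → <-≤-trans p b , <-≤-trans s b) (tail j sv s0 q≤ t))
      where
      b : j + N ≤ n
      b = ≤-trans (subst (_≤ q + l) (+-comm N j) (+-mono-≤ le jl)) (m≤m+n (q + l) 3)

    last-step : l′ + suc q ≡ q + l
    last-step = trans (+-suc l′ q) (trans (cong suc (+-comm l′ q)) (sym (+-suc q l′)))

    N≤q : ∀ k c → (k + k) + 3 ≤ (4 + c) + (k + k)
    N≤q k c = subst (_≤ (4 + c) + (k + k)) (+-comm 3 (k + k)) (+-monoˡ-≤ (k + k) {3} {4 + c} (s≤s (s≤s (s≤s z≤n))))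

    three : ∀ k → 3 ≤ (k + k) + 3
    three k = m≤n+m 3 (k + k)

    sq : ∀ k {x} → Square 3 x → Square ((k + k) + 3) x
    sq k (p , s) = <-≤-trans p (three k) , <-≤-trans s (three k)

    len2 : ∀ k → suc (suc ((k + k) + 2)) ≡ 4 + (k + k)
    len2 k = cong (2 +_) (+-comm (k + k) 2)

    len3 : ∀ k → suc (suc ((k + k) + 3)) ≡ 5 + (k + k)
    len3 k = cong (2 +_) (+-comm (k + k) 3)

  delete : Realises (Square n) (q + l) (flip (0 , 0) (0 , 1))
  delete with half q′
  ... | k , inj₁ refl = finish (N≤q k 0) (sq k (s≤s z≤n , s≤s (s≤s z≤n))) (sq k (s≤s z≤n , s≤s z≤n)) l′ (suc q) (m≤n⇒m≤1+n ≤-refl) last-step (m≤n⇒m≤1+n ≤-refl)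
        (RookDelete.even q (sym (len2 k)) (three k) (RookDelete.grown q k (m≤n⇒m≤1+n ≤-refl)))
  ... | k , inj₂ refl = finish (N≤q k 1) (sq k (s≤s z≤n , s≤s (s≤s z≤n))) (sq k (s≤s z≤n , s≤s z≤n)) l q ≤-refl (+-comm l q) ≤-refl
        (RookDelete.odd q (sym (cong suc (len2 k))) (three k) (RookDelete.grown q k (m≤n⇒m≤1+n (m≤n⇒m≤1+n ≤-refl))))

  add : Realises (Square n) (q + l) (flip (0 , 0) (1 , 1))
  add with half q′
  ... | k , inj₁ refl = finish (N≤q k 0) (sq k (s≤s (s≤s z≤n) , s≤s (s≤s z≤n))) (sq k (s≤s z≤n , s≤s z≤n)) l′ (suc q) (m≤n⇒m≤1+n ≤-refl) last-step (m≤n⇒m≤1+n ≤-refl)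
        (RookAdd.even q (sym (len2 k)) (three k) (RookAdd.grownP q k (m≤n⇒m≤1+n ≤-refl)))
  ... | k , inj₂ refl = finish (N≤q k 1) (sq k (s≤s (s≤s z≤n) , s≤s (s≤s z≤n))) (sq k (s≤s z≤n , s≤s z≤n)) l q ≤-refl (+-comm l q) ≤-refl
        (RookAdd.odd q (sym (len3 k)) (three k) (RookAdd.grownQ q k (m≤n⇒m≤1+n ≤-refl)))

  straight twisted : Perm n → Perm n → ℕ × ℕ → ℕ × ℕ
  straight f g (i , j) = fun f i , fun g j
  twisted f g (i , j) = fun f j , fun g i

  move : ∀ {u v} f g → Realises (Square n) (q + l) (flip u v) → Realises (Square n) (q + l) (flip (straight f g u) (straight f g v))
  move f g = realises-map (straight f g) (λ e → cong₂ _,_ (inj f (cong proj₁ e)) (inj g (cong proj₂ e)))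
    (λ (i , j) (i′ , j′) → cong₂ _xor_ (eqᵇ f i i′) (eqᵇ g j j′)) (λ (p , s) → bnd f p , bnd g s)

  move′ : ∀ {u v} f g → Realises (Square n) (q + l) (flip u v) → Realises (Square n) (q + l) (flip (twisted f g u) (twisted f g v))
  move′ f g = realises-map (twisted f g) (λ e → cong₂ _,_ (inj g (cong proj₂ e)) (inj f (cong proj₁ e)))
    (λ (i , j) (i′ , j′) → trans (cong₂ _xor_ (eqᵇ f j j′) (eqᵇ g i i′)) (xor-comm (j ≡ᵇ j′) (i ≡ᵇ i′))) (λ (p , s) → bnd f s , bnd g p)

  flips : ∀ u v → Square n u → Square n v → u ≢ v → Realises (Square n) (q + l) (flip u v)
  flips (i , j) (i′ , j′) (in′ , jn) (in″ , jn′) ne with i ℕP.≟ i′ | j ℕP.≟ j′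
  ... | yes refl | yes refl = ⊥-elim (ne refl)
  ... | yes refl | no jj with place {n} (s≤s z≤n) in′ | place₂ {n} {0} {1} (s≤s z≤n) (s≤s (s≤s z≤n)) jn jn′ (λ ()) jj
  ...   | f , refl | g , refl , refl = move f g delete
  flips (i , j) (i′ , j′) (in′ , jn) (in″ , jn′) ne | no ii | yes refl
    with place₂ {n} {0} {1} (s≤s z≤n) (s≤s (s≤s z≤n)) in′ in″ (λ ()) ii | place {n} (s≤s z≤n) jn
  ... | f , refl , refl | g , refl = move′ f g delete
  flips (i , j) (i′ , j′) (in′ , jn) (in″ , jn′) ne | no ii | no jj
    with place₂ {n} {0} {1} (s≤s z≤n) (s≤s (s≤s z≤n)) in′ in″ (λ ()) ii | place₂ {n} {0} {1} (s≤s z≤n) (s≤s (s≤s z≤n)) jn jn′ (λ ()) jj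
  ... | f , refl , refl | g , refl , refl = move f g add

  -- Two of three neighbours of a square share its row or its column.
  no-claw : ∀ r x y z → T (adj r x) → T (adj r y) → T (adj r z) → x ≢ y → x ≢ z → y ≢ z →
            ¬ T (adj x y) → ¬ T (adj x z) → ¬ T (adj y z) → ⊥
  no-claw r x y z rx ry rz xy xz yz nxy nxz nyz = three-lines (line rx) (line ry) (line rz)
    where
    line : ∀ {r x} → T (adj r x) → proj₁ r ≡ proj₁ x ⊎ proj₂ r ≡ proj₂ x
    line {i , j} {i′ , j′} t with i ≡ᵇ i′ in e | j ≡ᵇ j′ in e′
    ... | true | false = inj₁ (≡ᵇ⇒≡ i i′ (≡⇒T e))
    ... | false | true = inj₂ (≡ᵇ⇒≡ j j′ (≡⇒T e′))
    same-row : ∀ {x y} → x ≢ y → proj₁ x ≡ proj₁ y → T (adj x y)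
    same-row {i , j} ne refl = ≡⇒T (adj-row {i} (λ e → ne (cong (i ,_) e)))
    same-col : ∀ {x y} → x ≢ y → proj₂ x ≡ proj₂ y → T (adj x y)
    same-col {i , j} ne refl = ≡⇒T (adj-col {j = j} (λ e → ne (cong (_, j) e)))
    three-lines : proj₁ r ≡ proj₁ x ⊎ proj₂ r ≡ proj₂ x → proj₁ r ≡ proj₁ y ⊎ proj₂ r ≡ proj₂ y →
                  proj₁ r ≡ proj₁ z ⊎ proj₂ r ≡ proj₂ z → ⊥
    three-lines (inj₁ a) (inj₁ b) _ = nxy (same-row xy (trans (sym a) b))
    three-lines (inj₂ a) (inj₂ b) _ = nxy (same-col xy (trans (sym a) b))
    three-lines (inj₁ a) (inj₂ b) (inj₁ c) = nxz (same-row xz (trans (sym a) c))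
    three-lines (inj₁ a) (inj₂ b) (inj₂ c) = nyz (same-col yz (trans (sym b) c))
    three-lines (inj₂ a) (inj₁ b) (inj₁ c) = nyz (same-row yz (trans (sym b) c))
    three-lines (inj₂ a) (inj₁ b) (inj₂ c) = nxz (same-col xz (trans (sym a) c))

  -- The attaching vertex q - 1 is the centre of a claw with leaves 0, q - 2 and q. This uses q ≥ 4:
  -- in a triangle the vertices 0 and q - 2 are adjacent.
  free : ¬ Embedding (Pat (lol q) (q + l)) graph
  free e = no-claw (r c) (r 0) (r p) (r q)
      (adj-sym (r 0) (r c) (subst T (sym (r-< {0} {c} (s≤s z≤n) c<)) (Equivalence.from (T-∨ {c ≡ᵇ 1}) (inj₂ (≡ᵇ-refl c)))))
      (adj-sym (r p) (r c) (subst T (sym (r-< {p} {c} ≤-refl c<)) (≡⇒T (lol-next p))))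
      (subst T (sym (r-< {c} {q} ≤-refl q<)) (≡⇒T (lol-next c)))
      (λ e → 0≢p (r-inj 0< p< e)) (λ e → 0≢q (r-inj 0< q< e)) (λ e → <⇒≢ (m≤n⇒m≤1+n (≤-refl {suc p})) (r-inj p< q< e))
      (λ t → subst T (trans (r-< {0} {p} (s≤s z≤n) p<) (lol-far (s≤s (s≤s z≤n)) (λ e → <⇒≢ ≤-refl e))) t)
      (λ t → subst T (trans (r-< {0} {q} (s≤s z≤n) q<) (lol-far (s≤s (s≤s z≤n)) (λ e → <⇒≢ ≤-refl (sym e)))) t)
      (λ t → subst T (trans (r-< {p} {q} (m≤n⇒m≤1+n ≤-refl) q<) (lol-far ≤-refl (λ e → <⇒≢ ≤-refl (sym e)))) t)
    where
    open Copied {rook} {lol q} {squares} {squares-unique} e (0 , 0)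
    p c : ℕ
    p = 2 + q′
    c = 3 + q′
    q< : q < q + l
    q< = m<m+n q (s≤s z≤n)
    c< : c < q + l
    c< = <⇒≤ q<
    p< : p < q + l
    p< = <⇒≤ c<
    0< : 0 < q + l
    0< = s≤s z≤n
    0≢p : 0 ≢ p
    0≢p ()
    0≢q : 0 ≢ q
    0≢q ()

  hosts : Hosts (q + l)
  hosts = record
    { free = free
    ; flips = λ u v mu mv ne → realises-dom ∈⁺ (flips u v (∈⁻ mu) (∈⁻ mv) ne)
    ; two = (0 , 0) , (0 , 1) , ∈⁺ (s≤s z≤n , s≤s z≤n) , ∈⁺ (s≤s z≤n , s≤s (s≤s z≤n)) , λ ()
    }

lollipop-host : ∀ q l {H} → H ≅ Pat (lol (4 + q)) ((4 + q) + suc l) → ∃[ G ] (Finite G × InducedSaturated H G)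
lollipop-host q l iso = Rook.Host.exists (4 + q) (RookHost.squares q l) (RookHost.squares-unique q l) iso (RookHost.hosts q l)

-- Spiders: 0 is the centre, 1, …, k are its neighbours, and then the remaining m a vertices of leg a follow for a = 0, 1, …

module Legs (k : ℕ) (m : ℕ → ℕ) where
  off : ℕ → ℕ
  off zero = suc k
  off (suc a) = m a + off a

  -- The number of the vertex at distance x from the centre on leg a.
  idx : ℕ → ℕ → ℕ
  idx a zero = 0
  idx a (suc zero) = suc a
  idx a (suc (suc q)) = q + off a

  -- Inverse of `idx` as far as the first K legs are concerned: the legs are tried from the last one
  -- down, and the centre and its neighbours remain.
  dec : ℕ → ℕ → ℕ × ℕ
  dec zero zero = 0 , 0
  dec zero (suc j) = j , 1
  dec (suc a) j = if j <ᵇ off a then dec a j else (a , suc (suc (j ∸ off a)))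

  -- In this numbering each vertex but the centre has exactly one earlier neighbour, so the whole
  -- pattern is encoded by parents.
  par : ℕ → ℕ
  par j = idx (proj₁ (dec k j)) (proj₂ (dec k j) ∸ 1)

  tree : ℕ → ℕ → Bool
  tree i j = par j ≡ᵇ i

  off-mono : ∀ {a b} → a ≤ b → off a ≤ off b
  off-mono {a} {zero} z≤n = ≤-refl
  off-mono {a} {suc b} le with m≤n⇒m<n∨m≡n le
  ... | inj₁ lt = ≤-trans (off-mono {a} {b} (≤-pred lt)) (m≤n+m (off b) (m b))
  ... | inj₂ refl = ≤-refl

  dec-leg : ∀ K a q → a < K → q < m a → dec K (q + off a) ≡ (a , suc (suc q))
  dec-leg (suc K) a q a<K qm with a ℕP.≟ K
  ... | yes refl rewrite ¬T⇒≡ (λ t → <⇒≱ (<ᵇ⇒< (q + off a) (off a) t) (m≤n+m (off a) q)) | m+n∸n≡m q (off a) = refl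
  ... | no ne rewrite T⇒≡ (<⇒<ᵇ {q + off a} {off K} (<-≤-trans (+-monoˡ-< (off a) qm) (off-mono {suc a} {K} (≤∧≢⇒< (≤-pred a<K) ne)))) =
    dec-leg K a q (≤∧≢⇒< (≤-pred a<K) ne) qm

  dec-start : ∀ K j → j ≤ k → dec K j ≡ dec 0 j
  dec-start zero j le = refl
  dec-start (suc K) j le rewrite T⇒≡ (<⇒<ᵇ {j} {off K} (≤-trans (s≤s le) (off-mono {0} {K} z≤n))) = dec-start K j le

  par-start : ∀ {j} → j ≤ k → par j ≡ 0
  par-start {zero} le rewrite dec-start k 0 le = refl
  par-start {suc j} le rewrite dec-start k (suc j) le = refl

  par-leg : ∀ {a q} → a < k → q < m a → par (q + off a) ≡ idx a (suc q)
  par-leg {a} {q} p r rewrite dec-leg k a q p r = refl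

  record Located (j : ℕ) (ax : ℕ × ℕ) : Set where
    constructor located
    field
      leg<     : proj₁ ax < k
      height≤  : proj₂ ax ≤ suc (m (proj₁ ax))
      position : idx (proj₁ ax) (proj₂ ax) ≡ j

  dec-sound : 0 < k → ∀ K j → K ≤ k → j < off K → Located j (dec K j)
  dec-sound 0<k zero zero K≤ j< = located 0<k z≤n refl
  dec-sound 0<k zero (suc j) K≤ j< = located (≤-pred j<) (s≤s z≤n) refl
  dec-sound 0<k (suc K) j K≤ j< with j <ᵇ off K in e
  ... | true = dec-sound 0<k K j (<⇒≤ K≤) (<ᵇ⇒< j (off K) (≡⇒T e))
  ... | false = located K≤ (s≤s (+-cancelʳ-≤ (off K) (suc (j ∸ off K)) (m K) (subst (_< m K + off K) (sym (m∸n+n≡m ge)) j<))) (m∸n+n≡m ge)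
    where
    ge : off K ≤ j
    ge = ≮⇒≥ (λ lt → subst T e (<⇒<ᵇ lt))

  idx-step : ∀ {a} → a < k → ∀ x → idx a x < idx a (suc x)
  idx-step a<k zero = s≤s z≤n
  idx-step {a} a<k (suc zero) = ≤-trans (s≤s a<k) (off-mono {0} {a} z≤n)
  idx-step a<k (suc (suc q)) = ≤-refl

module Spider {k : ℕ} {H : Graph} (S : IsSpider k H) (0<k : 0 < k) where
  open IsSpider S

  m : ℕ → ℕ
  m a with a <? k
  ... | yes p = legLength (fromℕ< p) ∸ 1
  ... | no _ = 0

  open Legs k m public

  private
    length≡ : ∀ {a} (p : a < k) → legLength (fromℕ< p) ≡ suc (m a)
    length≡ {a} p with a <? k
    ... | no np = ⊥-elim (np p)
    ... | yes q rewrite <-irrelevant q p = sym (m+[n∸m]≡n (nontrivial (fromℕ< p)))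

    at : ∀ {a x} (p : a < k) → x ≤ suc (m a) → Fin (suc (legLength (fromℕ< p)))
    at {x = x} p q = fromℕ< (s≤s (subst (x ≤_) (sym (length≡ p)) q))

    toℕ-at : ∀ {a x} (p : a < k) (q : x ≤ suc (m a)) → toℕ (at p q) ≡ x
    toℕ-at p q = toℕ-fromℕ< _

    abstract
      v : ∀ a x → a < k → x ≤ suc (m a) → V H
      v a x p q = vertex (leg (fromℕ< p)) (at p q)

      v-def : ∀ {a x} p q → v a x p q ≡ vertex (leg (fromℕ< p)) (at p q)
      v-def p q = refl

    v-cong : ∀ {a b x y p q p′ q′} → a ≡ b → x ≡ y → v a x p q ≡ v b y p′ q′
    v-cong {p = p} {q} {p′} {q′} refl refl rewrite <-irrelevant p p′ | ≤-irrelevant q q′ = refl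

    v-zero : ∀ {a} p q → v a 0 p q ≡ r
    v-zero p q = trans (v-def p q) (start (fromℕ< p))

    v-inj′ : ∀ {a x y p q q′} → v a x p q ≡ v a y p q′ → x ≡ y
    v-inj′ {p = p} {q} {q′} e = trans (sym (toℕ-at p q)) (trans (cong toℕ (Copy.injective (leg (fromℕ< p)) (trans (sym (v-def p q)) (trans e (v-def p q′))))) (toℕ-at p q′))

    v-inj : ∀ {a b x y p q p′ q′} → v a x p q ≡ v b y p′ q′ → (x ≡ 0 × y ≡ 0) ⊎ (a ≡ b × x ≡ y)
    v-inj {a} {b} {x} {y} {p} {q} {p′} {q′} e with a ℕP.≟ b
    ... | yes refl = inj₂ (refl , v-inj′ (trans e (v-cong {p = p′} {q′} {p} {q′} refl refl)))
    ... | no ne = inj₁ (v-inj′ (trans root (sym (v-zero p z≤n))) , v-inj′ (trans (sym e) (trans root (sym (v-zero p′ z≤n)))))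
      where
      root : v a x p q ≡ r
      root = meet (fromℕ< p) (fromℕ< p′) (λ i → ne (trans (sym (toℕ-fromℕ< p)) (trans (cong toℕ i) (toℕ-fromℕ< p′)))) _
                  (at p q , sym (v-def p q)) (at p′ q′ , trans (sym (v-def p′ q′)) (sym e))

    N = off k

    loc : ∀ {j} → j < N → Located j (dec k j)
    loc {j} p = dec-sound 0<k k j ≤-refl p

    f : ∀ j → j < N → V H
    f j p = v (proj₁ (dec k j)) (proj₂ (dec k j)) (Located.leg< (loc p)) (Located.height≤ (loc p))

    idx-cong : ∀ {a b x y} → (x ≡ 0 × y ≡ 0) ⊎ (a ≡ b × x ≡ y) → idx a x ≡ idx b y
    idx-cong (inj₁ (refl , refl)) = refl
    idx-cong (inj₂ (refl , refl)) = refl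

    f-inj : ∀ {i j} p q → f i p ≡ f j q → i ≡ j
    f-inj p q e = trans (sym (Located.position (loc p))) (trans (idx-cong (v-inj e)) (Located.position (loc q)))

    idx-< : ∀ {a} → a < k → ∀ x → x ≤ suc (m a) → idx a x < N
    idx-< a<k zero _ = ≤-trans (s≤s z≤n) (off-mono {0} {k} z≤n)
    idx-< a<k (suc zero) _ = ≤-trans (s≤s a<k) (off-mono {0} {k} z≤n)
    idx-< {a} a<k (suc (suc x)) le = <-≤-trans (+-monoˡ-< (off a) (≤-pred le)) (off-mono {suc a} {k} a<k)

    f-idx : ∀ {a} (p : a < k) x (q : x ≤ suc (m a)) → f (idx a x) (idx-< p x q) ≡ v a x p q
    f-idx {a} p zero q = trans (v-cong′ (dec-start k 0 z≤n)) (trans (v-zero 0<k z≤n) (sym (v-zero p q)))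
      where
      v-cong′ : ∀ {ax by} {p q p′ q′} → ax ≡ by → v (proj₁ ax) (proj₂ ax) p q ≡ v (proj₁ by) (proj₂ by) p′ q′
      v-cong′ e = v-cong (cong proj₁ e) (cong proj₂ e)
    f-idx {a} p (suc zero) q = v-cong (cong proj₁ (dec-start k (suc a) p)) (cong proj₂ (dec-start k (suc a) p))
    f-idx {a} p (suc (suc x)) q = v-cong (cong proj₁ (dec-leg k a x p (≤-pred q))) (cong proj₂ (dec-leg k a x p (≤-pred q)))

    f-irr : ∀ {i j p q} → i ≡ j → f i p ≡ f j q
    f-irr {p = p} {q} refl = cong (f _) (<-irrelevant p q)

    f-sur : ∀ w → ∃[ j ] Σ[ p ∈ j < N ] f j p ≡ w
    f-sur w with vertices w
    ... | i , x , refl = idx a (toℕ x) , idx-< a<k (toℕ x) x≤ , trans (f-idx a<k (toℕ x) x≤) (trans (v-def a<k x≤) (leg-cong (FP.fromℕ<-toℕ i a<k) (toℕ-at a<k x≤)))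
      where
      a = toℕ i
      a<k = toℕ<n i
      x≤ : toℕ x ≤ suc (m a)
      x≤ = subst (toℕ x ≤_) (trans (cong legLength (sym (FP.fromℕ<-toℕ i a<k))) (length≡ a<k)) (≤-pred (toℕ<n x))
      leg-cong : ∀ {i′ i″} {y : Fin (suc (legLength i′))} {z : Fin (suc (legLength i″))} → i′ ≡ i″ → toℕ y ≡ toℕ z → vertex (leg i′) y ≡ vertex (leg i″) z
      leg-cong refl e = cong (vertex (leg _)) (toℕ-injective e)

    edge-up : ∀ {a} p x q q′ → Adj H (v a x p q) (v a (suc x) p q′)
    edge-up p x q q′ = subst₂ (Adj H) (sym (v-def p q)) (sym (v-def p q′))
      (Copy.edge (leg (fromℕ< p)) (inj₁ (trans (toℕ-at p q′) (cong suc (sym (toℕ-at p q))))))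

    f-adj : ∀ {i j} (p : i < N) (q : j < N) → i < j → T (tree i j) ⇔ Adj H (f i p) (f j q)
    f-adj {i} {j} p q i<j with dec k j | loc q
    ... | b , zero | located _ _ pos = ⊥-elim (n≮0 (subst (i <_) (sym pos) i<j))
    ... | b , suc y | located b<k y≤ pos = mk⇔ to from
      where
      to : T (idx b y ≡ᵇ i) → Adj H (f i p) (v b (suc y) b<k y≤)
      to t = subst (λ z → Adj H z (v b (suc y) b<k y≤))
        (trans (sym (f-idx b<k y (<⇒≤ y≤))) (f-irr {q = p} (≡ᵇ⇒≡ (idx b y) i t))) (edge-up b<k y (<⇒≤ y≤) y≤)
      same : ∀ {x} q′ → f i p ≡ v b x b<k q′ → i ≡ idx b x
      same {x} q′ e = f-inj p (idx-< b<k x q′) (trans e (sym (f-idx b<k x q′)))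
      near : ∀ x → (suc y ≡ suc x ⊎ x ≡ suc (suc y)) → ∀ q′ → f i p ≡ v b x b<k q′ → T (idx b y ≡ᵇ i)
      near x (inj₁ refl) q′ e = ≡⇒≡ᵇ _ _ (sym (same q′ e))
      near x (inj₂ refl) q′ e = ⊥-elim (<-asym i<j (subst₂ _<_ pos (sym (same q′ e)) (idx-step b<k (suc y))))
      from : Adj H (f i p) (v b (suc y) b<k y≤) → T (idx b y ≡ᵇ i)
      from ad with edges _ _ ad
      ... | c , x , y′ , xy , ex , ey with c FP.≟ fromℕ< b<k
      ...   | no ne = ⊥-elim (0≢1+n (sym (v-inj′ (trans (meet (fromℕ< b<k) c (ne ∘ sym) _ (at b<k y≤ , sym (v-def b<k y≤)) (y′ , ey)) (sym (v-zero b<k z≤n))))))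
      ...   | yes refl = near (toℕ x) (steps xy) x≤ (trans (sym ex) (trans (cong (vertex (leg (fromℕ< b<k))) (toℕ-injective (sym (toℕ-at b<k x≤)))) (sym (v-def b<k x≤))))
        where
        x≤ : toℕ x ≤ suc (m b)
        x≤ = subst (toℕ x ≤_) (length≡ b<k) (≤-pred (toℕ<n x))
        y≡ : toℕ y′ ≡ suc y
        y≡ = trans (cong toℕ (Copy.injective (leg (fromℕ< b<k)) (trans ey (v-def b<k y≤)))) (toℕ-at b<k y≤)
        steps : toℕ y′ ≡ suc (toℕ x) ⊎ toℕ x ≡ suc (toℕ y′) → suc y ≡ suc (toℕ x) ⊎ toℕ x ≡ suc (suc y)
        steps (inj₁ s) = inj₁ (trans (sym y≡) s)
        steps (inj₂ s) = inj₂ (trans s (cong suc y≡))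

  iso : H ≅ Pat tree (off k)
  iso = ≅-from {tree} {N} {H} (λ i → f (toℕ i) (toℕ<n i)) (λ {i} {j} e → toℕ-injective (f-inj (toℕ<n i) (toℕ<n j) e))
    (λ w → let (i , x , e) = f-sur w in fromℕ< x , trans (f-irr (toℕ-fromℕ< x)) e)
    (λ i j → f-adj (toℕ<n i) (toℕ<n j))

-- The host for spiders: tuples, adjacent when they agree somewhere

open import Data.Vec using ([]; _∷_)

eqᵛ shareᵇ : ∀ {d} → Vec ℕ d → Vec ℕ d → Bool
eqᵛ [] [] = true
eqᵛ (x ∷ xs) (y ∷ ys) = (x ≡ᵇ y) ∧ eqᵛ xs ys
shareᵇ [] [] = false
shareᵇ (x ∷ xs) (y ∷ ys) = (x ≡ᵇ y) ∨ shareᵇ xs ys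

eqᵛ-sound : ∀ {d} (x y : Vec ℕ d) → T (eqᵛ x y) → x ≡ y
eqᵛ-sound [] [] _ = refl
eqᵛ-sound (x ∷ xs) (y ∷ ys) t = cong₂ _∷_ (≡ᵇ⇒≡ x y (∧-elim₁ t)) (eqᵛ-sound xs ys (∧-elim₂ {x ≡ᵇ y} t))

eqᵛ-refl : ∀ {d} (x : Vec ℕ d) → T (eqᵛ x x)
eqᵛ-refl [] = tt
eqᵛ-refl (x ∷ xs) = ∧-intro (≡ᵇ-refl x) (eqᵛ-refl xs)

share-sound : ∀ {d} (x y : Vec ℕ d) → T (shareᵇ x y) → ∃[ e ] Vec.lookup x e ≡ Vec.lookup y e
share-sound [] [] ()
share-sound (x ∷ xs) (y ∷ ys) t with ∨-elim (x ≡ᵇ y) t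
... | inj₁ s = zero , ≡ᵇ⇒≡ x y s
... | inj₂ s = let (e , p) = share-sound xs ys s in suc e , p

share-intro : ∀ {d} (x y : Vec ℕ d) e → Vec.lookup x e ≡ Vec.lookup y e → T (shareᵇ x y)
share-intro (x ∷ xs) (y ∷ ys) zero p = Equivalence.from (T-∨ {x ≡ᵇ y}) (inj₁ (≡⇒≡ᵇ x y p))
share-intro (x ∷ xs) (y ∷ ys) (suc e) p = Equivalence.from (T-∨ {x ≡ᵇ y}) (inj₂ (share-intro xs ys e p))

not-intro : ∀ {b} → ¬ T b → T (not b)
not-intro {true} n = n tt
not-intro {false} _ = tt

not-elim : ∀ {b} → T (not b) → ¬ T b
not-elim {true} t _ = t

tuples : ℕ → Raw
tuples d = record
  { R = Vec ℕ d
  ; eq = eqᵛ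
  ; eq-sound = eqᵛ-sound
  ; eq-refl = eqᵛ-refl
  ; adj = λ x y → not (eqᵛ x y) ∧ shareᵇ x y
  ; adj-sym = λ x y t → ∧-intro (not-intro (λ s → not-elim {eqᵛ x y} (∧-elim₁ t) (subst (λ z → T (eqᵛ z y)) (eqᵛ-sound y x s) (eqᵛ-refl y))))
                          (let (e , p) = share-sound x y (∧-elim₂ {not (eqᵛ x y)} t) in share-intro y x e (sym p))
  ; adj-irr = λ x t → not-elim {eqᵛ x x} (∧-elim₁ t) (eqᵛ-refl x)
  }

Vec-ext : ∀ {d} (x y : Vec ℕ d) → (∀ e → Vec.lookup x e ≡ Vec.lookup y e) → x ≡ y
Vec-ext x y h = trans (sym (tabulate∘lookup x)) (trans (tabulate-cong h) (tabulate∘lookup y))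

allVecs : ℕ → ∀ d → List (Vec ℕ d)
allVecs n zero = [] ∷ []
allVecs n (suc d) = map (λ (x , xs) → x ∷ xs) (cartesianProduct (upTo n) (allVecs n d))

allVecs-unique : ∀ n d → Unique (allVecs n d)
allVecs-unique n zero = [] ∷ []
allVecs-unique n (suc d) = Unique-map⁺ (λ { refl → refl }) (cartesianProduct⁺ (upTo⁺ n) (allVecs-unique n d))

Bounded : ∀ {d} → ℕ → Vec ℕ d → Set
Bounded n x = ∀ e → Vec.lookup x e < n

∈-allVecs⁺ : ∀ {n d} {x : Vec ℕ d} → Bounded n x → x ∈ allVecs n d
∈-allVecs⁺ {x = []} b = here refl
∈-allVecs⁺ {x = x ∷ xs} b = ∈-map⁺ (λ (x , xs) → x ∷ xs) (∈-cartesianProduct⁺ (∈-upTo⁺ (b zero)) (∈-allVecs⁺ (b ∘ suc)))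

∈-allVecs⁻ : ∀ {n d} {x : Vec ℕ d} → x ∈ allVecs n d → Bounded n x
∈-allVecs⁻ {n} {suc d} m e with ∈-map⁻ (λ (x , xs) → x ∷ xs) m
... | (y , ys) , my , refl with ∈-cartesianProduct⁻ (upTo n) (allVecs n d) my | e
...   | p , q | zero = ∈-upTo⁻ p
...   | p , q | suc e′ = ∈-allVecs⁻ q e′

-- Spiders in the graph of tuples

module Tuples (d′ : ℕ) (m : ℕ → ℕ) where
  d k : ℕ
  d = suc (suc d′)
  k = suc d
  open Legs k m
  open Growth (tuples d) tree public
  open Raw (tuples d) using (R; adj; adj-sym)

  adj-true : ∀ {x y} e → x ≢ y → Vec.lookup x e ≡ Vec.lookup y e → adj x y ≡ true
  adj-true {x} {y} e ne p = T⇒≡ (∧-intro (not-intro (ne ∘ eqᵛ-sound x y)) (share-intro x y e p))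

  adj-false : ∀ {x y} → (∀ e → Vec.lookup x e ≢ Vec.lookup y e) → adj x y ≡ false
  adj-false {x} {y} h = ¬T⇒≡ (λ t → let (e , p) = share-sound x y (∧-elim₂ {not (eqᵛ x y)} t) in h e p)

  -- If N is a new symbol, this tuple can agree with earlier ones only in coordinate c, and only
  -- through the symbol s.
  spot : Fin d → ℕ → ℕ → R
  spot c s N = replicate d N [ c ]≔ s

  spot-at : ∀ c s N → Vec.lookup (spot c s N) c ≡ s
  spot-at c s N = lookup∘update c (replicate d N) s

  spot-off : ∀ {c e} s N → e ≢ c → Vec.lookup (spot c s N) e ≡ N
  spot-off {c} {e} s N ne = trans (lookup∘update′ ne (replicate d N) s) (lookup-replicate e N)

  -- A leg is continued from its new end in a coordinate other than the one just used; a second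
  -- coordinate exists because k ≥ 3.
  other : Fin d → Fin d
  other zero = suc zero
  other (suc _) = zero

  other-≢ : ∀ c → other c ≢ c
  other-≢ zero ()
  other-≢ (suc _) ()

  Everywhere : (ℕ → R → Set) → List R → Set
  Everywhere P [] = ⊤
  Everywhere P (z ∷ zs) = P (length zs) z × Everywhere P zs

  Sits : ℕ → R → List R → Set
  Sits t x [] = ⊥
  Sits t x (z ∷ zs) = (t ≡ length zs × x ≡ z) ⊎ Sits t x zs

  sits-∈ : ∀ {P : R → Set} {t x} xs → All P xs → Sits t x xs → P x
  sits-∈ (z ∷ zs) (p ∷ _) (inj₁ (_ , refl)) = p
  sits-∈ (z ∷ zs) (_ ∷ ps) (inj₂ s) = sits-∈ zs ps s

  sits-< : ∀ {t x} xs → Sits t x xs → t < length xs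
  sits-< (z ∷ zs) (inj₁ (refl , _)) = ≤-refl
  sits-< (z ∷ zs) (inj₂ s) = m≤n⇒m≤1+n (sits-< zs s)

  every-sits : ∀ {P t x} xs → Everywhere P xs → Sits t x xs → P t x
  every-sits (z ∷ zs) (p , _) (inj₁ (refl , refl)) = p
  every-sits (z ∷ zs) (_ , ps) (inj₂ s) = every-sits zs ps s

  Or : ℕ → R → Fin d → ℕ → R → Set
  Or t x c i z = (i ≡ t × z ≡ x) ⊎ (i ≢ t × Vec.lookup z c ≢ Vec.lookup x c)

  -- Vertex x has index t and is the only one with its symbol in coordinate c.
  Tip : List R → ℕ → R → Fin d → Set
  Tip xs t x c = Sits t x xs × Everywhere (Or t x c) xs

  module _ {u v : R} where
    private
      a = flip u v

    -- The child repeats the symbol of x in coordinate c, where x is the only vertex with it, and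
    -- has a new symbol elsewhere. So x is its only neighbour so far.
    module Child {N t x c xs} (un : Bounded N u) (vn : Bounded N v) (b : All (Bounded N) xs) (i : T (ind a xs))
                 (tip : Tip xs t x c) (parent : par (length xs) ≡ t) where
      y : R
      y = spot c (Vec.lookup x c) N

      x< : Bounded N x
      x< = sits-∈ xs b (proj₁ tip)

      y-fresh : ∀ {z} → Bounded N z → y ≢ z
      y-fresh {z} zb e = <⇒≢ (zb (other c)) (sym (trans (sym (spot-off _ N (other-≢ c))) (cong (λ w → Vec.lookup w (other c)) e)))

      keep : ∀ z → a z y ≡ adj z y
      keep z = flip-new {u} {v} z y (y-fresh un) (y-fresh vn)

      fit : ∀ zs → All (Bounded N) zs → Everywhere (Or t x c) zs → T (fits a (length xs) y zs)
      fit [] _ _ = tt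
      fit (z ∷ zs) (zb ∷ zbs) (inj₁ (e , refl) , es) = ∧-intro {not (eqᵛ z y) ∧ bool-eq (a z y) (tree (length zs) (length xs))}
        (∧-intro (not-intro (λ s → y-fresh zb (sym (eqᵛ-sound z y s))))
          (bool-eq-refl (trans (keep z) (trans (adj-true {z} {y} c (y-fresh zb ∘ sym) (sym (spot-at c _ N)))
            (sym (T⇒≡ (≡⇒≡ᵇ _ _ (trans parent (sym e)))))))))
        (fit zs zbs es)
      fit (z ∷ zs) (zb ∷ zbs) (inj₂ (i≢ , ne) , es) = ∧-intro {not (eqᵛ z y) ∧ bool-eq (a z y) (tree (length zs) (length xs))}
        (∧-intro (not-intro (λ s → y-fresh zb (sym (eqᵛ-sound z y s))))
          (bool-eq-refl (trans (keep z) (trans (adj-false {z} {y} none)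
            (sym (¬T⇒≡ (λ s → i≢ (sym (trans (sym parent) (≡ᵇ⇒≡ _ _ s))))))))))
        (fit zs zbs es)
        where
        none : ∀ e → Vec.lookup z e ≢ Vec.lookup y e
        none e p with e FP.≟ c
        ... | yes refl = ne (trans p (spot-at c _ N))
        ... | no e≢ = <⇒≢ (zb e) (trans p (spot-off _ N e≢))

      induced : T (ind a (y ∷ xs))
      induced = ∧-intro {fits a (length xs) y xs} (fit xs b (proj₂ tip)) i

      bounded : All (Bounded (suc N)) (y ∷ xs)
      bounded = y< ∷ All.map (λ zb e → m≤n⇒m≤1+n (zb e)) b
        where
        y< : Bounded (suc N) y
        y< e with e FP.≟ c
        ... | yes refl = subst (_< suc N) (sym (spot-at c _ N)) (m≤n⇒m≤1+n (x< c))
        ... | no e≢ = subst (_< suc N) (sym (spot-off _ N e≢)) ≤-refl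

      -- The child could spoil another tip only by repeating its symbol. Outside c its symbol is
      -- new; in c it is the symbol of x, which no other vertex has.
      preserve : ∀ {t′ x′ c′} → t′ ≢ t ⊎ c′ ≢ c → Tip xs t′ x′ c′ → Tip (y ∷ xs) t′ x′ c′
      preserve {t′} {x′} {c′} h (s , es) = inj₂ s , inj₂ ((λ e → <⇒≢ (sits-< xs s) (sym e)) , ne h) , es
        where
        ne : t′ ≢ t ⊎ c′ ≢ c → Vec.lookup y c′ ≢ Vec.lookup x′ c′
        ne h p with c′ FP.≟ c
        ... | no c≢ = <⇒≢ (sits-∈ xs b s c′) (sym (trans (sym (spot-off _ N c≢)) p))
        ... | yes refl with h
        ...   | inj₂ c≢ = c≢ refl
        ...   | inj₁ t≢ with every-sits xs (proj₂ tip) s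
        ...     | inj₁ (e , _) = t≢ e
        ...     | inj₂ (_ , n) = n (trans (sym p) (spot-at c _ N))

      fresh : Tip (y ∷ xs) (length xs) y (other c)
      fresh = inj₁ (refl , refl) , inj₁ (refl , refl) , rest xs b ≤-refl
        where
        rest : ∀ zs → All (Bounded N) zs → length zs ≤ length xs → Everywhere (Or (length xs) y (other c)) zs
        rest [] _ _ = tt
        rest (z ∷ zs) (zb ∷ zbs) le = inj₂ (<⇒≢ le , λ p → <⇒≢ (zb (other c)) (trans p (spot-off _ N (other-≢ c)))) , rest zs zbs (<⇒≤ le)

    record State (Pending : List R → Set) (n : ℕ) : Set where
      field
        verts   : List R
        symbols : ℕ
        u<      : Bounded symbols u
        v<      : Bounded symbols v
        bounded : All (Bounded symbols) verts
        induced : T (ind a verts)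
        tips    : Pending verts
        size    : length verts ≡ n
        few     : symbols ≤ 3 + n

    Bounded-suc : ∀ {N} (x : R) → Bounded N x → Bounded (suc N) x
    Bounded-suc _ h e = m≤n⇒m≤1+n (h e)

    Legs-from : ℕ → List R → Set
    Legs-from A xs = ∀ b → A ≤ b → b < k → ∃[ x ] ∃[ c ] Tip xs (suc b) x c

    Current : ℕ → ℕ → List R → Set
    Current A q xs = (∃[ x ] ∃[ c ] Tip xs (idx A (suc q)) x c) × Legs-from (suc A) xs

    idx≢ : ∀ {A} q b → A < b → b < k → suc b ≢ idx A (suc q)
    idx≢ zero b A<b b<k e = <⇒≢ A<b (sym (suc-injective e))
    idx≢ {A} (suc q) b A<b b<k e = <⇒≢ (≤-trans (s≤s b<k) (≤-trans (off-mono {0} {A} z≤n) (m≤n+m (off A) q))) e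

    lengthen : ∀ A → A < k → ∀ q → q ≤ m A → State (Legs-from A) (off A) → State (Current A q) (q + off A)
    lengthen A A<k zero _ s = record
      { verts = verts ; symbols = symbols ; u< = u< ; v< = v< ; bounded = bounded ; induced = induced ; size = size ; few = few
      ; tips = tips A ≤-refl A<k , λ b le → tips b (<⇒≤ le) }
      where
      open State s
    lengthen A A<k (suc q) q< s = record
      { verts = C.y ∷ verts ; symbols = suc symbols ; u< = Bounded-suc u u< ; v< = Bounded-suc v v< ; bounded = C.bounded ; induced = C.induced
      ; size = cong suc size ; few = s≤s few
      ; tips = (C.y , other c , subst (λ j → Tip (C.y ∷ verts) j C.y (other c)) size C.fresh)
             , λ b le b<k → let (x′ , c′ , t′) = proj₂ tips b le b<k in x′ , c′ , C.preserve (inj₁ (idx≢ q b le b<k)) t′ }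
      where
      open State (lengthen A A<k q (<⇒≤ q<) s)
      c = proj₁ (proj₂ (proj₁ tips))
      module C = Child {symbols} {idx A (suc q)} {proj₁ (proj₁ tips)} {c} {verts} u< v< bounded induced (proj₂ (proj₂ (proj₁ tips)))
                       (trans (cong par size) (par-leg A<k q<))

    legs : ∀ A → A ≤ k → State (Legs-from 0) (off 0) → State (Legs-from A) (off A)
    legs zero _ s = s
    legs (suc A) A<k s = record
      { verts = verts ; symbols = symbols ; u< = u< ; v< = v< ; bounded = bounded ; induced = induced ; size = size ; few = few
      ; tips = proj₂ tips }
      where
      open State (lengthen A A<k (m A) ≤-refl (legs A (<⇒≤ A<k) s))

    -- While the neighbours of the centre r are chosen, the coordinates still to be used are free at r.
    Star : R → List (Fin d) → List R → Set
    Star r es xs = (∀ t → 1 ≤ t → t < length xs → ∃[ x ] ∃[ c ] Tip xs t x c) × All (Tip xs 0 r) es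

    star : ∀ {r} es n → n + length es ≡ off 0 → 1 ≤ n → Unique es → State (Star r es) n → State (Legs-from 0) (off 0)
    star [] n e _ _ s = record
      { verts = verts ; symbols = symbols ; u< = u< ; v< = v< ; bounded = bounded ; induced = induced ; size = trans size n≡ ; few = subst (λ j → symbols ≤ 3 + j) n≡ few
      ; tips = λ b _ b<k → proj₁ tips (suc b) (s≤s z≤n) (subst (suc b <_) (sym (trans size n≡)) (s≤s b<k)) }
      where
      open State s
      n≡ : n ≡ off 0
      n≡ = trans (sym (+-identityʳ n)) e
    star {r} (c ∷ es) n e 1≤n (c∉ ∷ uniq) s = star {r} es (suc n) (trans (sym (+-suc n (length es))) e) (s≤s z≤n) uniq record
      { verts = C.y ∷ verts ; symbols = suc symbols ; u< = Bounded-suc u u< ; v< = Bounded-suc v v< ; bounded = C.bounded ; induced = C.induced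
      ; size = cong suc size ; few = s≤s few
      ; tips = old-or-new , All.zipWith (λ (ne , t) → C.preserve (inj₂ (ne ∘ sym)) t) (c∉ , All.tail (proj₂ tips)) }
      where
      open State s
      module C = Child {symbols} {0} {r} {c} {verts} u< v< bounded induced (All.head (proj₂ tips))
                       (trans (cong par size) (par-start (≤-pred (subst (suc n ≤_) e (subst (_≤ n + suc (length es)) (+-comm n 1) (+-monoʳ-≤ n (s≤s z≤n)))))))
      old-or-new : ∀ t → 1 ≤ t → t < length (C.y ∷ verts) → ∃[ x ] ∃[ c ] Tip (C.y ∷ verts) t x c
      old-or-new t 1≤t t< with m≤n⇒m<n∨m≡n (≤-pred t<)
      ... | inj₁ lt = let (x , c′ , tp) = proj₁ tips t 1≤t lt in x , c′ , C.preserve (inj₁ (λ { refl → n≮0 1≤t })) tp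
      ... | inj₂ refl = C.y , other c , C.fresh

  n : ℕ
  n = 3 + off k

  realise : ∀ {u v r} es j → j + length es ≡ off 0 → 1 ≤ j → Unique es → State {u} {v} (Star {u} {v} r es) j →
            Realises (Bounded n) (off k) (flip u v)
  realise {u} {v} {r} es j e 1≤j uniq s = realises verts induced (All.map (λ {x} (b : Bounded symbols x) e → <-≤-trans (b e) few) bounded) size
    where
    open State (legs {u} {v} k ≤-refl (star {u} {v} {r} es j e 1≤j uniq s))

  flip-old : ∀ {u v} x y → x ≢ u → x ≢ v → flip u v x y ≡ adj x y
  flip-old {u} {v} x y xu xv rewrite eq-≢ {x} {u} xu | eq-≢ {x} {v} xv with adj x y
  ... | true = refl
  ... | false = refl

  flip-self : ∀ {u v} → flip u v u v ≡ not (adj u v)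
  flip-self {u} {v} rewrite T⇒≡ (eqᵛ-refl u) | T⇒≡ (eqᵛ-refl v) with adj u v
  ... | true = refl
  ... | false = refl

  zeros : R
  zeros = replicate d 0

  zeros-at : ∀ e → Vec.lookup zeros e ≡ 0
  zeros-at e = lookup-replicate e 0

  -- `zeros` is the centre and v its first neighbour. The new edge occupies no coordinate, so the d
  -- = k - 1 coordinates are left for the other legs.
  add : ∀ v → Bounded 2 v → (∀ e → Vec.lookup v e ≢ 0) → Realises (Bounded n) (off k) (flip zeros v)
  add v v2 v≢0 = realise {zeros} {v} {zeros} (allFin d) 2 (cong (2 +_) (length-tabulate {n = d} id)) (s≤s z≤n) (Unique-allFin⁺ d) record
    { verts = v ∷ zeros ∷ [] ; symbols = 2 ; u< = z2 ; v< = v2 ; bounded = v2 ∷ z2 ∷ [] ; size = refl ; few = s≤s (s≤s z≤n)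
    ; induced = ∧-intro (∧-intro (∧-intro (not-intro (λ s → v≢0 zero (trans (cong (λ w → Vec.lookup w zero) (sym (eqᵛ-sound zeros v s))) (zeros-at zero))))
        (bool-eq-refl (trans (flip-self {zeros} {v}) (trans (cong not (adj-false {zeros} {v} (λ e p → v≢0 e (trans (sym p) (zeros-at e)))))
          (sym (T⇒≡ (≡⇒≡ᵇ _ _ (par-start {1} (s≤s z≤n))))))))) tt) tt
    ; tips = tip₁ , All.tabulate (λ {e} _ → inj₂ (inj₁ (refl , refl)) , inj₂ ((λ ()) , λ p → v≢0 e (trans p (zeros-at e))) , inj₁ (refl , refl) , tt) }
    where
    z2 : Bounded 2 zeros
    z2 e = subst (_< 2) (sym (zeros-at e)) (s≤s z≤n)
    tip₁ : ∀ t → 1 ≤ t → t < 2 → ∃[ x ] ∃[ c ] Tip (v ∷ zeros ∷ []) t x c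
    tip₁ (suc zero) _ _ = v , zero , inj₁ (refl , refl) , inj₁ (refl , refl) , inj₂ ((λ ()) , λ p → v≢0 zero (trans (sym p) (zeros-at zero))) , tt
    tip₁ (suc (suc _)) _ (s≤s (s≤s ()))

  -- The centre r has 0 in coordinate c and 2 elsewhere, so it meets `zeros` and v in c only. These
  -- two have become non-adjacent, hence c serves two legs and the other d - 1 coordinates one leg
  -- each: k legs in all.
  delete : ∀ v → Bounded 2 v → ∀ c e → Vec.lookup v c ≡ 0 → Vec.lookup v e ≢ 0 → Realises (Bounded n) (off k) (flip zeros v)
  delete v v2 c e vc ve = realise {zeros} {v} {r} es 3
      (cong (3 +_) (trans (length-map (F.punchIn c) (allFin (suc d′))) (length-tabulate {n = suc d′} id))) (s≤s z≤n)
      (Unique-map⁺ (FP.punchIn-injective c _ _) (Unique-allFin⁺ (suc d′))) record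
    { verts = v ∷ zeros ∷ r ∷ [] ; symbols = 3 ; u< = Bounded-suc {zeros} {v} zeros z2 ; v< = Bounded-suc {zeros} {v} v v2
    ; bounded = Bounded-suc {zeros} {v} v v2 ∷ Bounded-suc {zeros} {v} zeros z2 ∷ r3 ∷ [] ; size = refl ; few = s≤s (s≤s (s≤s z≤n))
    ; induced = ∧-intro {fits (flip zeros v) 2 v (zeros ∷ r ∷ [])} fits-v (∧-intro {fits (flip zeros v) 1 zeros (r ∷ [])} fits-u tt)
    ; tips = tip₁ , All.tabulate root }
    where
    r = spot c 0 2
    es = map (F.punchIn c) (allFin (suc d′))
    z2 : Bounded 2 zeros
    z2 e = subst (_< 2) (sym (zeros-at e)) (s≤s z≤n)
    e≢c : e ≢ c
    e≢c refl = ve vc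
    r-off : ∀ {j} → j ≢ c → Vec.lookup r j ≡ 2
    r-off = spot-off 0 2
    r3 : Bounded 3 r
    r3 j with j FP.≟ c
    ... | yes refl = subst (_< 3) (sym (spot-at c 0 2)) (s≤s z≤n)
    ... | no ne = subst (_< 3) (sym (r-off ne)) ≤-refl
    r≢ : ∀ {w} → Bounded 2 w → r ≢ w
    r≢ w2 p = <⇒≢ (w2 e) (sym (trans (sym (r-off e≢c)) (cong (λ x → Vec.lookup x e) p)))
    u≢v : zeros ≢ v
    u≢v p = ve (trans (cong (λ x → Vec.lookup x e) (sym p)) (zeros-at e))
    fits-u : T (fits (flip zeros v) 1 zeros (r ∷ []))
    fits-u = ∧-intro (∧-intro (not-intro (λ s → r≢ z2 (eqᵛ-sound r zeros s)))
      (bool-eq-refl (trans (flip-old r zeros (r≢ z2) (r≢ v2)) (trans (adj-true {r} {zeros} c (r≢ z2) (trans (spot-at c 0 2) (sym (zeros-at c))))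
        (sym (T⇒≡ (≡⇒≡ᵇ _ _ (par-start {1} (s≤s z≤n))))))))) tt
    fits-v : T (fits (flip zeros v) 2 v (zeros ∷ r ∷ []))
    fits-v = ∧-intro {not (eqᵛ zeros v) ∧ bool-eq (flip zeros v zeros v) (tree 1 2)}
      (∧-intro (not-intro (λ s → u≢v (eqᵛ-sound zeros v s)))
        (bool-eq-refl (trans (flip-self {zeros} {v}) (trans (cong not (adj-true {zeros} {v} c u≢v (trans (zeros-at c) (sym vc))))
          (sym (cong (_≡ᵇ 1) (par-start {2} (s≤s (s≤s z≤n)))))))))
      (∧-intro (∧-intro (not-intro (λ s → r≢ v2 (eqᵛ-sound r v s)))
        (bool-eq-refl (trans (flip-old r v (r≢ z2) (r≢ v2)) (trans (adj-true {r} {v} c (r≢ v2) (trans (spot-at c 0 2) (sym vc)))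
          (sym (T⇒≡ (≡⇒≡ᵇ _ _ (par-start {2} (s≤s (s≤s z≤n)))))))))) tt)
    tip₁ : ∀ t → 1 ≤ t → t < 3 → ∃[ x ] ∃[ j ] Tip (v ∷ zeros ∷ r ∷ []) t x j
    tip₁ (suc zero) _ _ = zeros , e , inj₂ (inj₁ (refl , refl)) , inj₂ ((λ ()) , λ p → ve (trans p (zeros-at e))) , inj₁ (refl , refl)
      , inj₂ ((λ ()) , λ p → <⇒≢ (z2 e) (sym (trans (sym (r-off e≢c)) p))) , tt
    tip₁ (suc (suc zero)) _ _ = v , e , inj₁ (refl , refl) , inj₁ (refl , refl) , inj₂ ((λ ()) , λ p → ve (trans (sym p) (zeros-at e)))
      , inj₂ ((λ ()) , λ p → <⇒≢ (v2 e) (sym (trans (sym (r-off e≢c)) p))) , tt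
    tip₁ (suc (suc (suc _))) _ (s≤s (s≤s (s≤s ())))
    root : ∀ {j} → j ∈ es → Tip (v ∷ zeros ∷ r ∷ []) 0 r j
    root {j} m = inj₂ (inj₂ (inj₁ (refl , refl))) , inj₂ ((λ ()) , λ p → <⇒≢ (v2 j) (trans p (r-off j≢c)))
      , inj₂ ((λ ()) , λ p → <⇒≢ (z2 j) (trans p (r-off j≢c))) , inj₁ (refl , refl) , tt
      where
      j≢c : j ≢ c
      j≢c with ∈-map⁻ (F.punchIn c) m
      ... | i , _ , refl = FP.punchInᵢ≢i c i

  -- Per coordinate, a permutation that takes 0 to the symbol of u, and 0 or 1 to that of v.
  record Chart (x y : ℕ) : Set where
    field
      perm : Perm n
      code : ℕ
      code< : code < 2
      to-x : Perm.fun perm 0 ≡ x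
      to-y : Perm.fun perm code ≡ y

  chart : ∀ {x y} → x < n → y < n → Chart x y
  chart {x} {y} xn yn with x ℕP.≟ y
  ... | yes refl = let (p , e) = place {n} {0} (s≤s z≤n) xn in record { perm = p ; code = 0 ; code< = s≤s z≤n ; to-x = e ; to-y = e }
  ... | no ne = let (p , e , e′) = place₂ {n} {0} {1} (s≤s z≤n) (s≤s (s≤s z≤n)) xn yn (λ ()) ne
                in record { perm = p ; code = 1 ; code< = ≤-refl ; to-x = e ; to-y = e′ }

  flips : ∀ u v → Bounded n u → Bounded n v → u ≢ v → Realises (Bounded n) (off k) (flip u v)
  flips u v un vn u≢v = subst₂ (λ x y → Realises (Bounded n) (off k) (flip x y)) Fu Fv (realises-map {D = Bounded n} {u = zeros} {w} F (λ {x} {y} → F-inj {x} {y}) F-adj (λ {x} → F-bound {x}) base)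
    where
    ch : ∀ e → Chart (Vec.lookup u e) (Vec.lookup v e)
    ch e = chart (un e) (vn e)
    p : Fin d → ℕ → ℕ
    p e = Perm.fun (Chart.perm (ch e))
    F : R → R
    F x = tabulate (λ e → p e (Vec.lookup x e))
    F-at : ∀ x e → Vec.lookup (F x) e ≡ p e (Vec.lookup x e)
    F-at x e = lookup∘tabulate (λ e → p e (Vec.lookup x e)) e
    F-at-inj : ∀ x y e → Vec.lookup (F x) e ≡ Vec.lookup (F y) e → Vec.lookup x e ≡ Vec.lookup y e
    F-at-inj x y e q = Perm.inj (Chart.perm (ch e)) (trans (sym (F-at x e)) (trans q (F-at y e)))
    F-inj : ∀ {x y} → F x ≡ F y → x ≡ y
    F-inj {x} {y} q = Vec-ext x y (λ e → F-at-inj x y e (cong (λ w → Vec.lookup w e) q))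
    F-adj : ∀ x y → adj (F x) (F y) ≡ adj x y
    F-adj x y = cong₂ (λ b c → not b ∧ c)
      (T-ext {eqᵛ (F x) (F y)} {eqᵛ x y} (λ t → subst (λ z → T (eqᵛ x z)) (F-inj {x} {y} (eqᵛ-sound (F x) (F y) t)) (eqᵛ-refl x))
        (λ t → subst (λ z → T (eqᵛ (F x) (F z))) (eqᵛ-sound x y t) (eqᵛ-refl (F x))))
      (T-ext (λ t → let (e , q) = share-sound (F x) (F y) t in share-intro x y e (F-at-inj x y e q))
             (λ t → let (e , q) = share-sound x y t in share-intro (F x) (F y) e (trans (F-at x e) (trans (cong (p e) q) (sym (F-at y e))))))
    F-bound : ∀ {x} → Bounded n x → Bounded n (F x)
    F-bound {x} b e = subst (_< n) (sym (F-at x e)) (Perm.bnd (Chart.perm (ch e)) (b e))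
    w : R
    w = tabulate (λ e → Chart.code (ch e))
    w-at : ∀ e → Vec.lookup w e ≡ Chart.code (ch e)
    w-at e = lookup∘tabulate (λ e → Chart.code (ch e)) e
    w2 : Bounded 2 w
    w2 e = subst (_< 2) (sym (w-at e)) (Chart.code< (ch e))
    Fu : F zeros ≡ u
    Fu = Vec-ext (F zeros) u (λ e → trans (F-at zeros e) (trans (cong (p e) (zeros-at e)) (Chart.to-x (ch e))))
    Fv : F w ≡ v
    Fv = Vec-ext (F w) v (λ e → trans (F-at w e) (trans (cong (p e) (w-at e)) (Chart.to-y (ch e))))
    base : Realises (Bounded n) (off k) (flip zeros w)
    -- No common coordinate means that an edge was added. Otherwise the two tuples agree somewhere
    -- and, being distinct, differ somewhere: an edge was deleted.
    base with any? (λ e → Vec.lookup w e ℕP.≟ 0) | any? (λ e → ¬? (Vec.lookup w e ℕP.≟ 0))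
    ... | no none | _ = add w w2 (λ e q → none (e , q))
    ... | yes (c , q) | yes (e , q′) = delete w w2 c e q q′
    ... | yes _ | no all0 = ⊥-elim (u≢v (trans (sym Fu) (trans (cong F (Vec-ext zeros w (λ e → trans (zeros-at e) (sym (zero-at e))))) Fv)))
      where
      zero-at : ∀ e → Vec.lookup w e ≡ 0
      zero-at e with Vec.lookup w e ℕP.≟ 0
      ... | yes q = q
      ... | no q = ⊥-elim (all0 (e , q))

  open Host (allVecs n d) (allVecs-unique n d)

  k<off : k < off k
  k<off = off-mono {0} {k} z≤n

  -- Two of k neighbours agree with the centre in the same coordinate.
  free : ¬ Embedding (Pat tree (off k)) graph
  free e = let (i , j , i<j , same) = pigeonhole {d} {k} ≤-refl coord in
      clash i j i<j (coord j) (trans (cong (λ c → Vec.lookup (r (suc (toℕ i))) c) (sym same)) (trans (sym (agree i)) (trans (cong (Vec.lookup (r 0)) same) (agree j))))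
    where
    open Copied {tuples d} {tree} {allVecs n d} {allVecs-unique n d} e zeros
    leaf : ∀ (i : Fin k) → suc (toℕ i) < off k
    leaf i = <-≤-trans (s≤s (toℕ<n i)) k<off
    shared : ∀ (i : Fin k) → ∃[ c ] Vec.lookup (r 0) c ≡ Vec.lookup (r (suc (toℕ i))) c
    shared i = share-sound (r 0) (r (suc (toℕ i))) (∧-elim₂ {not (eqᵛ (r 0) (r (suc (toℕ i))))}
      (≡⇒T (trans (r-< (s≤s z≤n) (leaf i)) (T⇒≡ (≡⇒≡ᵇ _ _ (par-start {suc (toℕ i)} (toℕ<n i)))))))
    coord : Fin k → Fin d
    coord i = proj₁ (shared i)
    agree : ∀ i → Vec.lookup (r 0) (coord i) ≡ Vec.lookup (r (suc (toℕ i))) (coord i)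
    agree i = proj₂ (shared i)
    clash : ∀ (i j : Fin k) → i F.< j → ∀ c → Vec.lookup (r (suc (toℕ i))) c ≡ Vec.lookup (r (suc (toℕ j))) c → ⊥
    clash i j i<j c q with trans (sym (adj-true {r (suc (toℕ i))} {r (suc (toℕ j))} c (λ p → <⇒≢ (s≤s i<j) (r-inj (leaf i) (leaf j) p)) q))
                                 (trans (r-< (s≤s i<j) (leaf j)) (cong (_≡ᵇ suc (toℕ i)) (par-start {suc (toℕ j)} (toℕ<n j))))
    ... | ()

  hosts : Hosts (off k)
  hosts = record
    { free = free
    ; flips = λ u v mu mv ne → realises-dom {D = Bounded n} {_∈ allVecs n d} (λ {x} → ∈-allVecs⁺ {x = x}) (flips u v (∈-allVecs⁻ {x = u} mu) (∈-allVecs⁻ {x = v} mv) ne)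
    ; two = zeros , replicate d 1 , ∈-allVecs⁺ {x = zeros} (λ e → subst (_< n) (sym (zeros-at e)) (s≤s z≤n))
          , ∈-allVecs⁺ {x = replicate d 1} (λ e → subst (_< n) (sym (lookup-replicate e 1)) (s≤s (s≤s z≤n))) , λ ()
    }

spider-host : ∀ k → 3 ≤ k → ∀ H → IsSpider k H → ∃[ G ] (Finite G × InducedSaturated H G)
spider-host (suc (suc (suc k))) (s≤s (s≤s (s≤s z≤n))) H S =
  Tuples.Host.exists k (Spider.m S (s≤s z≤n)) (allVecs _ _) (allVecs-unique _ _) (Spider.iso S (s≤s z≤n)) (Tuples.hosts k (Spider.m S (s≤s z≤n)))

-- Boards of cliques, except that row 0 joins different signs if σ holds

boardAdj : Bool → Cell → Cell → Bool
boardAdj σ (i , s , j) (i′ , s′ , j′) = if i ≡ᵇ i′ then not (j ≡ᵇ j′) ∧ (not (σ ∧ (i ≡ᵇ 0)) ∨ (s xor s′)) else (j ≡ᵇ j′)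

boardAdj-comm : ∀ σ x y → boardAdj σ x y ≡ boardAdj σ y x
boardAdj-comm σ (i , s , j) (i′ , s′ , j′) with i ℕP.≟ i′
... | yes refl rewrite ≡ᵇ-comm j j′ | xor-comm s s′ = refl
... | no ne rewrite ≢⇒≡ᵇ ne | ≢⇒≡ᵇ (ne ∘ sym) = ≡ᵇ-comm j j′

b-col : ∀ σ {i i′} s s′ j → i ≢ i′ → boardAdj σ (i , s , j) (i′ , s′ , j) ≡ true
b-col σ s s′ j ne rewrite ≢⇒≡ᵇ ne = T⇒≡ (≡ᵇ-refl j)

b-off : ∀ σ x y → row x ≢ row y → col x ≢ col y → boardAdj σ x y ≡ false
b-off σ x y p q rewrite ≢⇒≡ᵇ p | ≢⇒≡ᵇ q = refl

b-same : ∀ σ i s s′ j → boardAdj σ (i , s , j) (i , s′ , j) ≡ false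
b-same σ i s s′ j rewrite T⇒≡ (≡ᵇ-refl i) | T⇒≡ (≡ᵇ-refl j) = refl

b-row : ∀ σ {i} s s′ {j j′} → (T σ → i ≢ 0) → j ≢ j′ → boardAdj σ (i , s , j) (i , s′ , j′) ≡ true
b-row false {i} s s′ p q rewrite T⇒≡ (≡ᵇ-refl i) | ≢⇒≡ᵇ q = refl
b-row true {i} s s′ p q rewrite T⇒≡ (≡ᵇ-refl i) | ≢⇒≡ᵇ q | ≢⇒≡ᵇ (p tt) = refl

b-signed : ∀ σ s s′ {j j′} → T σ → j ≢ j′ → boardAdj σ (0 , s , j) (0 , s′ , j′) ≡ (s xor s′)
b-signed true s s′ _ q rewrite ≢⇒≡ᵇ q = refl

b-cases : ∀ σ x y → T (boardAdj σ x y) → (row x ≡ row y × col x ≢ col y) ⊎ (row x ≢ row y × col x ≡ col y)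
b-cases σ (i , s , j) (i′ , s′ , j′) t with i ≡ᵇ i′ in e
... | true = inj₁ (≡ᵇ⇒≡ i i′ (≡⇒T e) , λ { refl → neq (∧-elim₁ t) })
  where
  neq : ¬ T (not (j ≡ᵇ j))
  neq s rewrite T⇒≡ (≡ᵇ-refl j) = s
... | false = inj₂ ((λ { refl → subst T e (≡ᵇ-refl i) }) , ≡ᵇ⇒≡ j j′ t)

mixed : Bool → Raw
mixed σ = record
  { R = Cell
  ; eq = Raw.eq board
  ; eq-sound = Raw.eq-sound board
  ; eq-refl = Raw.eq-refl board
  ; adj = boardAdj σ
  ; adj-sym = λ x y → subst T (boardAdj-comm σ x y)
  ; adj-irr = λ x t → [ (λ (_ , n) → n refl) , (λ (n , _) → n refl) ]′ (b-cases σ x x t)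
  }

all⇒All : ∀ {A : Set} {p : A → Bool} xs → T (all p xs) → All (T ∘ p) xs
all⇒All [] _ = []
all⇒All {p = p} (x ∷ xs) t = ∧-elim₁ t ∷ all⇒All xs (∧-elim₂ {p x} t)

≡ᵇ-not : ∀ {m n} → T (not (m ≡ᵇ n)) → m ≢ n
≡ᵇ-not {m} t refl rewrite T⇒≡ (≡ᵇ-refl m) = t

bump : ∀ e len → suc (e + (e + len)) ≡ e + (e + suc len)
bump e len = trans (sym (+-suc e (e + len))) (cong (e +_) (sym (+-suc e len)))

-- One vertex per cell, with sign `false`; only row 0 has two per cell, and only if `σ` holds.
allowed : Bool → Cell → Bool
allowed σ z = not (sign z) ∨ (σ ∧ (row z ≡ᵇ 0))

-- Copies of a triangle with a path after one toggle

module Kite (σ : Bool) where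
  open Growth (mixed σ) (lol 3) public

  Valid : ℕ → ℕ → Cell → Set
  Valid R C z = row z < R × col z < C × T (allowed σ z)

  valid-mono : ∀ {R R′ C C′ z} → R ≤ R′ → C ≤ C′ → Valid R C z → Valid R′ C′ z
  valid-mono p q (a , b , c) = <-≤-trans a p , <-≤-trans b q , c

  next₃ : ∀ i → lol 3 i (suc i) ≡ true
  next₃ i rewrite T⇒≡ (≡ᵇ-refl i) = refl

  far₃ : ∀ {i n} → suc i < n → 2 < n → lol 3 i n ≡ false
  far₃ {i} {n} p q rewrite ≢⇒≡ᵇ (λ e → <⇒≢ p (sym e)) | ≢⇒≡ᵇ {suc n} {3} (λ e → <⇒≢ q (sym (suc-injective e))) with i ≡ᵇ 0
  ... | true = refl
  ... | false = refl

  -- Invariants of the growing trail for the special endings: `close` needs equal signs in row 0,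
  -- `tail₄` an unvisited row 0, and `tail₆` unvisited rows 0 and 1 and column 0.
  calm off0 far : Cell → Bool
  calm z = not (sign z)
  off0 z = not (row z ≡ᵇ 0)
  far z = (1 <ᵇ row z) ∧ (0 <ᵇ col z)

  module _ {u v : Cell} where
    private
      a = flip u v

    next : ∀ x y ys → T (ind a (x ∷ ys)) → x ≢ y → a x y ≡ true → All (Apart a y) ys → 2 ≤ length ys → T (ind a (y ∷ x ∷ ys))
    next x y ys i ne ad ap le = extend {a} {y} {x} {ys} i ne ad ap (next₃ (length ys)) (λ j p → far₃ (s≤s p) (s≤s le))

    keep : ∀ x y → (x ≡ u → y ≢ v) → (x ≡ v → y ≢ u) → a x y ≡ boardAdj σ x y
    keep x y f g = trans (cong (boardAdj σ x y xor_) (¬T⇒≡ none)) (xor-false _)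
      where
      open Raw (mixed σ) using (eq; eq-sound)
      xor-false : ∀ b → (b xor false) ≡ b
      xor-false true = refl
      xor-false false = refl
      none : ¬ T ((eq x u ∧ eq y v) ∨ (eq x v ∧ eq y u))
      none t with ∨-elim (eq x u ∧ eq y v) t
      ... | inj₁ s = f (eq-sound x u (∧-elim₁ s)) (eq-sound y v (∧-elim₂ {eq x u} s))
      ... | inj₂ s = g (eq-sound x v (∧-elim₁ s)) (eq-sound y u (∧-elim₂ {eq x v} s))

    apart : ∀ z y → (z ≡ u → y ≢ v) → (z ≡ v → y ≢ u) → row z ≢ row y → col z ≢ col y → Apart a y z
    apart z y f g p q = (λ e → p (cong row e)) , trans (keep z y f g) (b-off σ z y p q)

    -- The last vertex is alone in its column, so the trail can go on from there.
    record Trail (p : Cell → Bool) (R C len : ℕ) : Set where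
      field
        end     : Cell
        rest    : List Cell
        induced : T (ind a (end ∷ rest))
        inside  : All (Valid R C) (end ∷ rest)
        alone   : All (λ z → col z ≢ col end) rest
        good    : All (T ∘ p) (end ∷ rest)
        end-row : T σ → row end ≢ 0
        end-col : col end ≢ 0
        size    : length (end ∷ rest) ≡ len

    headᵇ : (Cell → Bool) → ℕ → ℕ → Cell → List Cell → Bool
    headᵇ p R C x xs = ind a (x ∷ xs) ∧ (all (λ z → (row z <ᵇ R) ∧ ((col z <ᵇ C) ∧ allowed σ z)) (x ∷ xs) ∧
      (all (λ z → not (col z ≡ᵇ col x)) xs ∧ (all p (x ∷ xs) ∧ ((not σ ∨ not (row x ≡ᵇ 0)) ∧ not (col x ≡ᵇ 0)))))

    start : ∀ p R C x xs → T (headᵇ p R C x xs) → Trail p R C (length (x ∷ xs))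
    start p R C x xs t = record
      { end = x ; rest = xs ; induced = ∧-elim₁ t
      ; inside = All.map (λ {z} s → <ᵇ⇒< _ _ (∧-elim₁ s) , <ᵇ⇒< _ _ (∧-elim₁ (∧-elim₂ {row z <ᵇ R} s)) , ∧-elim₂ {col z <ᵇ C} (∧-elim₂ {row z <ᵇ R} s))
                         (all⇒All (x ∷ xs) (∧-elim₁ t₁))
      ; alone = All.map ≡ᵇ-not (all⇒All xs (∧-elim₁ t₂))
      ; good = all⇒All (x ∷ xs) (∧-elim₁ t₃)
      ; end-row = λ s → ≡ᵇ-not ([ (λ n → ⊥-elim (not-both σ n s)) , id ]′ (∨-elim (not σ) (∧-elim₁ t₄)))
      ; end-col = ≡ᵇ-not (∧-elim₂ {not σ ∨ not (row x ≡ᵇ 0)} t₄)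
      ; size = refl }
      where
      not-both : ∀ b → T (not b) → ¬ T b
      not-both false _ ()
      t₁ = ∧-elim₂ {ind a (x ∷ xs)} t
      t₂ = ∧-elim₂ {all (λ z → (row z <ᵇ R) ∧ ((col z <ᵇ C) ∧ allowed σ z)) (x ∷ xs)} t₁
      t₃ = ∧-elim₂ {all (λ z → not (col z ≡ᵇ col x)) xs} t₂
      t₄ = ∧-elim₂ {all p (x ∷ xs)} t₃

    Kept : (Cell → Bool) → Set
    Kept p = ∀ R C {z} → 3 ≤ R → 3 ≤ C → T (p z) → T (p (R , false , col z)) × T (p (R , false , C))

    -- The trail enters a fresh row through the column of `end`, where `end` is alone, and leaves it
    -- in a fresh column: two vertices for one row and one column.
    step : ∀ {p R C len} → Kept p → row u < R → row v < R → 3 ≤ R → 3 ≤ C → 3 ≤ len → Trail p R C len → Trail p (suc R) (suc C) (suc (suc len))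
    step {p} {R} {C} {len} pres ur vr 3≤R 3≤C 3≤len t = record
      { end = y₂ ; rest = y₁ ∷ end ∷ rest
      ; induced = next y₁ y₂ (end ∷ rest) i₁ (λ e → <⇒≢ c< (cong col e)) (trans (flip-new y₁ y₂ (y≢ ur) (y≢ vr)) (b-row σ false false (λ _ e → <⇒≢ 0<R (sym e)) (<⇒≢ c<)))
          (All.map (λ {z} (p , q , _) → apart z y₂ (λ _ → y≢ vr) (λ _ → y≢ ur) (<⇒≢ p) (<⇒≢ q)) inside) (subst (2 ≤_) (sym size) (<⇒≤ 3≤len))
      ; inside = (≤-refl , ≤-refl , tt) ∷ (≤-refl , m≤n⇒m≤1+n c< , tt) ∷ All.map (valid-mono (m≤n⇒m≤1+n ≤-refl) (m≤n⇒m≤1+n ≤-refl)) inside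
      ; alone = <⇒≢ c< ∷ All.map (λ (_ , q , _) → <⇒≢ q) inside
      ; good = proj₂ (pres R C 3≤R 3≤C (All.head good)) ∷ proj₁ (pres R C 3≤R 3≤C (All.head good)) ∷ good
      ; end-row = λ _ e → <⇒≢ 0<R (sym e)
      ; end-col = λ e → <⇒≢ (≤-trans (s≤s z≤n) 3≤C) (sym e)
      ; size = cong (2 +_) size }
      where
      open Trail t
      y₁ y₂ : Cell
      y₁ = R , false , col end
      y₂ = R , false , C
      0<R : 0 < R
      0<R = ≤-trans (s≤s z≤n) 3≤R
      c< : col end < C
      c< = proj₁ (proj₂ (All.head inside))
      y≢ : ∀ {w c} → row w < R → (R , false , c) ≢ w
      y≢ lt refl = <-irrefl refl lt
      i₁ : T (ind a (y₁ ∷ end ∷ rest))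
      i₁ = next end y₁ rest induced (λ e → <⇒≢ (proj₁ (All.head inside)) (cong row e))
        (trans (flip-new end y₁ (y≢ ur) (y≢ vr)) (b-col σ (sign end) false (col end) (<⇒≢ (proj₁ (All.head inside)))))
        (All.zipWith (λ {z} ((p , _) , q) → apart z y₁ (λ _ → y≢ vr) (λ _ → y≢ ur) (<⇒≢ p) q) (All.tail inside , alone))
        (≤-pred (subst (3 ≤_) (sym size) 3≤len))

    grow : ∀ e {p R C len} → Kept p → row u < R → row v < R → 3 ≤ R → 3 ≤ C → 3 ≤ len → Trail p R C len → Trail p (e + R) (e + C) (e + (e + len))
    grow zero pres ur vr 3≤R 3≤C 3≤len t = t
    grow (suc e) {p} {R} {C} {len} pres ur vr 3≤R 3≤C 3≤len t = subst (Trail p (suc e + R) (suc e + C)) (cong suc (sym (+-suc e (e + len))))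
      (step pres (≤-trans ur (m≤n+m R e)) (≤-trans vr (m≤n+m R e)) (≤-trans 3≤R (m≤n+m R e)) (≤-trans 3≤C (m≤n+m C e))
        (≤-trans 3≤len (≤-trans (m≤n+m len e) (m≤n+m (e + len) e))) (grow e pres ur vr 3≤R 3≤C 3≤len t))

    direct : ∀ {p R C len} → Trail p R C len → Realises (Valid R C) len a
    direct t = realises _ (Trail.induced t) (Trail.inside t) (Trail.size t)

    calm-kept : Kept calm
    calm-kept R C _ _ _ = tt , tt

    off0-kept : Kept off0
    off0-kept (suc R) C _ _ _ = tt , tt

    far-kept : Kept far
    far-kept (suc (suc R)) (suc C) {z} _ _ t = ∧-elim₂ {1 <ᵇ row z} t , tt
    far-kept (suc zero) C (s≤s ()) _ _
    far-kept (suc (suc R)) zero _ () _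

    -- One more vertex without a new line: in row 0 and the column of `end`. The earlier vertices of
    -- row 0 have the same sign, hence are not adjacent to it. The conditions on u and v keep it off
    -- the toggled pair.
    close : ∀ {R C len} → T σ → col u ≡ 0 → row v ≢ 0 → 3 ≤ len → Trail calm R C len → Realises (Valid R C) (suc len) a
    close {R} {C} hσ u0 v0 3≤len t = realises (y ∷ end ∷ rest)
      (next end y rest induced (λ e → end-row hσ (cong row e)) (trans (flip-new end y nu nv) (b-col σ (sign end) false (col end) (end-row hσ)))
        (All.zipWith (λ {z} → each z) (All.tail good , alone)) (≤-pred (subst (3 ≤_) (sym size) 3≤len)))
      ((≤-trans (s≤s z≤n) (proj₁ (All.head inside)) , proj₁ (proj₂ (All.head inside)) , tt) ∷ inside) (cong suc size)
      where
      open Trail t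
      y : Cell
      y = 0 , false , col end
      nu : y ≢ u
      nu e = end-col (trans (cong col e) u0)
      nv : y ≢ v
      nv e = v0 (sym (cong row e))
      each : ∀ z → T (calm z) × col z ≢ col end → Apart a y z
      each (zero , false , j) (_ , q) = (λ e → q (cong col e)) , trans (flip-new (0 , false , j) y nu nv) (b-signed σ false false hσ q)
      each (suc i , false , j) (_ , q) = apart (suc i , false , j) y (λ _ → nv) (λ _ → nu) (λ ()) q

    -- Row 0, avoided so far, supplies three vertices: y₁ and y₂ have opposite signs, and y₄ comes
    -- back through the fresh row to the cell of y₂, with the sign of y₁, so it is adjacent to
    -- neither.
    tail₄ : ∀ {R C len} → T σ → row u ≢ 0 → row v ≢ 0 → row u < R → row v < R → 3 ≤ len → Trail off0 R C len →
            Realises (Valid (suc R) (suc C)) (4 + len) a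
    tail₄ {R} {C} {len} hσ u0 v0 ur vr 3≤len t = realises (y₄ ∷ y₃ ∷ y₂ ∷ y₁ ∷ end ∷ rest) i₄
      ((s≤s z≤n , ≤-refl , tt) ∷ (≤-refl , ≤-refl , tt) ∷ (s≤s z≤n , ≤-refl , ok hσ) ∷ (s≤s z≤n , m≤n⇒m≤1+n c< , tt)
        ∷ All.map (valid-mono (m≤n⇒m≤1+n ≤-refl) (m≤n⇒m≤1+n ≤-refl)) inside) (cong (4 +_) size)
      where
      open Trail t
      y₁ y₂ y₃ y₄ : Cell
      y₁ = 0 , false , col end
      y₂ = 0 , true , C
      y₃ = R , false , C
      y₄ = 0 , false , C
      c< : col end < C
      c< = proj₁ (proj₂ (All.head inside))
      0<R : 0 < R
      0<R = ≤-trans (s≤s z≤n) ur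
      ok : T σ → T (allowed σ y₂)
      ok h = ∧-intro h tt
      zero≢ : ∀ {w s c} → row w ≢ 0 → (0 , s , c) ≢ w
      zero≢ n e = n (sym (cong row e))
      R≢ : ∀ {w s c} → row w < R → (R , s , c) ≢ w
      R≢ lt refl = <-irrefl refl lt
      rows : All (λ z → row z ≢ 0) (end ∷ rest)
      rows = All.map ≡ᵇ-not good
      l₂ : 2 ≤ length rest
      l₂ = ≤-pred (subst (3 ≤_) (sym size) 3≤len)
      i₁ : T (ind a (y₁ ∷ end ∷ rest))
      i₁ = next end y₁ rest induced (λ e → All.head rows (cong row e))
        (trans (flip-new end y₁ (zero≢ u0) (zero≢ v0)) (b-col σ (sign end) false (col end) (All.head rows)))
        (All.zipWith (λ {z} (p , q) → apart z y₁ (λ _ → zero≢ v0) (λ _ → zero≢ u0) p q) (All.tail rows , alone)) l₂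
      i₂ : T (ind a (y₂ ∷ y₁ ∷ end ∷ rest))
      i₂ = next y₁ y₂ (end ∷ rest) i₁ (λ ()) (trans (flip-new y₁ y₂ (zero≢ u0) (zero≢ v0)) (b-signed σ false true hσ (<⇒≢ c<)))
        (All.zipWith (λ {z} (p , (_ , q , _)) → apart z y₂ (λ _ → zero≢ v0) (λ _ → zero≢ u0) p (<⇒≢ q)) (rows , inside)) (m≤n⇒m≤1+n l₂)
      i₃ : T (ind a (y₃ ∷ y₂ ∷ y₁ ∷ end ∷ rest))
      i₃ = next y₂ y₃ (y₁ ∷ end ∷ rest) i₂ (λ e → <⇒≢ 0<R (cong row e)) (trans (flip-new y₂ y₃ (R≢ ur) (R≢ vr)) (b-col σ true false C (<⇒≢ 0<R)))
        (apart y₁ y₃ (λ _ → R≢ vr) (λ _ → R≢ ur) (<⇒≢ 0<R) (<⇒≢ c<) ∷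
          All.map (λ {z} (p , q , _) → apart z y₃ (λ _ → R≢ vr) (λ _ → R≢ ur) (<⇒≢ p) (<⇒≢ q)) inside) (m≤n⇒m≤1+n (m≤n⇒m≤1+n l₂))
      i₄ : T (ind a (y₄ ∷ y₃ ∷ y₂ ∷ y₁ ∷ end ∷ rest))
      i₄ = next y₃ y₄ (y₂ ∷ y₁ ∷ end ∷ rest) i₃ (λ e → <⇒≢ 0<R (sym (cong row e))) (trans (flip-new y₃ y₄ (zero≢ u0) (zero≢ v0)) (b-col σ false false C (λ e → <⇒≢ 0<R (sym e))))
        (((λ ()) , trans (flip-new y₂ y₄ (zero≢ u0) (zero≢ v0)) (b-same σ 0 true false C)) ∷
         ((λ e → <⇒≢ c< (cong col e)) , trans (flip-new y₁ y₄ (zero≢ u0) (zero≢ v0)) (b-signed σ false false hσ (<⇒≢ c<))) ∷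
         All.zipWith (λ {z} (p , (_ , q , _)) → apart z y₄ (λ _ → zero≢ v0) (λ _ → zero≢ u0) p (<⇒≢ q)) (rows , inside)) (m≤n⇒m≤1+n (m≤n⇒m≤1+n (m≤n⇒m≤1+n l₂)))

  -- The last four vertices lie in row 0 with alternating signs, the first and the last of them in
  -- one cell, so they induce a path. It is entered from v through column 0, and its final vertex is
  -- u, no longer adjacent to v.
  tail₆ : ∀ {R C len} → T σ → 3 ≤ R → 3 ≤ C → 3 ≤ len → Trail {0 , false , 0} {1 , false , 0} far R C len →
          Realises (Valid R (2 + C)) (6 + len) (flip (0 , false , 0) (1 , false , 0))
  tail₆ {R} {C} {len} hσ 3≤R 3≤C 3≤len t = realises (u ∷ y₅ ∷ y₄ ∷ y₃ ∷ v ∷ y₁ ∷ end ∷ rest) i₆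
      ((0<R , s≤s z≤n , tt) ∷ (0<R , ≤-refl , ∧-intro hσ tt) ∷ (0<R , m≤n⇒m≤1+n ≤-refl , tt) ∷ (0<R , s≤s z≤n , ∧-intro hσ tt) ∷ (1<R , s≤s z≤n , tt)
        ∷ (1<R , m≤n⇒m≤1+n (m≤n⇒m≤1+n c<) , tt) ∷ All.map (valid-mono ≤-refl (m≤n⇒m≤1+n (m≤n⇒m≤1+n ≤-refl))) inside) (cong (6 +_) size)
    where
    open Trail t
    u v y₁ y₃ y₄ y₅ : Cell
    u = 0 , false , 0
    v = 1 , false , 0
    y₁ = 1 , false , col end
    y₃ = 0 , true , 0
    y₄ = 0 , false , C
    y₅ = 0 , true , suc C
    a = flip u v
    0<R : 0 < R
    0<R = ≤-trans (s≤s z≤n) 3≤R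
    1<R : 1 < R
    1<R = ≤-trans (s≤s (s≤s z≤n)) 3≤R
    C≢0 : C ≢ 0
    C≢0 e = <⇒≢ (≤-trans (s≤s z≤n) 3≤C) (sym e)
    c< : col end < C
    c< = proj₁ (proj₂ (All.head inside))
    record Old (z : Cell) : Set where
      field
        r0 : row z ≢ 0
        r1 : row z ≢ 1
        c0 : col z ≢ 0
        cC : col z < C
    old : All Old (end ∷ rest)
    old = All.zipWith (λ {z} (g , (_ , q , _)) → record
      { r0 = λ e → <⇒≢ (<-trans (s≤s z≤n) (<ᵇ⇒< 1 (row z) (∧-elim₁ g))) (sym e) ; r1 = λ e → <⇒≢ (<ᵇ⇒< 1 (row z) (∧-elim₁ g)) (sym e)
      ; c0 = λ e → <⇒≢ (<ᵇ⇒< 0 (col z) (∧-elim₂ {1 <ᵇ row z} g)) (sym e) ; cC = q }) (good , inside)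
    away : ∀ {z} y → Old z → row z ≢ row y → col z ≢ col y → Apart a y z
    away {z} y o p q = apart {u} {v} z y (λ e → ⊥-elim (Old.r0 o (cong row e))) (λ e → ⊥-elim (Old.r1 o (cong row e))) p q
    eo = All.head old
    l₂ : 2 ≤ length rest
    l₂ = ≤-pred (subst (3 ≤_) (sym size) 3≤len)
    up : ∀ {n} → 2 ≤ n → 2 ≤ suc n
    up = m≤n⇒m≤1+n
    i₁ : T (ind a (y₁ ∷ end ∷ rest))
    i₁ = next {u} {v} end y₁ rest induced (λ e → Old.r1 eo (cong row e))
      (trans (keep {u} {v} end y₁ (λ e → ⊥-elim (Old.r0 eo (cong row e))) (λ e → ⊥-elim (Old.r1 eo (cong row e)))) (b-col σ (sign end) false (col end) (Old.r1 eo)))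
      (All.zipWith (λ {z} (o , q) → away y₁ o (Old.r1 o) q) (All.tail old , alone)) l₂
    i₂ : T (ind a (v ∷ y₁ ∷ end ∷ rest))
    i₂ = next {u} {v} y₁ v (end ∷ rest) i₁ (λ e → Old.c0 eo (cong col e)) (trans (keep {u} {v} y₁ v (λ ()) (λ _ ())) (b-row σ {1} false false (λ _ ()) (Old.c0 eo)))
      (All.map (λ {z} o → away v o (Old.r1 o) (Old.c0 o)) old) (up l₂)
    i₃ : T (ind a (y₃ ∷ v ∷ y₁ ∷ end ∷ rest))
    i₃ = next {u} {v} v y₃ (y₁ ∷ end ∷ rest) i₂ (λ ()) (trans (keep {u} {v} v y₃ (λ ()) (λ _ ())) (b-col σ {1} {0} false true 0 (λ ())))
      (apart {u} {v} y₁ y₃ (λ ()) (λ _ ()) (λ ()) (Old.c0 eo) ∷ All.map (λ {z} o → away y₃ o (Old.r0 o) (Old.c0 o)) old) (up (up l₂))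
    i₄ : T (ind a (y₄ ∷ y₃ ∷ v ∷ y₁ ∷ end ∷ rest))
    i₄ = next {u} {v} y₃ y₄ (v ∷ y₁ ∷ end ∷ rest) i₃ (λ ()) (trans (keep {u} {v} y₃ y₄ (λ ()) (λ ())) (b-signed σ true false hσ (C≢0 ∘ sym)))
      (apart {u} {v} v y₄ (λ ()) (λ _ e → C≢0 (cong col e)) (λ ()) (C≢0 ∘ sym) ∷ apart {u} {v} y₁ y₄ (λ ()) (λ _ e → C≢0 (cong col e)) (λ ()) (<⇒≢ c<) ∷
       All.map (λ {z} o → away y₄ o (Old.r0 o) (<⇒≢ (Old.cC o))) old) (up (up (up l₂)))
    i₅ : T (ind a (y₅ ∷ y₄ ∷ y₃ ∷ v ∷ y₁ ∷ end ∷ rest))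
    i₅ = next {u} {v} y₄ y₅ (y₃ ∷ v ∷ y₁ ∷ end ∷ rest) i₄ (λ ()) (trans (keep {u} {v} y₄ y₅ (λ _ ()) (λ _ ())) (b-signed σ false true {C} {suc C} hσ (<⇒≢ ≤-refl)))
      (((λ ()) , trans (keep {u} {v} y₃ y₅ (λ _ ()) (λ _ ())) (b-signed σ true true {0} {suc C} hσ (λ ()))) ∷ apart {u} {v} v y₅ (λ _ ()) (λ _ ()) (λ ()) (λ ()) ∷
       apart {u} {v} y₁ y₅ (λ _ ()) (λ _ ()) (λ ()) (<⇒≢ (m≤n⇒m≤1+n c<)) ∷
       All.map (λ {z} o → away y₅ o (Old.r0 o) (<⇒≢ (m≤n⇒m≤1+n (Old.cC o)))) old) (up (up (up (up l₂))))
    i₆ : T (ind a (u ∷ y₅ ∷ y₄ ∷ y₃ ∷ v ∷ y₁ ∷ end ∷ rest))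
    i₆ = next {u} {v} y₅ u (y₄ ∷ y₃ ∷ v ∷ y₁ ∷ end ∷ rest) i₅ (λ ()) (trans (keep {u} {v} y₅ u (λ ()) (λ ())) (b-signed σ true false {suc C} {0} hσ (λ ())))
      (((λ e → C≢0 (cong col e)) , trans (keep {u} {v} y₄ u (λ _ ()) (λ ())) (b-signed σ false false hσ C≢0)) ∷
       ((λ ()) , trans (keep {u} {v} y₃ u (λ ()) (λ ())) (b-same σ 0 true false 0)) ∷ ((λ ()) , refl) ∷
       apart {u} {v} y₁ u (λ ()) (λ e → ⊥-elim (Old.c0 eo (cong col e))) (λ ()) (Old.c0 eo) ∷
       All.map (λ {z} o → away u o (Old.r0 o) (Old.c0 o)) old) (up (up (up (up (up l₂)))))

  dom : ℕ → List Cell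
  dom M = filter (λ z → T? (allowed σ z)) (cells M)

  dom-unique : ∀ M → Unique (dom M)
  dom-unique M = Unique-filter⁺ (λ z → T? (allowed σ z)) (cells-unique M)

  ∈-dom⁺ : ∀ {M z} → Valid M M z → z ∈ dom M
  ∈-dom⁺ {M} (p , q , s) = ∈-filter⁺ (λ z → T? (allowed σ z)) (∈-cells⁺ {M} (p , q)) s

  ∈-dom⁻ : ∀ {M z} → z ∈ dom M → Valid M M z
  ∈-dom⁻ {M} m = let (c , s) = ∈-filter⁻ (λ z → T? (allowed σ z)) {xs = cells M} m ; (p , q) = ∈-cells⁻ {M} c in p , q , s

  -- Row 0 only compares its own signs, and columns ignore signs: `t` reverses the row as a whole.
  -- If `σ` holds, the row permutation will have to fix row 0.
  shuffle : ∀ {M} → Perm M → Bool → Perm M → Cell → Cell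
  shuffle p t g (i , s , j) = fun p i , (s xor (t ∧ (i ≡ᵇ 0))) , fun g j

shuffle-adj : ∀ σ {M} (p : Perm M) t (g : Perm M) → (T σ → fun p 0 ≡ 0) → ∀ x y →
              boardAdj σ (Kite.shuffle σ p t g x) (Kite.shuffle σ p t g y) ≡ boardAdj σ x y
shuffle-adj false p t g h (i , s , j) (i′ , s′ , j′) rewrite eqᵇ p i i′ | eqᵇ g j j′ = refl
shuffle-adj true p t g h (i , s , j) (i′ , s′ , j′) rewrite eqᵇ p i i′ | eqᵇ g j j′ with i ≡ᵇ i′ in e
... | false = refl
... | true with ≡ᵇ⇒≡ i i′ (≡⇒T e)
...   | refl rewrite trans (cong (fun p i ≡ᵇ_) (sym (h tt))) (eqᵇ p i 0) | Board.xor-cancel 0 s s′ (t ∧ (i ≡ᵇ 0)) = refl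

shuffle-allowed : ∀ σ {M} (p : Perm M) t (g : Perm M) → (T σ → fun p 0 ≡ 0) → (T t → T σ) → ∀ z → T (allowed σ z) → T (allowed σ (Kite.shuffle σ p t g z))
shuffle-allowed false p false g h ht (i , false , j) ok = tt
shuffle-allowed false p true g h ht z ok = ⊥-elim (ht tt)
shuffle-allowed true p t g h ht (i , s , j) ok rewrite trans (cong (fun p i ≡ᵇ_) (sym (h tt))) (eqᵇ p i 0) with i ≡ᵇ 0
... | true = Equivalence.from (T-∨ {not (s xor (t ∧ true))}) (inj₂ tt)
shuffle-allowed true p false g h ht (i , false , j) ok | false = tt
shuffle-allowed true p true g h ht (i , false , j) ok | false = tt

module Shuffles (σ : Bool) where
  open Kite σ public

  move : ∀ {M n u v} (p : Perm M) t (g : Perm M) → (T σ → fun p 0 ≡ 0) → (T t → T σ) → Realises (Valid M M) n (flip u v) →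
         Realises (Valid M M) n (flip (shuffle p t g u) (shuffle p t g v))
  move p t g h ht = realises-map (shuffle p t g) injective (shuffle-adj σ p t g h)
    (λ {z} (a , b , c) → bnd p a , bnd g b , shuffle-allowed σ p t g h ht z c)
    where
    injective : ∀ {x y} → shuffle p t g x ≡ shuffle p t g y → x ≡ y
    injective {i , s , j} {i′ , s′ , j′} e with inj p (cong row e) | inj g (cong col e)
    ... | refl | refl rewrite Board.xor-inj 0 s s′ (t ∧ (i ≡ᵇ 0)) (cong sign e) = refl

-- Permutes the ordinary rows and fixes the row with signs.
lift : ∀ {n} → Perm n → Perm (suc n)
lift {n} p = record { fun = f ; inj = f-inj ; bnd = f-bnd }
  where
  f : ℕ → ℕ
  f zero = zero
  f (suc x) = suc (fun p x)
  f-inj : ∀ {x y} → f x ≡ f y → x ≡ y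
  f-inj {zero} {zero} _ = refl
  f-inj {suc x} {suc y} e = cong suc (inj p (suc-injective e))
  f-bnd : ∀ {x} → x < suc n → f x < suc n
  f-bnd {zero} lt = lt
  f-bnd {suc x} (s≤s lt) = s≤s (bnd p lt)

-- Freeness of the boards

crowd : ∀ {K M} → M < K → (g : ℕ → ℕ) → (∀ {i} → i < K → g i < M) → (∀ {i j} → i < j → j < K → g i ≢ g j) → ⊥
crowd {K} {M} lt g b d = let (i , j , i<j , e) = pigeonhole {M} {K} lt (λ i → fromℕ< (b (toℕ<n i))) in
  d i<j (toℕ<n j) (trans (sym (toℕ-fromℕ< (b (toℕ<n i)))) (trans (cong toℕ e) (toℕ-fromℕ< (b (toℕ<n j)))))

Near : ℕ → ℕ → Set
Near i j = (j ≡ suc i ⊎ i ≡ suc j) ⊎ ((i ≡ 0 × j ≡ 2) ⊎ (i ≡ 2 × j ≡ 0))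

near : ∀ i j → T (patAdj (lol 3) i j) → Near i j
near i j t with ∨-elim ((i <ᵇ j) ∧ lol 3 i j) t
... | inj₁ s = up i j (∧-elim₂ {i <ᵇ j} s)
  where
  up : ∀ i j → T (lol 3 i j) → Near i j
  up i j t with ∨-elim (j ≡ᵇ suc i) t
  ... | inj₁ e = inj₁ (inj₁ (≡ᵇ⇒≡ j (suc i) e))
  ... | inj₂ e = inj₂ (inj₁ (≡ᵇ⇒≡ i 0 (∧-elim₁ e) , suc-injective (≡ᵇ⇒≡ (suc j) 3 (∧-elim₂ {i ≡ᵇ 0} e))))
... | inj₂ s with ∨-elim (i ≡ᵇ suc j) (∧-elim₂ {j <ᵇ i} s)
...   | inj₁ e = inj₁ (inj₂ (≡ᵇ⇒≡ i (suc j) e))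
...   | inj₂ e = inj₂ (inj₂ (suc-injective (≡ᵇ⇒≡ (suc i) 3 (∧-elim₂ {j ≡ᵇ 0} e)) , ≡ᵇ⇒≡ j 0 (∧-elim₁ e)))

-- 0, 1, 2 and then every second vertex of the path
pos : ℕ → ℕ
pos zero = 0
pos (suc zero) = 1
pos (suc (suc t)) = 2 + (t + t)

pos-gap : ∀ {i j} → i < j → 3 ≤ j → 2 + pos i ≤ pos j
pos-gap {zero} {suc (suc (suc t))} _ _ = s≤s (s≤s z≤n)
pos-gap {suc zero} {suc (suc (suc t))} _ _ = s≤s (s≤s (s≤s z≤n))
pos-gap {suc (suc s)} {suc (suc t)} (s≤s (s≤s s<t)) _ = s≤s (s≤s (subst (_≤ t + t) (cong suc (+-suc s s)) (+-mono-≤ s<t s<t)))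
pos-gap {_} {suc zero} _ (s≤s ())
pos-gap {_} {suc (suc zero)} _ (s≤s (s≤s ()))

pos-mono : ∀ {i j} → i < j → pos i < pos j
pos-mono {zero} {suc zero} _ = s≤s z≤n
pos-mono {zero} {suc (suc t)} _ = s≤s z≤n
pos-mono {suc zero} {suc (suc t)} _ = s≤s (s≤s z≤n)
pos-mono {suc (suc s)} {suc (suc t)} (s≤s (s≤s s<t)) = s≤s (s≤s (+-mono-<-≤ s<t (<⇒≤ s<t)))
pos-mono {suc _} {suc zero} (s≤s ())

pos-big : ∀ {j} → 3 ≤ j → 4 ≤ pos j
pos-big {suc (suc (suc t))} _ = s≤s (s≤s (s≤s (subst (1 ≤_) (sym (+-suc t t)) (s≤s z≤n))))
pos-big {suc zero} (s≤s ())
pos-big {suc (suc zero)} (s≤s (s≤s ()))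

pos-twice : ∀ {i} → 2 ≤ i → 2 + pos i ≡ i + i
pos-twice {suc (suc t)} _ = cong (2 +_) (sym (trans (+-suc t (suc t)) (cong suc (+-suc t t))))
pos-twice {suc zero} (s≤s ())

not-near : ∀ {a b} → 2 + a ≤ b → 3 ≤ b → ¬ Near a b
not-near p q (inj₁ (inj₁ refl)) = <-irrefl refl p
not-near {b = b} p q (inj₁ (inj₂ refl)) = <⇒≱ p (≤-trans (n≤1+n b) (n≤1+n (suc b)))
not-near p q (inj₂ (inj₁ (refl , refl))) = <-irrefl refl q
not-near p () (inj₂ (inj₂ (refl , refl)))

b-col′ : ∀ σ x y → row x ≢ row y → col x ≡ col y → T (boardAdj σ x y)
b-col′ σ (i , s , j) (i′ , s′ , .j) ne refl = ≡⇒T (b-col σ s s′ j ne)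

b-row′ : ∀ σ x y → row x ≡ row y → (T σ → row x ≢ 0) → col x ≢ col y → T (boardAdj σ x y)
b-row′ σ (i , s , j) (.i , s′ , j′) refl n ne = ≡⇒T (b-row σ s s′ n ne)

b-signed′ : ∀ x y → row x ≡ 0 → row y ≡ 0 → col x ≢ col y → sign x ≢ sign y → T (boardAdj true x y)
b-signed′ (.0 , s , j) (.0 , s′ , j′) refl refl ne sn = ≡⇒T (trans (b-signed true s s′ tt ne) (differ s s′ sn))
  where
  differ : ∀ s s′ → s ≢ s′ → (s xor s′) ≡ true
  differ true true n = ⊥-elim (n refl)
  differ true false _ = refl
  differ false true _ = refl
  differ false false n = ⊥-elim (n refl)

b-sign : ∀ x y → row x ≡ 0 → row y ≡ 0 → T (boardAdj true x y) → sign x ≢ sign y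
b-sign (.0 , s , j) (.0 , .s , j′) refl refl t refl = same s (∧-elim₂ {not (j ≡ᵇ j′)} t)
  where
  same : ∀ s → ¬ T (s xor s)
  same true ()
  same false ()

third : ∀ {a b c : Bool} → a ≢ b → c ≢ b → a ≡ c
third {true} {true} p _ = ⊥-elim (p refl)
third {false} {false} p _ = ⊥-elim (p refl)
third {true} {false} {true} _ _ = refl
third {true} {false} {false} _ q = ⊥-elim (q refl)
third {false} {true} {false} _ _ = refl
third {false} {true} {true} _ q = ⊥-elim (q refl)

allowed-false : ∀ σ z → (T σ → row z ≢ 0) → T (allowed σ z) → sign z ≡ false
allowed-false σ (i , false , j) n t = refl
allowed-false true (zero , true , j) n t = ⊥-elim (n tt refl)

module KiteFree (σ : Bool) (M n : ℕ) (r : ℕ → Cell) (val : ∀ {i} → i < n → Kite.Valid σ M M (r i))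
                (radj : ∀ {i j} → i < n → j < n → boardAdj σ (r i) (r j) ≡ patAdj (lol 3) i j)
                (rinj : ∀ {i j} → i < n → j < n → r i ≡ r j → i ≡ j)
                (2M≤ : M + M ≤ suc n) (5≤n : 5 ≤ n) where
  A : ℕ → ℕ → Set
  A i j = T (boardAdj σ (r i) (r j))

  A-sym : ∀ {i j} → A i j → A j i
  A-sym {i} {j} = subst T (boardAdj-comm σ (r i) (r j))

  A⇒near : ∀ {i j} → i < n → j < n → A i j → Near i j
  A⇒near {i} {j} p q t = near i j (subst T (radj p q) t)

  A⁺ : ∀ {i j} → i < n → j < n → T (patAdj (lol 3) i j) → A i j
  A⁺ p q = subst T (sym (radj p q))

  A-next : ∀ {i} → suc i < n → A i (suc i)
  A-next {i} p = A⁺ (<⇒≤ p) p (subst T (sym (patAdj-< (lol 3) {i} {suc i} ≤-refl)) (≡⇒T (Kite.next₃ false i)))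

  0< : 0 < n
  0< = ≤-trans (s≤s z≤n) 5≤n
  1< : 1 < n
  1< = ≤-trans (s≤s (s≤s z≤n)) 5≤n
  2< : 2 < n
  2< = ≤-trans (s≤s (s≤s (s≤s z≤n))) 5≤n

  -- The last chosen vertex is `pos M` = 2M - 2; `2M≤` says that it still belongs to the copy.
  pos-< : ∀ {i} → i < suc M → pos i < n
  pos-< {zero} _ = 0<
  pos-< {suc zero} _ = 1<
  pos-< {suc (suc t)} (s≤s p) = ≤-pred (≤-trans (≤-trans (≤-reflexive (pos-twice {suc (suc t)} (s≤s (s≤s z≤n)))) (+-mono-≤ p p)) 2M≤)

  triangle : (row (r 0) ≡ row (r 1) × row (r 0) ≡ row (r 2)) ⊎ (col (r 0) ≡ col (r 1) × col (r 0) ≡ col (r 2))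
  triangle with b-cases σ (r 0) (r 1) (A⁺ 0< 1< tt) | b-cases σ (r 0) (r 2) (A⁺ 0< 2< tt) | b-cases σ (r 1) (r 2) (A⁺ 1< 2< tt)
  ... | inj₁ (p , _) | inj₁ (q , _) | _ = inj₁ (p , q)
  ... | inj₂ (_ , p) | inj₂ (_ , q) | _ = inj₂ (p , q)
  ... | inj₁ (p , _) | inj₂ (q , _) | inj₁ (e , _) = ⊥-elim (q (trans p e))
  ... | inj₁ (_ , p) | inj₂ (_ , q) | inj₂ (_ , e) = ⊥-elim (p (trans q (sym e)))
  ... | inj₂ (p , _) | inj₁ (q , _) | inj₁ (e , _) = ⊥-elim (p (trans q (sym e)))
  ... | inj₂ (_ , p) | inj₁ (_ , q) | inj₂ (_ , e) = ⊥-elim (q (trans p e))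

  -- `f` counts the lines that cross the line `g` of the triangle. The triangle's vertices share `g`
  -- and so differ in `f`; any other two chosen vertices are non-adjacent in the pattern and cannot
  -- share `f` either. That is M + 1 vertices on M lines.
  lines : (f g : Cell → ℕ) → (∀ {a} → a < n → f (r a) < M) →
          (∀ {i j} → i < j → j < suc M → f (r (pos i)) ≡ f (r (pos j)) → g (r (pos i)) ≢ g (r (pos j)) × A (pos i) (pos j)) →
          g (r 0) ≡ g (r 1) → g (r 0) ≡ g (r 2) → ⊥
  lines f g bound clash e₁ e₂ = crowd {suc M} {M} ≤-refl (λ i → f (r (pos i))) (bound ∘ pos-<) distinct
    where
    tri≡ : ∀ {i j} → i < j → j < 3 → g (r (pos i)) ≡ g (r (pos j))
    tri≡ {zero} {suc zero} _ _ = e₁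
    tri≡ {zero} {suc (suc zero)} _ _ = e₂
    tri≡ {suc zero} {suc (suc zero)} _ _ = trans (sym e₁) e₂
    tri≡ {suc _} {suc zero} (s≤s ()) _
    tri≡ {suc (suc _)} {suc (suc zero)} (s≤s (s≤s ())) _
    tri≡ {_} {suc (suc (suc _))} _ (s≤s (s≤s (s≤s ())))
    distinct : ∀ {i j} → i < j → j < suc M → f (r (pos i)) ≢ f (r (pos j))
    distinct {i} {j} i<j j≤ e with j <? 3
    ... | yes j<3 = proj₁ (clash i<j j≤ e) (tri≡ i<j j<3)
    ... | no j≮ = not-near (pos-gap i<j (≮⇒≥ j≮)) (<⇒≤ (pos-big (≮⇒≥ j≮)))
                    (A⇒near (pos-< (<-trans i<j j≤)) (pos-< j≤) (proj₂ (clash i<j j≤ e)))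

  cell≡ : ∀ {a b} → row (r a) ≡ row (r b) → sign (r a) ≡ sign (r b) → col (r a) ≡ col (r b) → r a ≡ r b
  cell≡ p q s = cong₂ _,_ p (cong₂ _,_ q s)

  plain≡ : ∀ {a b} → a < n → b < n → row (r a) ≡ row (r b) → (T σ → row (r a) ≢ 0) → col (r a) ≡ col (r b) → a ≡ b
  plain≡ {a} {b} p q e n0 c = rinj p q (cell≡ e (trans (allowed-false σ (r a) n0 (proj₂ (proj₂ (val p))))
    (sym (allowed-false σ (r b) (λ s z → n0 s (trans e z)) (proj₂ (proj₂ (val q)))))) c)

  by-columns : (∀ {i j} → i < j → j < suc M → row (r (pos i)) ≡ row (r (pos j)) → col (r (pos i)) ≢ col (r (pos j))) →
               row (r 0) ≡ row (r 1) → row (r 0) ≡ row (r 2) → ⊥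
  by-columns single = lines col row (λ p → proj₁ (proj₂ (val p)))
    (λ {i} {j} i<j j≤ e → let n = λ e′ → single i<j j≤ e′ e in n , b-col′ σ (r (pos i)) (r (pos j)) n e)

module EvenFree (M n : ℕ) (r : ℕ → Cell) (val : ∀ {i} → i < n → Kite.Valid false M M (r i))
                (radj : ∀ {i j} → i < n → j < n → boardAdj false (r i) (r j) ≡ patAdj (lol 3) i j)
                (rinj : ∀ {i j} → i < n → j < n → r i ≡ r j → i ≡ j)
                (2M≤ : M + M ≤ suc n) (5≤n : 5 ≤ n) where
  open KiteFree false M n r val radj rinj 2M≤ 5≤n

  absurd : ⊥
  absurd with triangle
  ... | inj₁ (p , q) = by-columns single p q
    where
    single : ∀ {i j} → i < j → j < suc M → row (r (pos i)) ≡ row (r (pos j)) → col (r (pos i)) ≢ col (r (pos j))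
    single i<j j≤ e c = <⇒≢ (pos-mono i<j) (plain≡ (pos-< (<-trans i<j j≤)) (pos-< j≤) e (λ ()) c)
  ... | inj₂ (p , q) = lines row col (λ p → proj₁ (val p))
    (λ {i} {j} i<j j≤ e → let n = λ c → <⇒≢ (pos-mono i<j) (plain≡ (pos-< (<-trans i<j j≤)) (pos-< j≤) e (λ ()) c)
                          in n , b-row′ false (r (pos i)) (r (pos j)) e (λ ()) n) p q

-- Row 0 spoils the count twice: a cell can contain two vertices, and equal signs are non-adjacent.
-- The first defect is removed by `no-double`, the second by the choice `κ` of other vertices.
module OddFree (M n : ℕ) (r : ℕ → Cell) (val : ∀ {i} → i < n → Kite.Valid true M M (r i))
               (radj : ∀ {i j} → i < n → j < n → boardAdj true (r i) (r j) ≡ patAdj (lol 3) i j)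
               (rinj : ∀ {i j} → i < n → j < n → r i ≡ r j → i ≡ j)
               (n≡ : M + M ≡ n) (5≤n : 5 ≤ n) where
  open KiteFree true M n r val radj rinj (≤-trans (≤-reflexive n≡) (m≤n⇒m≤1+n ≤-refl)) 5≤n

  -- No cycles besides the triangle: a set in which every vertex has two neighbours stays below 3.
  Two : List ℕ → ℕ → Set
  Two L t = ∃[ a ] ∃[ b ] (a ≢ b × a ∈ L × b ∈ L × A t a × A t b)

  -- A vertex t ≥ 3 has no neighbours but t - 1 and t + 1, so `L` contains t + 1 as well, and so on
  -- beyond n; `fuel` measures the climb.
  ascend : ∀ L → All (_< n) L → All (Two L) L → ∀ fuel t → n ≤ fuel + t → 3 ≤ t → t ∈ L → ⊥
  ascend L bd two zero t le 3≤t m = <⇒≱ (All.lookup bd m) le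
  ascend L bd two (suc fuel) t le 3≤t m with All.lookup two m
  ... | a , b , a≢b , ma , mb , ta , tb = [ (λ { refl → go ma }) , (λ pa → [ (λ { refl → go mb }) , (λ pb → a≢b (suc-injective (trans (sym pa) pb))) ]′ (beyond mb tb)) ]′ (beyond ma ta)
    where
    go : suc t ∈ L → ⊥
    go = ascend L bd two fuel (suc t) (subst (n ≤_) (sym (+-suc fuel t)) le) (m≤n⇒m≤1+n 3≤t)
    beyond : ∀ {c} → c ∈ L → A t c → c ≡ suc t ⊎ t ≡ suc c
    beyond mc tc with A⇒near (All.lookup bd m) (All.lookup bd mc) tc
    ... | inj₁ e = e
    ... | inj₂ (inj₁ (refl , _)) = ⊥-elim (n≮0 3≤t)
    ... | inj₂ (inj₂ (refl , _)) = ⊥-elim (<-irrefl refl 3≤t)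

  -- By the climb `L` lies within the triangle, where any two vertices are adjacent; so a cycle with
  -- a non-adjacent pair is contradictory.
  cyc : ∀ L {i j} → All (_< n) L → All (Two L) L → i ∈ L → j ∈ L → i ≢ j → ¬ A i j → ⊥
  cyc L {i} {j} bd two mi mj ne na with 3 ≤? i | 3 ≤? j
  ... | yes p | _ = ascend L bd two n i (m≤m+n n i) p mi
  ... | no _ | yes p = ascend L bd two n j (m≤m+n n j) p mj
  ... | no p | no q = na (A⁺ (All.lookup bd mi) (All.lookup bd mj) (small i j (≰⇒> p) (≰⇒> q) ne))
    where
    small : ∀ i j → i < 3 → j < 3 → i ≢ j → T (patAdj (lol 3) i j)
    small 0 0 _ _ ne = ⊥-elim (ne refl)
    small 0 1 _ _ _ = tt
    small 0 2 _ _ _ = tt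
    small 1 0 _ _ _ = tt
    small 1 1 _ _ ne = ⊥-elim (ne refl)
    small 1 2 _ _ _ = tt
    small 2 0 _ _ _ = tt
    small 2 1 _ _ _ = tt
    small 2 2 _ _ ne = ⊥-elim (ne refl)
    small (suc (suc (suc _))) _ (s≤s (s≤s (s≤s ()))) _ _
    small 0 (suc (suc (suc _))) _ (s≤s (s≤s (s≤s ()))) _
    small 1 (suc (suc (suc _))) _ (s≤s (s≤s (s≤s ()))) _
    small 2 (suc (suc (suc _))) _ (s≤s (s≤s (s≤s ()))) _

  Z : ℕ → Set
  Z a = row (r a) ≡ 0

  c : ℕ → ℕ
  c a = col (r a)

  s : ℕ → Bool
  s a = sign (r a)

  Kind : ℕ → ℕ → Set
  Kind i x = (Z x × c x ≢ c i × s x ≢ s i) ⊎ (row (r x) ≢ 0 × c i ≡ c x)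

  kind : ∀ {i x} → Z i → A i x → Kind i x
  kind {i} {x} zi t with b-cases true (r i) (r x) t
  ... | inj₁ (p , q) = inj₁ (trans (sym p) zi , q ∘ sym , b-sign (r i) (r x) zi (trans (sym p) zi) t ∘ sym)
  ... | inj₂ (p , q) = inj₂ ((λ e → p (trans zi (sym e))) , q)

  col-A : ∀ {i x} → Z i → row (r x) ≢ 0 → c i ≡ c x → A i x
  col-A {i} {x} zi n e = b-col′ true (r i) (r x) (λ p → n (trans (sym p) zi)) e

  row-A : ∀ {i x} → Z i → Z x → c i ≢ c x → s i ≢ s x → A i x
  row-A {i} {x} = b-signed′ (r i) (r x)

  same-¬A : ∀ {i x} → Z i → Z x → s i ≡ s x → ¬ A i x
  same-¬A {i} {x} zi zx e t = b-sign (r i) (r x) zi zx t e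

  record Nbrs (i : ℕ) : Set where
    constructor nbrs
    field
      {a b} : ℕ
      a≢b : a ≢ b
      a<  : a < n
      b<  : b < n
      ia  : A i a
      ib  : A i b

  two-nbrs : ∀ i → suc i < n → Nbrs i
  two-nbrs zero p = nbrs (λ ()) 1< 2< (A⁺ 0< 1< tt) (A⁺ 0< 2< tt)
  two-nbrs (suc zero) p = nbrs {a = 0} {2} (λ ()) 0< 2< (A⁺ 1< 0< tt) (A⁺ 1< 2< tt)
  two-nbrs (suc (suc t)) p = nbrs {a = suc t} {suc (suc (suc t))} (λ e → <⇒≢ (m≤n⇒m≤1+n ≤-refl) e) (<⇒≤ (<⇒≤ p)) p (A-sym (A-next (<⇒≤ p))) (A-next p)

  caseA : ∀ {i j a b} → i < n → j < n → a < n → b < n → i ≢ j → a ≢ b → ¬ A i j → A i a → A i b → A j a → A j b → ⊥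
  caseA {i} {j} {a} {b} i< j< a< b< ij ab nij ia ib ja jb = cyc (i ∷ j ∷ a ∷ b ∷ []) (i< ∷ j< ∷ a< ∷ b< ∷ [])
    ((a , b , ab , there (there (here refl)) , there (there (there (here refl))) , ia , ib) ∷
     (a , b , ab , there (there (here refl)) , there (there (there (here refl))) , ja , jb) ∷
     (i , j , ij , here refl , there (here refl) , A-sym ia , A-sym ja) ∷
     (i , j , ij , here refl , there (here refl) , A-sym ib , A-sym jb) ∷ []) (here refl) (there (here refl)) ij nij

  five : ∀ {i x j y b} → i < n → x < n → j < n → y < n → b < n → i ≢ j → ¬ A i j → x ≢ b → x ≢ y → j ≢ b → y ≢ i →
         A i x → A x j → A j y → A y b → A b i → ⊥
  five {i} {x} {j} {y} {b} i< x< j< y< b< ij nij xb xy jb yi ix xj jy yb bi = cyc (i ∷ x ∷ j ∷ y ∷ b ∷ []) (i< ∷ x< ∷ j< ∷ y< ∷ b< ∷ [])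
    ((x , b , xb , m₁ , m₄ , ix , A-sym bi) ∷ (i , j , ij , m₀ , m₂ , A-sym ix , xj) ∷ (x , y , xy , m₁ , m₃ , A-sym xj , jy) ∷
     (j , b , jb , m₂ , m₄ , A-sym jy , yb) ∷ (y , i , yi , m₃ , m₀ , A-sym yb , bi) ∷ []) m₀ m₂ ij nij
    where
    m₀ : i ∈ (i ∷ x ∷ j ∷ y ∷ b ∷ [])
    m₀ = here refl
    m₁ : x ∈ (i ∷ x ∷ j ∷ y ∷ b ∷ [])
    m₁ = there (here refl)
    m₂ : j ∈ (i ∷ x ∷ j ∷ y ∷ b ∷ [])
    m₂ = there (there (here refl))
    m₃ : y ∈ (i ∷ x ∷ j ∷ y ∷ b ∷ [])
    m₃ = there (there (there (here refl)))
    m₄ : b ∈ (i ∷ x ∷ j ∷ y ∷ b ∷ [])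
    m₄ = there (there (there (there (here refl))))

  six : ∀ {i x e j y b} → i < n → x < n → e < n → j < n → y < n → b < n → i ≢ j → ¬ A i j → x ≢ b → i ≢ e → x ≢ j → e ≢ y → j ≢ b → y ≢ i →
        A i x → A x e → A e j → A j y → A y b → A b i → ⊥
  six {i} {x} {e} {j} {y} {b} i< x< e< j< y< b< ij nij xb ie xj ey jb yi ix xe ej jy yb bi =
    cyc (i ∷ x ∷ e ∷ j ∷ y ∷ b ∷ []) (i< ∷ x< ∷ e< ∷ j< ∷ y< ∷ b< ∷ [])
    ((x , b , xb , m₁ , m₅ , ix , A-sym bi) ∷ (i , e , ie , m₀ , m₂ , A-sym ix , xe) ∷ (x , j , xj , m₁ , m₃ , A-sym xe , ej) ∷
     (e , y , ey , m₂ , m₄ , A-sym ej , jy) ∷ (j , b , jb , m₃ , m₅ , A-sym jy , yb) ∷ (y , i , yi , m₄ , m₀ , A-sym yb , bi) ∷ []) m₀ m₃ ij nij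
    where
    m₀ : i ∈ (i ∷ x ∷ e ∷ j ∷ y ∷ b ∷ [])
    m₀ = here refl
    m₁ : x ∈ (i ∷ x ∷ e ∷ j ∷ y ∷ b ∷ [])
    m₁ = there (here refl)
    m₂ : e ∈ (i ∷ x ∷ e ∷ j ∷ y ∷ b ∷ [])
    m₂ = there (there (here refl))
    m₃ : j ∈ (i ∷ x ∷ e ∷ j ∷ y ∷ b ∷ [])
    m₃ = there (there (there (here refl)))
    m₄ : y ∈ (i ∷ x ∷ e ∷ j ∷ y ∷ b ∷ [])
    m₄ = there (there (there (there (here refl))))
    m₅ : b ∈ (i ∷ x ∷ e ∷ j ∷ y ∷ b ∷ [])
    m₅ = there (there (there (there (there (here refl)))))

  record Double (i j : ℕ) : Set where
    field
      i< : i < n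
      j< : j < n
      i≢j : i ≢ j
      zi : Z i
      zj : Z j
      cc : c i ≡ c j
    ss : s i ≢ s j
    ss e = i≢j (rinj i< j< (cell≡ (trans zi (sym zj)) e cc))
    ¬ij : ¬ A i j
    ¬ij t with b-cases true (r i) (r j) t
    ... | inj₁ (_ , q) = q cc
    ... | inj₂ (p , _) = p (trans zi (sym zj))

  swapD : ∀ {i j} → Double i j → Double j i
  swapD d = record { i< = j< ; j< = i< ; i≢j = i≢j ∘ sym ; zi = zj ; zj = zi ; cc = sym cc }
    where
    open Double d

  module _ {i j : ℕ} (d : Double i j) where
    open Double d

    -- Neighbours of i within row 0 have the sign of j and conversely, so the two kinds are adjacent
    -- unless they share a column.
    rowB : ∀ {b e} → Z b → Z e → s b ≢ s i → s e ≢ s j → c b ≢ c e → A b e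
    rowB zb ze sb se ne = row-A zb ze ne (λ q → se (trans (sym q) (third sb (λ p → ss (sym p)))))

    ≢j : ∀ {b} → A i b → b ≢ j
    ≢j t refl = ¬ij t

    ≢i : ∀ {b} → A j b → b ≢ i
    ≢i t refl = ¬ij (A-sym t)

  -- Here b and e share a cell. As b is not the end of the path it has a neighbour z other than i:
  -- in row 0, z is adjacent to j and gives a cycle of length 5; off row 0, it is adjacent to e too
  -- and gives one of length 6.
  caseB′ : ∀ {i j x b e} → Double i j → suc b < n → x < n → e < n → A i x → A j x → row (r x) ≢ 0 →
           A i b → Z b → s b ≢ s i → A j e → Z e → s e ≢ s j → c b ≡ c e → ⊥
  caseB′ {i} {j} {x} {b} {e} d b<′ x< e< ix jx x0 ib zb sb je ze se be with two-nbrs b b<′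
  ... | nbrs {a₁} {a₂} ne p q u v = [ (λ { refl → from q v (λ e′ → ne (sym e′)) }) , (λ n′ → from p u n′) ]′ (isI a₁)
    where
    open Double d
    b< : b < n
    b< = <⇒≤ b<′
    isI : ∀ a → a ≡ i ⊎ a ≢ i
    isI a with a ℕP.≟ i
    ... | yes p = inj₁ p
    ... | no p = inj₂ p
    x≢ : ∀ {y} → Z y → x ≢ y
    x≢ zy refl = x0 zy
    from : ∀ {z} → z < n → A b z → z ≢ i → ⊥
    from {z} z< bz z≢i with kind zb bz
    ... | inj₁ (zz , cz , sz) = five i< x< j< z< b< i≢j ¬ij (x≢ zb) (x≢ zz) (λ e′ → ≢j d ib (sym e′)) z≢i ix (A-sym jx)
            (A-sym (row-A zz zj (λ e′ → z≢i (rinj z< i< (cell≡ (trans zz (sym zi)) si (trans e′ (sym cc))))) (λ e′ → ss (trans (sym si) e′)))) (A-sym bz) (A-sym ib)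
      where
      si : s z ≡ s i
      si = third sz (λ e′ → sb (sym e′))
    ... | inj₂ (z0 , cz) = six {i} {x} {j} {e} {z} {b} i< x< j< e< z< b< (λ e′ → ≢i d je (sym e′)) (same-¬A zi ze (third (λ q → ss q) (λ q → se q)))
            (x≢ zb) i≢j (x≢ ze) (λ { refl → z0 zj }) (λ { refl → ss (sym (third (λ q → se (sym q)) (λ q → sb (sym q)))) }) z≢i
            ix (A-sym jx) je (col-A ze z0 (trans (sym be) cz)) (A-sym bz) (A-sym ib)

  caseB : ∀ {i j x b e} → Double i j → b < n → x < n → e < n → A i x → A j x → row (r x) ≢ 0 →
          A i b → Z b → s b ≢ s i → A j e → Z e → s e ≢ s j → ⊥
  caseB {i} {j} {x} {b} {e} d b< x< e< ix jx x0 ib zb sb je ze se with c b ℕP.≟ c e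
  ... | no ne = five i< x< j< e< b< i≢j ¬ij (λ { refl → x0 zb }) (λ { refl → x0 ze }) (λ q → ≢j d ib (sym q)) (≢i d je) ix (A-sym jx) je
                  (A-sym (rowB d zb ze sb se ne)) (A-sym ib)
    where
    open Double d
  ... | yes be with m≤n⇒m<n∨m≡n b< | m≤n⇒m<n∨m≡n e<
  ...   | inj₁ p | _ = caseB′ d p x< e< ix jx x0 ib zb sb je ze se be
  ...   | inj₂ _ | inj₁ p = caseB′ (swapD d) p x< b< jx ix x0 je ze se ib zb sb (sym be)
  ...   | inj₂ p | inj₂ q with suc-injective (trans p (sym q))
  ...     | refl = Double.ss d (trans (third (λ e′ → sb (sym e′)) (λ e′ → se (sym e′) )) refl)

  Row : ℕ → ℕ → Set
  Row i a = Z a × c a ≢ c i × s a ≢ s i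

  row-cols : ∀ {i a b} → a < n → b < n → a ≢ b → Row i a → Row i b → c a ≢ c b
  row-cols a< b< ne (za , _ , sa) (zb , _ , sb) e = ne (rinj a< b< (cell≡ (trans za (sym zb)) (third sa sb) e))

  square : ∀ {i a b e} → i < n → a < n → b < n → e < n → a ≢ b → i ≢ e → Z i → Z e → s i ≡ s e → A i a → A i b → Row i a → Row i b →
           c e ≢ c a → c e ≢ c b → ⊥
  square i< a< b< e< ab ie zi ze se ia ib (za , _ , sa) (zb , _ , sb) na nb = caseA i< e< a< b< ie ab (same-¬A zi ze se) ia ib
    (row-A ze za na (λ q → sa (trans (sym q) (sym se)))) (row-A ze zb nb (λ q → sb (trans (sym q) (sym se))))

  -- All four neighbours lie in row 0. If e or f misses the columns of both a and b, it forms a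
  -- cycle of length 4 with i, a and b. Otherwise e and f pair off with a and b by columns, and the
  -- remaining adjacencies give a cycle of length 6.
  caseC : ∀ {i j a b e f} → Double i j → a < n → b < n → e < n → f < n → a ≢ b → e ≢ f → A i a → A i b → A j e → A j f →
          Row i a → Row i b → Row j e → Row j f → ⊥
  caseC {i} {j} {a} {b} {e} {f} d a< b< e< f< ab ef ia ib je jf ra rb re rf
    with c e ℕP.≟ c a | c e ℕP.≟ c b | c f ℕP.≟ c a | c f ℕP.≟ c b
  ... | no p | no q | _ | _ = square i< a< b< e< ab (λ q → ≢i d je (sym q)) zi (proj₁ re) (third ss (proj₂ (proj₂ re))) ia ib ra rb p q
    where
    open Double d
  ... | _ | _ | no p | no q = square i< a< b< f< ab (λ q → ≢i d jf (sym q)) zi (proj₁ rf) (third ss (proj₂ (proj₂ rf))) ia ib ra rb p q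
    where
    open Double d
  ... | yes p | _ | yes q | _ = row-cols e< f< ef re rf (trans p (sym q))
  ... | _ | yes p | _ | yes q = row-cols e< f< ef re rf (trans p (sym q))
  ... | yes p | _ | _ | yes q = hexagon d a< b< e< f< ab ef ia ib je jf ra rb re rf p q
    where
    hexagon : ∀ {i j a b e f} → Double i j → a < n → b < n → e < n → f < n → a ≢ b → e ≢ f → A i a → A i b → A j e → A j f →
              Row i a → Row i b → Row j e → Row j f → c e ≡ c a → c f ≡ c b → ⊥
    hexagon d a< b< e< f< ab ef ia ib je jf ra@(za , _ , sa) rb@(zb , _ , sb) (ze , _ , se) (zf , _ , sf) p q =
      six i< a< f< j< e< b< i≢j ¬ij ab (λ x → ≢i d jf (sym x)) (≢j d ia) (λ x → ef (sym x)) (λ x → ≢j d ib (sym x)) (≢i d je) ia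
        (rowB d za zf sa sf (λ x → row-cols a< b< ab ra rb (trans x q))) (A-sym jf) je (A-sym (rowB d zb ze sb se (λ x → row-cols a< b< ab ra rb (sym (trans x p))))) (A-sym ib)
      where
      open Double d
  ... | no _ | yes p | yes q | no _ = six i< a< e< j< f< b< i≢j ¬ij ab (λ x → ≢i d je (sym x)) (≢j d ia) ef (λ x → ≢j d ib (sym x)) (≢i d jf) ia
        (rowB d (proj₁ ra) (proj₁ re) (proj₂ (proj₂ ra)) (proj₂ (proj₂ re)) (λ x → row-cols a< b< ab ra rb (trans x p))) (A-sym je) jf
        (A-sym (rowB d (proj₁ rb) (proj₁ rf) (proj₂ (proj₂ rb)) (proj₂ (proj₂ rf)) (λ x → row-cols a< b< ab ra rb (sym (trans x q))))) (A-sym ib)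
    where
    open Double d

  -- A second neighbour in the common column would be shared by i and j too, a cycle of length 4. So
  -- b and e lie in row 0.
  withX : ∀ {i j x b e} → Double i j → x < n → b < n → e < n → row (r x) ≢ 0 → A i x → A j x → A i b → b ≢ x → A j e → e ≢ x → ⊥
  withX {i} {j} {x} {b} {e} d x< b< e< x0 ix jx ib bx je ex with kind (Double.zi d) ib | kind (Double.zj d) je
  ... | inj₂ (b0 , cb) | _ = caseA i< j< x< b< i≢j (λ q → bx (sym q)) ¬ij ix ib jx (col-A zj b0 (trans (sym cc) cb))
    where
    open Double d
  ... | inj₁ _ | inj₂ (e0 , ce) = caseA i< j< x< e< i≢j (λ q → ex (sym q)) ¬ij ix (col-A zi e0 (trans cc ce)) jx je
    where
    open Double d
  ... | inj₁ (zb , _ , sb) | inj₁ (ze , _ , se) = caseB d b< x< e< ix jx x0 ib zb sb je ze se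

  -- Both vertices have two neighbours, since neither ends the path. A neighbour off row 0 lies in
  -- the common column and is shared by both. In every case a second cycle arises.
  no-double : ∀ {i j} → suc i < n → suc j < n → Double i j → ⊥
  no-double {i} {j} i<′ j<′ d with two-nbrs i i<′ | two-nbrs j j<′
  ... | nbrs {a} {b} ab a< b< ia ib | nbrs {e} {f} ef e< f< je jf = go (kind zi ia) (kind zi ib) (kind zj je) (kind zj jf)
    where
    open Double d
    pick : ∀ x → x < n → row (r x) ≢ 0 → A i x → A j x → ∀ {y} → y < n → A i y → y ≢ x → ⊥
    pick x x< x0 ix jx y< iy yx with e ℕP.≟ x
    ... | no q = withX d x< y< e< x0 ix jx iy yx je q
    ... | yes refl = withX d x< y< f< x0 ix jx iy yx jf (λ q → ef (sym q))
    go : Kind i a → Kind i b → Kind j e → Kind j f → ⊥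
    go (inj₂ (a0 , ca)) _ _ _ = pick a a< a0 ia (col-A zj a0 (trans (sym cc) ca)) b< ib (λ q → ab (sym q))
    go _ (inj₂ (b0 , cb)) _ _ = pick b b< b0 ib (col-A zj b0 (trans (sym cc) cb)) a< ia ab
    go (inj₁ (za , _)) _ (inj₂ (e0 , ce)) _ = pick e e< e0 (col-A zi e0 (trans cc ce)) je a< ia (λ { refl → e0 za })
    go (inj₁ (za , _)) _ _ (inj₂ (f0 , cf)) = pick f f< f0 (col-A zi f0 (trans cc cf)) jf a< ia (λ { refl → f0 za })
    go (inj₁ ra) (inj₁ rb) (inj₁ re) (inj₁ rf) = caseC d a< b< e< f< ab ef ia ib je jf ra rb re rf

  -- The end of the path has only one neighbour, so `no-double` misses it. One configuration
  -- survives: the last and the third last vertex in one cell, with a vertex outside row 0 between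
  -- them, just as at the end of `tail₄`.
  leaf-double : ∀ {x w} → suc x < n → suc (suc w) ≡ n → 3 ≤ w → Double x (suc w) → row (r w) ≢ 0 × suc x ≡ w
  leaf-double {x} {w} x<′ last 3≤w d with kind (Double.zj d) (A-sym (A-next {w} (≤-reflexive last)))
  ... | inj₂ (w0 , cw) = w0 , chase (A⇒near i< w< (col-A zi w0 (trans cc cw)))
    where
    open Double d
    w< : w < n
    w< = <⇒≤ (≤-reflexive last)
    chase : Near x w → suc x ≡ w
    chase (inj₁ (inj₁ e)) = sym e
    chase (inj₁ (inj₂ e)) = ⊥-elim (i≢j e)
    chase (inj₂ (inj₁ (_ , refl))) = ⊥-elim (<-irrefl refl 3≤w)
    chase (inj₂ (inj₂ (_ , refl))) = ⊥-elim (n≮0 3≤w)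
  ... | inj₁ (zw , cw , sw) with two-nbrs x x<′
  ...   | nbrs {a} {b} ab a< b< xa xb = ⊥-elim (go (kind zi xa) (kind zi xb))
    where
    open Double d
    w< : w < n
    w< = <⇒≤ (≤-reflexive last)
    only : ∀ {y} → y < n → row (r y) ≢ 0 → c x ≡ c y → ⊥
    only {y} y< y0 cy with A⇒near j< y< (col-A zj y0 (trans (sym cc) cy))
    ... | inj₁ (inj₁ refl) = <-irrefl last y<
    ... | inj₁ (inj₂ e) = y0 (subst Z (suc-injective e) zw)
    ... | inj₂ (inj₂ (e , _)) = <⇒≢ (<-trans 3≤w ≤-refl) (sym e)
    inner : ∀ {y} → y < n → A x y → suc y < n
    inner {y} y< xy with m≤n⇒m<n∨m≡n y<
    ... | inj₁ p = p
    ... | inj₂ p = ⊥-elim (≢j d xy (suc-injective (trans p (sym last))))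
    dbl : ∀ {y} → y < n → A x y → Row x y → c w ≡ c y → ⊥
    dbl {y} y< xy (zy , _ , sy) e = no-double (inner y< xy) (≤-reflexive last) record
      { i< = y< ; j< = w< ; i≢j = λ { refl → sy (third sw ss) } ; zi = zy ; zj = zw ; cc = sym e }
    go : Kind x a → Kind x b → ⊥
    go (inj₂ (a0 , ca)) _ = only a< a0 ca
    go _ (inj₂ (b0 , cb)) = only b< b0 cb
    go (inj₁ ra) (inj₁ rb) with c w ℕP.≟ c a | c w ℕP.≟ c b
    ... | yes p | _ = dbl a< xa ra p
    ... | no _ | yes p = dbl b< xb rb p
    ... | no p | no q = square i< a< b< w< ab (λ { refl → cw cc }) zi zw (third ss sw) xa xb ra rb p q

  module _ (8≤n : 8 ≤ n) where
    -- Since n = 2M, the last chosen vertex is n - 2; thus `no-double` applies to all chosen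
    -- vertices.
    pos-inner : ∀ {i} → i < suc M → suc (pos i) < n
    pos-inner {zero} _ = 1<
    pos-inner {suc zero} _ = 2<
    pos-inner {suc (suc t)} (s≤s p) = ≤-trans (≤-reflexive (pos-twice {suc (suc t)} (s≤s (s≤s z≤n)))) (≤-trans (+-mono-≤ p p) (≤-reflexive n≡))

    single : ∀ {i j} → i < j → j < suc M → row (r (pos i)) ≡ row (r (pos j)) → col (r (pos i)) ≢ col (r (pos j))
    single {i} {j} i<j j≤ e cc with row (r (pos i)) ℕP.≟ 0
    ... | yes z = no-double (pos-inner (<-trans i<j j≤)) (pos-inner j≤) record
          { i< = pos-< (<-trans i<j j≤) ; j< = pos-< j≤ ; i≢j = <⇒≢ (pos-mono i<j) ; zi = z ; zj = trans (sym e) z ; cc = cc }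
    ... | no nz = <⇒≢ (pos-mono i<j) (plain≡ (pos-< (<-trans i<j j≤)) (pos-< j≤) e (λ _ → nz) cc)

    -- Two vertices of row 0 among the chosen ones have a common neighbour in row 0.
    pair′ : ∀ x y → suc (suc y) < n → 3 ≤ y → 2 + x ≤ suc y → Z x → Z (suc y) → suc y ≡ 2 + x × Z (suc x)
    pair′ x y y<′ 3≤y gap zx zy = go (kind zy (A-sym (A-next (<⇒≤ y<′)))) (kind zy (A-next y<′))
      where
      y₁< : suc y < n
      y₁< = <⇒≤ y<′
      y< : y < n
      y< = <⇒≤ y₁<
      x<y : x < suc y
      x<y = <⇒≤ gap
      x<′ : suc x < n
      x<′ = ≤-<-trans (≤-pred gap) y<
      x< : x < n
      x< = <⇒≤ x<′
      ¬xy : ¬ A x (suc y)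
      ¬xy t = not-near gap (m≤n⇒m≤1+n 3≤y) (A⇒near x< y₁< t)
      cxy : c x ≢ c (suc y)
      cxy e = no-double x<′ y<′ record { i< = x< ; j< = y₁< ; i≢j = <⇒≢ x<y ; zi = zx ; zj = zy ; cc = e }
      sxy : s x ≡ s (suc y)
      sxy with s x B.≟ s (suc y)
      ... | yes e = e
      ... | no ne = ⊥-elim (¬xy (row-A zx zy cxy ne))
      go : Kind (suc y) y → Kind (suc y) (suc (suc y)) → suc y ≡ 2 + x × Z (suc x)
      -- The predecessor y of `suc y` has the sign opposite to that of x. It is not in the cell of
      -- x, so it is adjacent to x and comes directly after it.
      go (inj₁ (zw , cw , sw)) _ with c x ℕP.≟ c y
      ... | yes e = ⊥-elim (no-double x<′ y₁< record { i< = x< ; j< = y< ; i≢j = λ { refl → sw sxy } ; zi = zx ; zj = zw ; cc = e })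
      ... | no ne with A⇒near x< y< (row-A zx zw ne (λ e → sw (trans (sym e) sxy)))
      ...   | inj₁ (inj₁ e) = cong suc e , subst Z e zw
      ...   | inj₁ (inj₂ e) = ⊥-elim (<-irrefl e (x<y))
      ...   | inj₂ (inj₁ (_ , e)) = ⊥-elim (<⇒≢ 3≤y (sym e))
      ...   | inj₂ (inj₂ (_ , e)) = ⊥-elim (<⇒≢ (≤-trans (s≤s z≤n) 3≤y) (sym e))
      go (inj₂ _) (inj₁ (zw , cw , sw)) with c x ℕP.≟ c (suc (suc y))
      ... | no ne = ⊥-elim (not-near (m≤n⇒m≤1+n gap) (m≤n⇒m≤1+n (m≤n⇒m≤1+n 3≤y)) (A⇒near x< y<′ (row-A zx zw ne (λ e → sw (trans (sym e) sxy)))))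
      ... | yes e = ⊥-elim (leaf (m≤n⇒m<n∨m≡n y<′))
        where
        d : Double x (suc (suc y))
        d = record { i< = x< ; j< = y<′ ; i≢j = <⇒≢ (m≤n⇒m≤1+n x<y) ; zi = zx ; zj = zw ; cc = e }
        leaf : (suc (suc (suc y)) < n ⊎ suc (suc (suc y)) ≡ n) → ⊥
        leaf (inj₁ p) = no-double x<′ p d
        leaf (inj₂ p) = proj₁ (leaf-double x<′ p (m≤n⇒m≤1+n 3≤y) d) zy
      -- Both neighbours would lie in the column of `suc y`, outside row 0: they would coincide in
      -- one row and be adjacent in two.
      go (inj₂ (y0 , cy)) (inj₂ (w0 , cw)) with row (r y) ℕP.≟ row (r (suc (suc y)))
      ... | yes e = ⊥-elim (<⇒≢ (m≤n⇒m≤1+n ≤-refl) (plain≡ y< y<′ e (λ _ → y0) (trans (sym cy) cw)))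
      ... | no ne = ⊥-elim (not-near ≤-refl (m≤n⇒m≤1+n (m≤n⇒m≤1+n 3≤y)) (A⇒near y< y<′ (b-col′ true (r y) (r (suc (suc y))) ne (trans (sym cy) cw))))

    pair : ∀ {i j} → i < j → j < suc M → 3 ≤ j → Z (pos i) → Z (pos j) → pos j ≡ 2 + pos i × Z (suc (pos i))
    pair {i} {j} i<j j≤ 3≤j zi zj = generic (pos j) refl (pos-big 3≤j)
      where
      generic : ∀ y → pos j ≡ y → 4 ≤ y → pos j ≡ 2 + pos i × Z (suc (pos i))
      generic (suc y) e (s≤s 3≤y) with pair′ (pos i) y (subst (λ z → suc z < n) e (pos-inner j≤)) 3≤y (subst (2 + pos i ≤_) e (pos-gap i<j 3≤j)) zi (subst Z e zj)
      ... | p , q = trans e p , q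

    module Columns (c₁ : col (r 0) ≡ col (r 1)) (c₂ : col (r 0) ≡ col (r 2)) where
      apart-rows : ∀ {a b} → A a b → c a ≡ c b → row (r a) ≢ row (r b)
      apart-rows {a} {b} t e with b-cases true (r a) (r b) t
      ... | inj₁ (_ , q) = ⊥-elim (q e)
      ... | inj₂ (p , _) = p

      tri-rows : ∀ {i j} → i < j → j < 3 → row (r (pos i)) ≢ row (r (pos j))
      tri-rows {zero} {suc zero} _ _ = apart-rows (A⁺ 0< 1< tt) c₁
      tri-rows {zero} {suc (suc zero)} _ _ = apart-rows (A⁺ 0< 2< tt) c₂
      tri-rows {suc zero} {suc (suc zero)} _ _ = apart-rows (A⁺ 1< 2< tt) (trans (sym c₁) c₂)
      tri-rows {suc _} {suc zero} (s≤s ()) _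
      tri-rows {suc (suc _)} {suc (suc zero)} (s≤s (s≤s ())) _
      tri-rows {_} {suc (suc (suc _))} _ (s≤s (s≤s (s≤s ())))

      plain-clash : ∀ {a b} → a < n → b < n → a ≢ b → row (r a) ≢ 0 → row (r a) ≡ row (r b) → Near a b
      plain-clash {a} {b} p q ne nz e with c a ℕP.≟ c b
      ... | yes cc = ⊥-elim (ne (plain≡ p q e (λ _ → nz) cc))
      ... | no cc = A⇒near p q (b-row′ true (r a) (r b) e (λ _ → nz) cc)

      -- After the path in row 0 that starts at t = pos i, the other half of the path vertices is taken.
      module _ {i j : ℕ} (i<j : i < j) (j≤ : j < suc M) (3≤j : 3 ≤ j) (zi : Z (pos i)) (zj : Z (pos j)) where
        t : ℕ
        t = pos i
        pj : pos j ≡ 2 + t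
        pj = proj₁ (pair i<j j≤ 3≤j zi zj)
        z₁ : Z (suc t)
        z₁ = proj₂ (pair i<j j≤ 3≤j zi zj)
        z₂ : Z (2 + t)
        z₂ = subst Z pj zj
        2≤i : 2 ≤ i
        2≤i = small i refl
          where
          small : ∀ a → i ≡ a → 2 ≤ a
          small zero refl = ⊥-elim (<⇒≱ (pos-big 3≤j) (subst (_≤ 3) (sym pj) (s≤s (s≤s z≤n))))
          small (suc zero) refl = ⊥-elim (<⇒≱ (pos-big 3≤j) (subst (_≤ 3) (sym pj) ≤-refl))
          small (suc (suc a)) _ = s≤s (s≤s z≤n)
        t₂< : suc (2 + t) < n
        t₂< = subst (λ z → suc z < n) pj (pos-inner j≤)
        i≤M : i < suc M
        i≤M = <-trans i<j j≤

        -- Jumps over t, t + 1 and t + 2, the stretch of the path in row 0. The shift by 3 changes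
        -- the parity, and the largest value, at M - 1, is the last vertex n - 1.
        κ : ℕ → ℕ
        κ l with l <? i
        ... | yes _ = pos l
        ... | no _ = 3 + pos l

        κ-< : ∀ {l} → l < M → κ l < n
        κ-< {l} p with l <? i
        ... | yes _ = pos-< (m≤n⇒m≤1+n p)
        ... | no l≮ = ≤-trans (≤-reflexive (trans (cong (2 +_) (pos-twice (≤-trans 2≤i (≮⇒≥ l≮)))) (cong suc (sym (+-suc l l))))) (≤-trans (+-mono-≤ p p) (≤-reflexive n≡))

        -- One of t and t + 1 has the sign opposite to that of a later vertex in row 0, so the two
        -- are adjacent or share a cell. They are too far apart to be adjacent, and the cell is
        -- excluded by `no-double` or, at the end of the path, by `leaf-double`.
        late : ∀ {y} → 2 + t ≤ y → suc y < n → ¬ Z (suc y)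
        late {y} le y< zy with s (suc y) B.≟ s t
        ... | yes e = one (c (suc t) ℕP.≟ c (suc y))
          where
          sy : s (suc t) ≢ s (suc y)
          sy p = b-sign (r t) (r (suc t)) zi z₁ (A-next (<⇒≤ (<⇒≤ t₂<))) (trans (sym e) (sym p))
          one : Dec (c (suc t) ≡ c (suc y)) → ⊥
          one (no ne) = not-near (s≤s le) (≤-trans (s≤s (s≤s (s≤s z≤n))) (s≤s le)) (A⇒near (<⇒≤ (<⇒≤ t₂<)) y< (row-A z₁ zy ne sy))
          one (yes cc) = leaf (m≤n⇒m<n∨m≡n y<)
            where
            d : Double (suc t) (suc y)
            d = record { i< = <⇒≤ (<⇒≤ t₂<) ; j< = y< ; i≢j = <⇒≢ (s≤s (<⇒≤ le)) ; zi = z₁ ; zj = zy ; cc = cc }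
            leaf : (suc (suc y) < n ⊎ suc (suc y) ≡ n) → ⊥
            leaf (inj₁ p) = no-double (<⇒≤ t₂<) p d
            leaf (inj₂ p) with leaf-double (<⇒≤ t₂<) p (≤-trans (≤-trans (s≤s (s≤s (s≤s z≤n))) (subst (4 ≤_) pj (pos-big 3≤j))) le) d
            ... | y0 , refl = y0 z₂
        ... | no ne = one (c t ℕP.≟ c (suc y))
          where
          one : Dec (c t ≡ c (suc y)) → ⊥
          one (no nc) = not-near (m≤n⇒m≤1+n le) (≤-trans (s≤s (s≤s (s≤s z≤n))) (s≤s le)) (A⇒near (pos-< i≤M) y< (row-A zi zy nc (λ p → ne (sym p))))
          one (yes cc) = leaf (m≤n⇒m<n∨m≡n y<)
            where
            d : Double t (suc y)
            d = record { i< = pos-< i≤M ; j< = y< ; i≢j = <⇒≢ (m≤n⇒m≤1+n (<⇒≤ le)) ; zi = zi ; zj = zy ; cc = cc }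
            leaf : (suc (suc y) < n ⊎ suc (suc y) ≡ n) → ⊥
            leaf (inj₁ p) = no-double (pos-inner i≤M) p d
            leaf (inj₂ p) with leaf-double (pos-inner i≤M) p (≤-trans (≤-trans (s≤s (s≤s (s≤s z≤n))) (subst (4 ≤_) pj (pos-big 3≤j))) le) d
            ... | _ , refl = <-irrefl refl le

        κ-Z : ∀ {l} → l < M → ¬ Z (κ l)
        -- For l < i, `pair` would make `pos j` equal to 2 + `pos l` as well as 2 + t.
        κ-Z {l} p z with l <? i
        ... | yes l<i = <⇒≢ (pos-mono l<i) (suc-injective (suc-injective (trans (sym (proj₁ (pair (<-trans l<i i<j) j≤ 3≤j z zj))) pj)))
        ... | no l≮ = late (s≤s (s≤s (mono≤ (m≤n⇒m<n∨m≡n (≮⇒≥ l≮))))) (subst (_< n) refl (κ-late p (≮⇒≥ l≮))) z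
          where
          mono≤ : i < l ⊎ i ≡ l → t ≤ pos l
          mono≤ (inj₁ q) = <⇒≤ (pos-mono q)
          mono≤ (inj₂ refl) = ≤-refl
          κ-late : l < M → i ≤ l → 3 + pos l < n
          κ-late p q = ≤-trans (≤-reflexive (trans (cong (2 +_) (pos-twice (≤-trans 2≤i q))) (cong suc (sym (+-suc l l))))) (≤-trans (+-mono-≤ p p) (≤-reflexive n≡))

        κ-rows : ∀ {l l′} → l < l′ → l′ < M → row (r (κ l)) ≢ row (r (κ l′))
        κ-rows {l} {l′} l< l′< e with plain-clash (κ-< (<-trans l< l′<)) (κ-< l′<) | κ-Z (<-trans l< l′<)
        ... | clash | nz with l <? i | l′ <? i
        ...   | no l≮ | yes l′<i = l≮ (<-trans l< l′<i)
        ...   | yes _ | no l′≮ = not-near g (s≤s (s≤s (s≤s z≤n))) (clash (<⇒≢ (<⇒≤ g)) nz e)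
          where
          g : 2 + pos l ≤ 3 + pos l′
          g = s≤s (s≤s (<⇒≤ (m≤n⇒m≤1+n (pos-mono l<))))
        ...   | no l≮ | no l′≮ = not-near g (s≤s (s≤s (s≤s z≤n))) (clash (<⇒≢ (<⇒≤ g)) nz e)
          where
          g : 2 + (3 + pos l) ≤ 3 + pos l′
          g = s≤s (s≤s (s≤s (pos-gap l< (≤-trans (s≤s (≤-trans 2≤i (≮⇒≥ l≮))) l<))))
        ...   | yes _ | yes _ with l′ <? 3
        ...     | yes q = tri-rows l< q e
        ...     | no q = not-near (pos-gap l< (≮⇒≥ q)) (<⇒≤ (pos-big (≮⇒≥ q))) (clash (<⇒≢ (pos-mono l<)) nz e)

        -- M vertices in different rows, none of them in row 0: only M - 1 rows are available,
        -- whence the subtraction of 1.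
        final : ⊥
        final = crowd {M} {M ∸ 1} (below M 0<M) (λ l → row (r (κ l)) ∸ 1)
          (λ {l} p → shrink (row (r (κ l))) M (κ-Z p) (proj₁ (val (κ-< p))))
          (λ {l} {l′} p q e → κ-rows p q (unshrink _ _ (κ-Z (<-trans p q)) (κ-Z q) e))
          where
          0<M : 0 < M
          0<M = ≤-pred (≤-trans (s≤s (≤-trans (s≤s z≤n) 2≤i)) i≤M)
          below : ∀ m → 0 < m → m ∸ 1 < m
          below (suc m) _ = ≤-refl
          shrink : ∀ x m → x ≢ 0 → x < m → x ∸ 1 < m ∸ 1
          shrink zero m n _ = ⊥-elim (n refl)
          shrink (suc x) (suc m) _ (s≤s p) = p
          unshrink : ∀ x y → x ≢ 0 → y ≢ 0 → x ∸ 1 ≡ y ∸ 1 → x ≡ y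
          unshrink zero _ n _ _ = ⊥-elim (n refl)
          unshrink (suc x) zero _ n _ = ⊥-elim (n refl)
          unshrink (suc x) (suc y) _ _ e = cong suc e

      absurd-columns : ⊥
      absurd-columns = crowd {suc M} {M} ≤-refl (λ i → row (r (pos i))) (λ p → proj₁ (val (pos-< p))) distinct
        where
        distinct : ∀ {i j} → i < j → j < suc M → row (r (pos i)) ≢ row (r (pos j))
        distinct {i} {j} i<j j≤ e with j <? 3 | row (r (pos i)) ℕP.≟ 0
        ... | yes q | _ = tri-rows i<j q e
        ... | no q | yes z = final i<j j≤ (≮⇒≥ q) z (trans (sym e) z)
        ... | no q | no nz = not-near (pos-gap i<j (≮⇒≥ q)) (<⇒≤ (pos-big (≮⇒≥ q)))
              (plain-clash (pos-< (<-trans i<j j≤)) (pos-< j≤) (<⇒≢ (pos-mono i<j)) nz e)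

    absurd : ⊥
    absurd with triangle
    ... | inj₁ (p , q) = by-columns single p q
    ... | inj₂ (p , q) = Columns.absurd-columns p q

rows+ : ∀ c e → e + (e + c) ≡ c + (e + e)
rows+ c e = trans (sym (+-assoc e e c)) (+-comm (e + e) c)

double+ : ∀ c e → (c + e) + (c + e) ≡ (c + c) + (e + e)
double+ c e = trans (+-assoc c e (c + e)) (trans (cong (c +_) (trans (sym (+-assoc e c e)) (trans (cong (_+ e) (+-comm e c)) (+-assoc c e e)))) (sym (+-assoc c c (e + e))))

-- Hosts for a triangle with a path

module EvenHost (e : ℕ) where
  open Shuffles false

  M n : ℕ
  M = 3 + e
  n = e + (e + 5)

  open Host (dom M) (dom-unique M)

  anything : Cell → Bool
  anything _ = true

  grown : ∀ {u v} → row u < 3 → row v < 3 → Trail {u} {v} anything 3 3 5 → Realises (Valid M M) n (flip u v)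
  grown {u} {v} ur vr t = subst (λ k → Realises (Valid k k) n (flip u v)) (+-comm e 3)
    (direct (grow e (λ _ _ _ _ _ → tt , tt) ur vr ≤-refl ≤-refl (s≤s (s≤s (s≤s z≤n))) t))

  same-row : Realises (Valid M M) n (flip (0 , false , 0) (0 , false , 1))
  same-row = grown (s≤s z≤n) (s≤s z≤n) (start anything 3 3 (0 , false , 1) ((0 , false , 2) ∷ (0 , false , 0) ∷ (2 , false , 0) ∷ (1 , false , 0) ∷ []) tt)

  no-line : Realises (Valid M M) n (flip (0 , false , 0) (1 , false , 1))
  no-line = grown (s≤s z≤n) (s≤s (s≤s z≤n)) (start anything 3 3 (2 , false , 2) ((2 , false , 1) ∷ (1 , false , 1) ∷ (1 , false , 0) ∷ (0 , false , 0) ∷ []) tt)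

  transpose : Cell → Cell
  transpose (i , s , j) = j , s , i

  -- Without signs, rows and columns are interchangeable, so pairs in a column reduce to pairs in a
  -- row.
  transposed : ∀ {u v} → Realises (Valid M M) n (flip u v) → Realises (Valid M M) n (flip (transpose u) (transpose v))
  transposed = realises-map transpose (λ { refl → refl }) preserves (λ { {i , false , j} (p , q , _) → q , p , tt })
    where
    preserves : ∀ x y → boardAdj false (transpose x) (transpose y) ≡ boardAdj false x y
    preserves (i , s , j) (i′ , s′ , j′) with i ≡ᵇ i′ | j ≡ᵇ j′
    ... | true | true = refl
    ... | true | false = refl
    ... | false | true = refl
    ... | false | false = refl

  flips : ∀ u v → Valid M M u → Valid M M v → u ≢ v → Realises (Valid M M) n (flip u v)
  flips (i , false , j) (i′ , false , j′) (iM , jM , _) (iM′ , jM′ , _) ne with i ℕP.≟ i′ | j ℕP.≟ j′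
  ... | yes refl | yes refl = ⊥-elim (ne refl)
  ... | yes refl | no jj with place {M} {0} (s≤s z≤n) iM | place₂ {M} {0} {1} (s≤s z≤n) (s≤s (s≤s z≤n)) jM jM′ (λ ()) jj
  ...   | p , refl | g , refl , refl = move p false g (λ ()) (λ ()) same-row
  flips (i , false , j) (i′ , false , j′) (iM , jM , _) (iM′ , jM′ , _) ne | no ii | yes refl
    with place₂ {M} {0} {1} (s≤s z≤n) (s≤s (s≤s z≤n)) iM iM′ (λ ()) ii | place {M} {0} (s≤s z≤n) jM
  ... | p , refl , refl | g , refl = transposed (move g false p (λ ()) (λ ()) same-row)
  flips (i , false , j) (i′ , false , j′) (iM , jM , _) (iM′ , jM′ , _) ne | no ii | no jj
    with place₂ {M} {0} {1} (s≤s z≤n) (s≤s (s≤s z≤n)) iM iM′ (λ ()) ii | place₂ {M} {0} {1} (s≤s z≤n) (s≤s (s≤s z≤n)) jM jM′ (λ ()) jj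
  ... | p , refl , refl | g , refl , refl = move p false g (λ ()) (λ ()) no-line

  free : ¬ Embedding (Pat (lol 3) n) graph
  free em = EvenFree.absurd M n r (λ p → ∈-dom⁻ {M} (r-∈ p)) r-adj r-inj
    (≤-reflexive (trans (double+ 3 e) (cong suc (sym (rows+ 5 e))))) (≤-trans (m≤n+m 5 e) (m≤n+m (e + 5) e))
    where
    open Copied {mixed false} {lol 3} {dom M} {dom-unique M} em (0 , false , 0)

  hosts : Hosts n
  hosts = record
    { free = free
    ; flips = λ u v mu mv ne → realises-dom {D = Valid M M} {_∈ dom M} (∈-dom⁺ {M}) (flips u v (∈-dom⁻ {M} mu) (∈-dom⁻ {M} mv) ne)
    ; two = (0 , false , 0) , (0 , false , 1) , ∈-dom⁺ {M} (s≤s z≤n , s≤s z≤n , tt) , ∈-dom⁺ {M} (s≤s z≤n , s≤s (s≤s z≤n) , tt) , λ ()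
    }

module OddHost (e : ℕ) where
  open Shuffles true

  M n : ℕ
  M = 4 + e
  n = e + (e + 8)

  open Host (dom M) (dom-unique M)

  Goal : Cell → Cell → Set
  Goal u v = Realises (Valid M M) n (flip u v)

  anything : Cell → Bool
  anything _ = true

  grown : ∀ {u v} → row u < 4 → row v < 4 → Trail {u} {v} anything 4 4 8 → Goal u v
  grown {u} {v} ur vr t = subst (λ k → Realises (Valid k k) n (flip u v)) (+-comm e 4)
    (direct (grow e (λ _ _ _ _ _ → tt , tt) ur vr (s≤s (s≤s (s≤s z≤n))) (s≤s (s≤s (s≤s z≤n))) (s≤s (s≤s (s≤s z≤n))) t))

  closed : ∀ {u v} → row u < 4 → row v < 4 → col u ≡ 0 → row v ≢ 0 → Trail {u} {v} calm 4 4 7 → Goal u v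
  closed {u} {v} ur vr u0 v0 t = subst₂ (λ k l → Realises (Valid k k) l (flip u v)) (+-comm e 4) (bump e 7)
    (close tt u0 v0 (≤-trans (s≤s (s≤s (s≤s z≤n))) (≤-trans (m≤n+m 7 e) (m≤n+m (e + 7) e)))
      (grow e (calm-kept {u} {v}) ur vr (s≤s (s≤s (s≤s z≤n))) (s≤s (s≤s (s≤s z≤n))) (s≤s (s≤s (s≤s z≤n))) t))

  -- The symmetries leave eight kinds of pairs: three within row 0, two between row 0 and the rest,
  -- and three outside row 0.
  same-cell : Goal (0 , false , 0) (0 , true , 0)
  same-cell = grown (s≤s z≤n) (s≤s z≤n) (start anything 4 4 (3 , false , 3)
    ((3 , false , 2) ∷ (2 , false , 2) ∷ (2 , false , 1) ∷ (1 , false , 1) ∷ (1 , false , 0) ∷ (0 , true , 0) ∷ (0 , false , 0) ∷ []) tt)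

  same-sign : Goal (0 , false , 0) (0 , false , 1)
  same-sign = grown (s≤s z≤n) (s≤s z≤n) (start anything 4 4 (3 , false , 3)
    ((3 , false , 1) ∷ (0 , false , 1) ∷ (0 , false , 0) ∷ (2 , false , 0) ∷ (2 , false , 2) ∷ (1 , false , 2) ∷ (0 , false , 2) ∷ []) tt)

  signed-edge : Goal (0 , false , 0) (0 , true , 1)
  signed-edge = grown (s≤s z≤n) (s≤s z≤n) (start anything 4 4 (3 , false , 3)
    ((3 , false , 2) ∷ (0 , false , 2) ∷ (0 , true , 1) ∷ (2 , false , 1) ∷ (2 , false , 0) ∷ (1 , false , 0) ∷ (0 , false , 0) ∷ []) tt)

  mixed-off : Goal (0 , false , 0) (1 , false , 1)
  mixed-off = closed (s≤s z≤n) (s≤s (s≤s z≤n)) refl (λ ()) (start calm 4 4 (3 , false , 3)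
    ((3 , false , 2) ∷ (2 , false , 2) ∷ (2 , false , 1) ∷ (1 , false , 1) ∷ (1 , false , 0) ∷ (0 , false , 0) ∷ []) tt)

  plain-row : Goal (1 , false , 0) (1 , false , 1)
  plain-row = closed (s≤s (s≤s z≤n)) (s≤s (s≤s z≤n)) refl (λ ()) (start calm 4 4 (3 , false , 3)
    ((3 , false , 1) ∷ (1 , false , 1) ∷ (1 , false , 2) ∷ (1 , false , 0) ∷ (2 , false , 0) ∷ (0 , false , 0) ∷ []) tt)

  plain-column : Goal (1 , false , 0) (2 , false , 0)
  plain-column = closed (s≤s (s≤s z≤n)) (s≤s (s≤s (s≤s z≤n))) refl (λ ()) (start calm 4 4 (2 , false , 2)
    ((2 , false , 0) ∷ (0 , false , 0) ∷ (1 , false , 0) ∷ (1 , false , 1) ∷ (3 , false , 1) ∷ (0 , false , 1) ∷ []) tt)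

  plain-off : Goal (1 , false , 0) (2 , false , 1)
  plain-off = subst₂ (λ k l → Realises (Valid k k) l (flip u v)) (trans (cong suc (+-comm e 3)) refl)
      (trans (cong (3 +_) (bump e 4)) (trans (cong (2 +_) (bump e 5)) (trans (cong suc (bump e 6)) (bump e 7))))
    (tail₄ tt (λ ()) (λ ()) (≤-trans (s≤s (s≤s z≤n)) (m≤n+m 3 e)) (m≤n+m 3 e) (≤-trans (s≤s (s≤s (s≤s z≤n))) (≤-trans (m≤n+m 4 e) (m≤n+m (e + 4) e)))
      (grow e (off0-kept {u} {v}) (s≤s (s≤s z≤n)) ≤-refl ≤-refl ≤-refl (s≤s (s≤s (s≤s z≤n)))
        (start {u} {v} off0 3 3 (2 , false , 2) ((2 , false , 1) ∷ (1 , false , 1) ∷ (1 , false , 0) ∷ []) tt)))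
    where
    u v : Cell
    u = 1 , false , 0
    v = 2 , false , 1

-- `tail₆` consumes two fresh columns but no fresh row, so its trail starts on a 5 × 3 board and the
-- method begins with side 5; the copy for side 4 is explicit.
mixed-edge : ∀ e → OddHost.Goal e (0 , false , 0) (1 , false , 0)
mixed-edge zero = Kite.realises
  ((0 , false , 0) ∷ (0 , true , 3) ∷ (2 , false , 3) ∷ (0 , false , 3) ∷ (0 , true , 0) ∷ (1 , false , 0) ∷ (1 , false , 2) ∷ (1 , false , 1) ∷ []) tt
  (v 0 false 0 ∷ v 0 true 3 ∷ v 2 false 3 ∷ v 0 false 3 ∷ v 0 true 0 ∷ v 1 false 0 ∷ v 1 false 2 ∷ v 1 false 1 ∷ []) refl
  where
  v : ∀ i s j {p : T (i <ᵇ 4)} {q : T (j <ᵇ 4)} {a : T (allowed true (i , s , j))} → Kite.Valid true 4 4 (i , s , j)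
  v i s j {p} {q} {a} = <ᵇ⇒< i 4 p , <ᵇ⇒< j 4 q , a
mixed-edge (suc e) = subst₂ (λ k l → Realises (Valid k k) l (flip u v)) (+-comm e 5)
    (trans (cong (5 +_) (bump e 4)) (trans (cong (4 +_) (bump e 5)) (trans (cong (3 +_) (bump e 6)) (trans (cong (2 +_) (bump e 7)) (cong suc (sym (+-suc e (e + 8))))))))
    (realises-dom {D = Valid (e + 5) (2 + (e + 3))} {Valid (e + 5) (e + 5)} (valid-mono ≤-refl (≤-reflexive (trans (cong suc (sym (+-suc e 3))) (sym (+-suc e 4)))))
      (tail₆ tt (≤-trans (s≤s (s≤s (s≤s z≤n))) (m≤n+m 5 e)) (m≤n+m 3 e) (≤-trans (s≤s (s≤s (s≤s z≤n))) (≤-trans (m≤n+m 4 e) (m≤n+m (e + 4) e)))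
        (grow e (far-kept {u} {v}) (s≤s z≤n) (s≤s (s≤s z≤n)) (s≤s (s≤s (s≤s z≤n))) ≤-refl (s≤s (s≤s (s≤s z≤n)))
          (start {u} {v} far 5 3 (4 , false , 2) ((4 , false , 1) ∷ (3 , false , 1) ∷ (2 , false , 1) ∷ []) tt))))
  where
  open Kite true
  u v : Cell
  u = 0 , false , 0
  v = 1 , false , 0

module OddHosts (e : ℕ) where
  open OddHost e
  open Shuffles true
  open Host (dom M) (dom-unique M)

  private
    0<M : 0 < M
    0<M = s≤s z≤n
    1<M : 1 < M
    1<M = s≤s (s≤s z≤n)

  in-signed-row : ∀ s s′ {j j′} → j < M → j′ < M → _≢_ {A = Cell} (0 , s , j) (0 , s′ , j′) → Goal (0 , s , j) (0 , s′ , j′)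
  in-signed-row s s′ {j} {j′} jM jM′ ne with j ℕP.≟ j′
  ... | yes refl = cell s s′ (λ { refl → ne refl }) (place 0<M jM)
    where
    cell : ∀ s s′ → s ≢ s′ → Σ[ g ∈ Perm M ] fun g 0 ≡ j → Goal (0 , s , j) (0 , s′ , j)
    cell true true n _ = ⊥-elim (n refl)
    cell false false n _ = ⊥-elim (n refl)
    cell false true _ (g , refl) = move (lift (proj₁ (place {3 + e} {0} {0} (s≤s z≤n) (s≤s z≤n)))) false g (λ _ → refl) (λ ()) same-cell
    cell true false _ (g , refl) = move (lift (proj₁ (place {3 + e} {0} {0} (s≤s z≤n) (s≤s z≤n)))) true g (λ _ → refl) (λ _ → tt) same-cell
  ... | no jj = line s s′ (place₂ 0<M 1<M jM jM′ (λ ()) jj)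
    where
    p : Perm M
    p = lift (proj₁ (place {3 + e} {0} {0} (s≤s z≤n) (s≤s z≤n)))
    line : ∀ s s′ → Σ[ g ∈ Perm M ] (fun g 0 ≡ j × fun g 1 ≡ j′) → Goal (0 , s , j) (0 , s′ , j′)
    line false false (g , refl , refl) = move p false g (λ _ → refl) (λ ()) same-sign
    line true true (g , refl , refl) = move p true g (λ _ → refl) (λ _ → tt) same-sign
    line false true (g , refl , refl) = move p false g (λ _ → refl) (λ ()) signed-edge
    line true false (g , refl , refl) = move p true g (λ _ → refl) (λ _ → tt) signed-edge

  cross : ∀ s {i j j′} → i < 3 + e → j < M → j′ < M → Goal (0 , s , j) (suc i , false , j′)
  cross s {i} {j} {j′} iM jM jM′ with j ℕP.≟ j′ | place {3 + e} {0} {i} (s≤s z≤n) iM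
  ... | yes refl | p , refl = go s (place 0<M jM)
    where
    go : ∀ s → Σ[ g ∈ Perm M ] fun g 0 ≡ j → Goal (0 , s , j) (suc (fun p 0) , false , j)
    go false (g , refl) = move (lift p) false g (λ _ → refl) (λ ()) (mixed-edge e)
    go true (g , refl) = move (lift p) true g (λ _ → refl) (λ _ → tt) (mixed-edge e)
  ... | no jj | p , refl = go s (place₂ 0<M 1<M jM jM′ (λ ()) jj)
    where
    go : ∀ s → Σ[ g ∈ Perm M ] (fun g 0 ≡ j × fun g 1 ≡ j′) → Goal (0 , s , j) (suc (fun p 0) , false , j′)
    go false (g , refl , refl) = move (lift p) false g (λ _ → refl) (λ ()) mixed-off
    go true (g , refl , refl) = move (lift p) true g (λ _ → refl) (λ _ → tt) mixed-off

  plain : ∀ {i i′ j j′} → i < 3 + e → i′ < 3 + e → j < M → j′ < M → _≢_ {A = ℕ × ℕ} (i , j) (i′ , j′) → Goal (suc i , false , j) (suc i′ , false , j′)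
  plain {i} {i′} {j} {j′} iM iM′ jM jM′ ne with i ℕP.≟ i′ | j ℕP.≟ j′
  ... | yes refl | yes refl = ⊥-elim (ne refl)
  ... | yes refl | no jj with place {3 + e} {0} {i} (s≤s z≤n) iM | place₂ 0<M 1<M jM jM′ (λ ()) jj
  ...   | p , refl | g , refl , refl = move (lift p) false g (λ _ → refl) (λ ()) plain-row
  plain {i} {i′} {j} {j′} iM iM′ jM jM′ ne | no ii | yes refl
    with place₂ {3 + e} {0} {1} {i} {i′} (s≤s z≤n) (s≤s (s≤s z≤n)) iM iM′ (λ ()) ii | place 0<M jM
  ... | p , refl , refl | g , refl = move (lift p) false g (λ _ → refl) (λ ()) plain-column
  plain {i} {i′} {j} {j′} iM iM′ jM jM′ ne | no ii | no jj
    with place₂ {3 + e} {0} {1} {i} {i′} (s≤s z≤n) (s≤s (s≤s z≤n)) iM iM′ (λ ()) ii | place₂ 0<M 1<M jM jM′ (λ ()) jj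
  ... | p , refl , refl | g , refl , refl = move (lift p) false g (λ _ → refl) (λ ()) plain-off

  flips : ∀ u v → Valid M M u → Valid M M v → u ≢ v → Goal u v
  flips (zero , s , j) (zero , s′ , j′) (_ , jM , _) (_ , jM′ , _) ne = in-signed-row s s′ jM jM′ ne
  flips (zero , s , j) (suc i′ , false , j′) (_ , jM , _) (s≤s iM′ , jM′ , _) ne = cross s iM′ jM jM′
  flips (suc i , false , j) (zero , s′ , j′) (s≤s iM , jM , _) (_ , jM′ , _) ne = realises-swap (cross s′ iM jM′ jM)
  flips (suc i , false , j) (suc i′ , false , j′) (s≤s iM , jM , _) (s≤s iM′ , jM′ , _) ne = plain iM iM′ jM jM′ (λ { refl → ne refl })

  free : ¬ Embedding (Pat (lol 3) n) graph
  free em = OddFree.absurd M n r (λ p → ∈-dom⁻ {M} (r-∈ p)) r-adj r-inj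
    (trans (double+ 4 e) (sym (rows+ 8 e))) (≤-trans (s≤s (s≤s (s≤s (s≤s (s≤s z≤n))))) 8≤n) 8≤n
    where
    open Copied {mixed true} {lol 3} {dom M} {dom-unique M} em (0 , false , 0)
    8≤n : 8 ≤ n
    8≤n = ≤-trans (m≤n+m 8 e) (m≤n+m (e + 8) e)

  hosts : Hosts n
  hosts = record
    { free = free
    ; flips = λ u v mu mv ne → realises-dom {D = Valid M M} {_∈ dom M} (∈-dom⁺ {M}) (flips u v (∈-dom⁻ {M} mu) (∈-dom⁻ {M} mv) ne)
    ; two = (0 , false , 0) , (0 , false , 1) , ∈-dom⁺ {M} (s≤s z≤n , s≤s z≤n , tt) , ∈-dom⁺ {M} (s≤s z≤n , s≤s (s≤s z≤n) , tt) , λ ()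
    }

-- Differences not divisible by 3 give the complete tripartite graph with parts of size 3;
-- differences that are nonzero squares modulo 13 give the Paley graph of order 13.
tripartite paley : Raw
tripartite = circulant 9 (1 ∷ 2 ∷ 4 ∷ 5 ∷ 7 ∷ 8 ∷ [])
paley = circulant 13 (1 ∷ 3 ∷ 4 ∷ 9 ∷ 10 ∷ 12 ∷ [])

-- The path has length l + 1. The lengths 1 and 3 would correspond to signed boards of side 2 and 3,
-- below the eight vertices that the argument for those boards assumes.
kite-host : ∀ l {H} → H ≅ Pat (lol 3) (3 + suc l) → ∃[ G ] (Finite G × InducedSaturated H G)
kite-host l {H} iso with half l
... | zero , inj₁ refl = Realisation.Host.exists tripartite (lol 3) (upTo 9) (upTo⁺ 9) {4} {H} iso
      (Realisation.Host.searched tripartite (lol 3) (upTo 9) (upTo⁺ 9) 4 refl refl (0 , 1 , ∈-upTo⁺ (s≤s z≤n) , ∈-upTo⁺ (s≤s (s≤s z≤n)) , λ ()))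
... | suc zero , inj₁ refl = Realisation.Host.exists paley (lol 3) (upTo 13) (upTo⁺ 13) {6} {H} iso
      (Realisation.Host.searched paley (lol 3) (upTo 13) (upTo⁺ 13) 6 refl refl (0 , 1 , ∈-upTo⁺ (s≤s z≤n) , ∈-upTo⁺ (s≤s (s≤s z≤n)) , λ ()))
... | suc (suc e) , inj₁ refl = Realisation.Host.exists (mixed true) (lol 3) (Kite.dom true (4 + e)) (Kite.dom-unique true (4 + e)) {e + (e + 8)} {H}
      (subst (λ n → H ≅ Pat (lol 3) n) (trans (cong (4 +_) (double+ 2 e)) (sym (rows+ 8 e))) iso) (OddHosts.hosts e)
... | e , inj₂ refl = Realisation.Host.exists (mixed false) (lol 3) (Kite.dom false (3 + e)) (Kite.dom-unique false (3 + e)) {e + (e + 5)} {H}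
      (subst (λ n → H ≅ Pat (lol 3) n) (sym (rows+ 5 e)) iso) (EvenHost.hosts e)

IsCycleWithPath-host : ∀ H → IsCycleWithPath H → ∃[ G ] (Finite G × InducedSaturated H G)
IsCycleWithPath-host H L = by-lengths (IsCycleWithPath.cycleLength L) (IsCycleWithPath.pathLength L) (IsCycleWithPath.3≤length L) (IsCycleWithPath.nontrivial L) (Lollipop.iso L)
  where
  by-lengths : ∀ q l → 3 ≤ q → 1 ≤ l → H ≅ Pat (lol q) (q + l) → ∃[ G ] (Finite G × InducedSaturated H G)
  by-lengths (suc (suc (suc zero))) (suc l) _ _ iso = kite-host l iso
  by-lengths (suc (suc (suc (suc q)))) (suc l) _ _ iso = lollipop-host q l iso
  by-lengths (suc zero) _ (s≤s ()) _ _
  by-lengths (suc (suc zero)) _ (s≤s (s≤s ())) _ _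

proposition4 :
    (k : ℕ) → 3 ≤ k →
    (H : Graph) → Finite H →
    IsSpider k H ⊎ IsC̃ (2 * k + 1) H ⊎ IsCycleWithPath H →
    ∃[ G ] (Finite G × InducedSaturated H G)
proposition4 k 3≤k H _ (inj₁ S) = spider-host k 3≤k H S
proposition4 k 3≤k H _ (inj₂ (inj₁ C)) = IsC̃-host k 3≤k H C
proposition4 k 3≤k H _ (inj₂ (inj₂ L)) = IsCycleWithPath-host H L
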